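{- Let $\alpha\in(0,1)$ be a fixed constant. There is an algorithm that, given local access to a directed graph $G=(V,E)$ with $n$ nodes and $m$ edges, maximum in-degree $\Delta_{\mathrm{in}}$ and maximum out-degree $\Delta_{\mathrm{out}}$, together with a target node $t\in V$ and a parameter $\delta\in(0,1)$, computes a superset of the $\delta$-contributing set of $t$ without using the $\mathrm{JUMP}()$ query, with computational complexity $$O\left(\min\left(\frac{\Delta_{\mathrm{in}}}{\delta},\frac{\Delta_{\mathrm{out}}}{\delta},\frac{\sqrt{m}}{\delta},m\right)\right).$$
   Context: Graphs: $G=(V,E)$ is a directed graph with $n=|V|$, $m=|E|$, $E\subseteq V\times V$, in which every node has nonzero out-degree. If $(u,v)\in E$ then $u$ is a parent of $v$ and $v$ is a child of $u$. $d_{\mathrm{in}}(v)$ and $d_{\mathrm{out}}(v)$ are the in-degree and out-degree of $v$; $\Delta_{\mathrm{in}}=\max_{v}d_{\mathrm{in}}(v)$ and $\Delta_{\mathrm{out}}=\max_v d_{\mathrm{out}}(v)$. PageRank: the decay factor $\alpha\in(0,1)$ is a fixed constant (constants hidden in $O(\cdot)$ may depend on it). An $\alpha$-discounted random walk from $u$ starts at $u$, moves to a uniformly random child of the current node at each step, and has random length equal to $\ell$ with probability $\alpha(1-\alpha)^{\ell}$ for each $\ell\ge 0$. $\pi(u,v)$ is the probability that an $\alpha$-discounted random walk from $u$ terminates at $v$ (the PageRank contribution of $u$ to $v$). The PageRank score of $t$ is $\pi(t)=\frac1n\sum_{u\in V}\pi(u,t)$. The $\delta$-contributing set of $t$ is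 $\{v\in V\mid \pi(v,t)\ge \delta n\pi(t)\}$. Model (arc-centric graph-access model): computational complexity is measured in the standard RAM model, where the graph is accessed only through an oracle supporting in unit time the queries $\mathrm{INDEG}(v)$ (returns $d_{\mathrm{in}}(v)$), $\mathrm{OUTDEG}(v)$ (returns $d_{\mathrm{out}}(v)$), $\mathrm{PARENT}(v,i)$ (returns the $i$-th parent of $v$), $\mathrm{CHILD}(v,i)$ (returns the $i$-th child of $v$), and the global query $\mathrm{JUMP}()$ (returns a uniformly random node of $V$). "Without using $\mathrm{JUMP}()$" means only the other four (local) queries are used. The algorithm is given only $t$ and $\delta$; in particular $n\pi(t)$ is not assumed to be known. -}

module Defs where

open import Algebra.Bundles using (CommutativeRing; module Semiring)
open import Data.Bool using (Bool; true; if_then_else_)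
open import Data.Fin using (Fin; toℕ)
import Data.Fin.Properties as Fin
open import Data.Fin.Subset using (Subset; _∈_; ∣_∣)
open import Data.List as List using (List; []; _∷_)
open import Data.List.Extrema.Nat using (max)
import Data.List.Membership.Propositional as ListMembership
open import Data.Nat as ℕ using (ℕ; zero; suc; NonZero)
import Data.Nat.ListAction as ListAction
open import Data.Product using (_×_; _,_; proj₁; Σ; ∃; ∃-syntax)
import Data.Vec as Vec
open import Function using (_⤖_; module Bijection)
open import Function.Definitions using (Injective)
open import Level using (Level; _⊔_) renaming (suc to lsuc)
open import Relation.Binary.Bundles using (TotalOrder)
open import Relation.Binary.Core using (Rel)
open import Relation.Binary.PropositionalEquality using (_≡_)
open import Relation.Binary.Structures using (IsDecTotalOrder)
open import Relation.Nullary using (¬_)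
open import Relation.Nullary.Decidable using (⌊_⌋)

------------------------------------------------------------------------
-- Real numbers

record OrderedField (c ℓ₁ ℓ₂ : Level) : Set (lsuc (c ⊔ ℓ₁ ⊔ ℓ₂)) where
  infix  8 _⁻¹
  infixl 7 _/_
  infix  4 _≤_
  field
    commutativeRing : CommutativeRing c ℓ₁

  open CommutativeRing commutativeRing public
    renaming (Carrier to ℝ)

  field
    0≉1             : ¬ (0# ≈ 1#)
    -- The value of 0# ⁻¹ is unspecified.
    _⁻¹             : ℝ → ℝ
    ⁻¹-cong         : ∀ {x y} → x ≈ y → x ⁻¹ ≈ y ⁻¹
    ⁻¹-inverseʳ     : ∀ x → ¬ (x ≈ 0#) → x * x ⁻¹ ≈ 1#
    _≤_             : Rel ℝ ℓ₂
    isDecTotalOrder : IsDecTotalOrder _≈_ _≤_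
    +-monoˡ-≤       : ∀ {x y} z → x ≤ y → x + z ≤ y + z
    *-nonNeg        : ∀ {x y} → 0# ≤ x → 0# ≤ y → 0# ≤ x * y

  open IsDecTotalOrder isDecTotalOrder public
    using (isTotalOrder; _≟_; _≤?_)

  totalOrder : TotalOrder c ℓ₁ ℓ₂
  totalOrder = record { isTotalOrder = isTotalOrder }

  open import Algebra.Construct.NaturalChoice.Min totalOrder public
    using (_⊓_)
  open import Relation.Binary.Construct.NonStrictToStrict _≈_ _≤_ public
    using (_<_)
  open import Algebra.Definitions.RawSemiring
    (Semiring.rawSemiring semiring) public
    using (sum; _^_) renaming (_×_ to _×ℝ_)

  fromℕ : ℕ → ℝ
  fromℕ n = n ×ℝ 1#

  _/_ : ℝ → ℝ → ℝ
  x / y = x * y ⁻¹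

  IsSqrt : ℝ → ℝ → Set (ℓ₁ ⊔ ℓ₂)
  IsSqrt x s = 0# ≤ s × s * s ≈ x

  Converges : (ℕ → ℝ) → ℝ → Set (c ⊔ ℓ₁ ⊔ ℓ₂)
  Converges a x = ∀ ε → 0# < ε →
    ∃[ N ] (∀ k → N ℕ.≤ k → a k ≤ x + ε × x ≤ a k + ε)

  -- No absolute value is needed: i and j may be exchanged.
  Cauchy : (ℕ → ℝ) → Set (c ⊔ ℓ₁ ⊔ ℓ₂)
  Cauchy a = ∀ ε → 0# < ε →
    ∃[ N ] (∀ i j → N ℕ.≤ i → N ℕ.≤ j → a i ≤ a j + ε)

  HasSum : (ℕ → ℝ) → ℝ → Set (c ⊔ ℓ₁ ⊔ ℓ₂)
  HasSum f = Converges λ k → sum {k} λ i → f (toℕ i)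

-- The axioms of a Cauchy-complete Archimedean ordered field; classically
-- ℝ is the unique model up to isomorphism.  The order is decidable, as
-- a machine branching on comparisons of reals requires.
record RealField (c ℓ₁ ℓ₂ : Level) : Set (lsuc (c ⊔ ℓ₁ ⊔ ℓ₂)) where
  field
    orderedField : OrderedField c ℓ₁ ℓ₂

  open OrderedField orderedField public

  field
    archimedean : ∀ x → ∃[ n ] x ≤ fromℕ n
    complete    : ∀ a → Cauchy a → ∃[ x ] Converges a x

------------------------------------------------------------------------
-- Directed graphs

record DiGraph : Set where
  field
    n : ℕ

  V : Set
  V = Fin n

  field
    edge : V → V → Bool

  children : V → Subset n
  children u = Vec.tabulate λ v → edge u v

  outdeg : V → ℕ
  outdeg v = ∣ children v ∣

  field
    outdeg-nonZero : ∀ v → NonZero (outdeg v)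

  parents : V → Subset n
  parents v = Vec.tabulate λ u → edge u v

  indeg : V → ℕ
  indeg v = ∣ parents v ∣

  m Δin Δout : ℕ
  m    = ListAction.sum (List.tabulate outdeg)
  Δin  = max 0 (List.tabulate indeg)
  Δout = max 0 (List.tabulate outdeg)

-- How a graph is presented to an algorithm: arbitrary distinct names for
-- the nodes and arbitrary orderings of the parents and children of each
-- node.  As names need not be an initial segment of ℕ, an algorithm that
-- has to work for every presentation can only reach nodes through
-- queries.  Parents and children are indexed from 0.
record Access (G : DiGraph) : Set where
  open DiGraph G
  field
    name           : V → ℕ
    name-injective : Injective _≡_ _≡_ name
    parents-enum   : ∀ v → Fin (indeg v) ⤖ Σ V (_∈ parents v)
    children-enum  : ∀ v → Fin (outdeg v) ⤖ Σ V (_∈ children v)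

  parent : ∀ v → Fin (indeg v) → V
  parent v i = proj₁ (Bijection.to (parents-enum v) i)

  child : ∀ v → Fin (outdeg v) → V
  child v i = proj₁ (Bijection.to (children-enum v) i)

------------------------------------------------------------------------
-- Programs of a random access machine with graph queries

-- The memory consists of cells X 0, X 1, … holding naturals and cells
-- Y 0, Y 1, … holding exact reals.  Naturals are only added and
-- subtracted, and reals cannot be rounded, so unit-cost arithmetic cannot
-- be used to manipulate packed words.  An operand is the index of a cell,
-- except for the literal k of set i k; the first one is the destination
-- (the source for emit), which is indirect in store and storeR.  The real
-- constant α is built in, and JUMP() is not among the instructions.
data Instr : Set where
  set                 : (i k : ℕ) → Instr
  add sub             : (i j k : ℕ) → Instr
  load store          : (i j : ℕ) → Instr
  cast                : (i j : ℕ) → Instr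
  decay               : (i : ℕ) → Instr
  addR subR mulR divR : (i j k : ℕ) → Instr
  loadR storeR        : (i j : ℕ) → Instr
  leqR                : (i j k : ℕ) → Instr
  INDEG OUTDEG        : (i j : ℕ) → Instr
  PARENT CHILD        : (i j k : ℕ) → Instr
  emit                : (i : ℕ) → Instr

infixr 5 _⨟_

data Program : Set where
  skip  : Program
  instr : Instr → Program
  _⨟_   : Program → Program → Program
  ifnz  : (i : ℕ) → Program → Program → Program
  while : (i : ℕ) → Program → Program

_[_↦_] : ∀ {a} {A : Set a} → (ℕ → A) → ℕ → A → (ℕ → A)
(f [ i ↦ x ]) j = if ⌊ j ℕ.≟ i ⌋ then x else f j

module _ {c ℓ₁ ℓ₂ : Level} (R : RealField c ℓ₁ ℓ₂) where
  open RealField R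

  ----------------------------------------------------------------------
  -- PageRank

  module PageRank (α : ℝ) (G : DiGraph) where
    open DiGraph G

    stepProb : V → V → ℝ
    stepProb u v = if edge u v then 1# / fromℕ (outdeg u) else 0#

    -- walkProb ℓ u v is the probability that a walk of exactly ℓ steps
    -- from u ends at v.
    walkProb : ℕ → V → V → ℝ
    walkProb zero    u v = if ⌊ u Fin.≟ v ⌋ then 1# else 0#
    walkProb (suc ℓ) u v = sum λ w → stepProb u w * walkProb ℓ w v

    -- π u v is the probability that an α-discounted walk from u
    -- terminates at v, by conditioning on the length of the walk.
    IsContribution : (V → V → ℝ) → Set (c ⊔ ℓ₁ ⊔ ℓ₂)
    IsContribution π = ∀ u v →
      HasSum (λ ℓ → (α * (1# - α) ^ ℓ) * walkProb ℓ u v) (π u v)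

    score : (V → V → ℝ) → V → ℝ
    score π t = 1# / fromℕ n * sum λ u → π u t

    -- Membership of v in the δ-contributing set of t.
    Contributing : (V → V → ℝ) → ℝ → V → V → Set ℓ₂
    Contributing π δ t v = δ * fromℕ n * score π t ≤ π v t

  ----------------------------------------------------------------------
  -- Executions

  module Machine (α : ℝ) {G : DiGraph} (A : Access G) where
    open DiGraph G
    open Access A

    record State : Set c where
      constructor ⟪_,_,_⟫
      field
        X      : ℕ → ℕ
        Y      : ℕ → ℝ
        output : List V

    open State public

    -- An instruction with an invalid operand (division by zero, a query
    -- about something that is not the name of a node, an index that is
    -- too large) has no transition: the machine is stuck.
    infix 3 _⊢_⟶_

    data _⊢_⟶_ : Instr → State → State → Set (c ⊔ ℓ₁ ⊔ ℓ₂) where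
      set    : ∀ {i k X Y o} →
               set i k ⊢ ⟪ X , Y , o ⟫ ⟶ ⟪ X [ i ↦ k ] , Y , o ⟫
      add    : ∀ {i j k X Y o} →
               add i j k ⊢ ⟪ X , Y , o ⟫ ⟶ ⟪ X [ i ↦ X j ℕ.+ X k ] , Y , o ⟫
      sub    : ∀ {i j k X Y o} →
               sub i j k ⊢ ⟪ X , Y , o ⟫ ⟶ ⟪ X [ i ↦ X j ℕ.∸ X k ] , Y , o ⟫
      load   : ∀ {i j X Y o} →
               load i j ⊢ ⟪ X , Y , o ⟫ ⟶ ⟪ X [ i ↦ X (X j) ] , Y , o ⟫
      store  : ∀ {i j X Y o} →
               store i j ⊢ ⟪ X , Y , o ⟫ ⟶ ⟪ X [ X i ↦ X j ] , Y , o ⟫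
      cast   : ∀ {i j X Y o} →
               cast i j ⊢ ⟪ X , Y , o ⟫ ⟶ ⟪ X , Y [ i ↦ fromℕ (X j) ] , o ⟫
      decay  : ∀ {i X Y o} →
               decay i ⊢ ⟪ X , Y , o ⟫ ⟶ ⟪ X , Y [ i ↦ α ] , o ⟫
      addR   : ∀ {i j k X Y o} →
               addR i j k ⊢ ⟪ X , Y , o ⟫ ⟶ ⟪ X , Y [ i ↦ Y j + Y k ] , o ⟫
      subR   : ∀ {i j k X Y o} →
               subR i j k ⊢ ⟪ X , Y , o ⟫ ⟶ ⟪ X , Y [ i ↦ Y j - Y k ] , o ⟫
      mulR   : ∀ {i j k X Y o} →
               mulR i j k ⊢ ⟪ X , Y , o ⟫ ⟶ ⟪ X , Y [ i ↦ Y j * Y k ] , o ⟫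
      divR   : ∀ {i j k X Y o} → ¬ (Y k ≈ 0#) →
               divR i j k ⊢ ⟪ X , Y , o ⟫ ⟶ ⟪ X , Y [ i ↦ Y j / Y k ] , o ⟫
      loadR  : ∀ {i j X Y o} →
               loadR i j ⊢ ⟪ X , Y , o ⟫ ⟶ ⟪ X , Y [ i ↦ Y (X j) ] , o ⟫
      storeR : ∀ {i j X Y o} →
               storeR i j ⊢ ⟪ X , Y , o ⟫ ⟶ ⟪ X , Y [ X i ↦ Y j ] , o ⟫
      leqR   : ∀ {i j k X Y o} →
               leqR i j k ⊢ ⟪ X , Y , o ⟫ ⟶
               ⟪ X [ i ↦ if ⌊ Y j ≤? Y k ⌋ then 1 else 0 ] , Y , o ⟫
      INDEG  : ∀ {i j X Y o v} → X j ≡ name v →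
               INDEG i j ⊢ ⟪ X , Y , o ⟫ ⟶ ⟪ X [ i ↦ indeg v ] , Y , o ⟫
      OUTDEG : ∀ {i j X Y o v} → X j ≡ name v →
               OUTDEG i j ⊢ ⟪ X , Y , o ⟫ ⟶ ⟪ X [ i ↦ outdeg v ] , Y , o ⟫
      PARENT : ∀ {i j k X Y o v p} → X j ≡ name v → X k ≡ toℕ p →
               PARENT i j k ⊢ ⟪ X , Y , o ⟫ ⟶
               ⟪ X [ i ↦ name (parent v p) ] , Y , o ⟫
      CHILD  : ∀ {i j k X Y o v p} → X j ≡ name v → X k ≡ toℕ p →
               CHILD i j k ⊢ ⟪ X , Y , o ⟫ ⟶
               ⟪ X [ i ↦ name (child v p) ] , Y , o ⟫
      emit   : ∀ {i X Y o v} → X i ≡ name v →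
               emit i ⊢ ⟪ X , Y , o ⟫ ⟶ ⟪ X , Y , v ∷ o ⟫

    -- P ⊢ s ⇓[ T ] s′: started in s, the program P terminates in s′ after
    -- T steps, where every instruction and every evaluation of a test
    -- counts as one step.
    infix 3 _⊢_⇓[_]_

    data _⊢_⇓[_]_ : Program → State → ℕ → State → Set (c ⊔ ℓ₁ ⊔ ℓ₂) where
      skip    : ∀ {s} → skip ⊢ s ⇓[ 0 ] s
      instr   : ∀ {I s s′} → I ⊢ s ⟶ s′ → instr I ⊢ s ⇓[ 1 ] s′
      seq     : ∀ {P Q s s′ s″ T T′} →
                P ⊢ s ⇓[ T ] s′ → Q ⊢ s′ ⇓[ T′ ] s″ →
                P ⨟ Q ⊢ s ⇓[ T ℕ.+ T′ ] s″
      if-nz   : ∀ {i P Q s s′ T} → NonZero (X s i) →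
                P ⊢ s ⇓[ T ] s′ → ifnz i P Q ⊢ s ⇓[ suc T ] s′
      if-z    : ∀ {i P Q s s′ T} → X s i ≡ 0 →
                Q ⊢ s ⇓[ T ] s′ → ifnz i P Q ⊢ s ⇓[ suc T ] s′
      while-nz : ∀ {i P s s′ s″ T T′} → NonZero (X s i) →
                P ⊢ s ⇓[ T ] s′ → while i P ⊢ s′ ⇓[ T′ ] s″ →
                while i P ⊢ s ⇓[ suc (T ℕ.+ T′) ] s″
      while-z : ∀ {i P s} → X s i ≡ 0 → while i P ⊢ s ⇓[ 1 ] s

    -- The input is t (by name) in X 0 and δ in Y 0; all other cells are 0.
    initial : V → ℝ → State
    initial t δ = ⟪ (λ _ → 0) [ 0 ↦ name t ] , (λ _ → 0#) [ 0 ↦ δ ] , [] ⟫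

  ----------------------------------------------------------------------
  -- Correctness and complexity

  -- On the given graph, target and parameter, P terminates after at most
  -- bound steps, having output a superset of the δ-contributing set of t.
  ComputesSupersetWithin :
    (α : ℝ) (P : Program) {G : DiGraph} (A : Access G) →
    (π : DiGraph.V G → DiGraph.V G → ℝ) (t : DiGraph.V G) (δ bound : ℝ) →
    Set (c ⊔ ℓ₁ ⊔ ℓ₂)
  ComputesSupersetWithin α P {G} A π t δ bound =
    ∃[ T ] ∃[ s ] (P ⊢ initial t δ ⇓[ T ] s)
                × fromℕ T ≤ bound
                × (∀ v → Contributing π δ t v → v ∈ₗ output s)
    where
    open PageRank α G
    open Machine α A
    open ListMembership renaming (_∈_ to _∈ₗ_)

{-# OPTIONS --safe #-}
module Submission where

-- Two explorations of the ancestors of t run in lockstep, and every node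
-- that either of them meets is output.  The first is a backward
-- depth-first search; when it ends, after O(m) steps, all nodes with a
-- nonzero contribution have been output.
--
-- The second is a backward push with a threshold x that starts at 1 and is
-- halved whenever all residues are at most x.  Let q u be the mass pushed
-- from u, r u its residue, and S the sum of all q u + r u.  Since
-- α (q u + r u) ≤ π(u,t) ≤ α q u + 2 x, we have α S ≤ n π(t), and once
-- 2 x < δ α S every contributing node has been pushed.  While 2 x ≥ δ α S,
-- the number of edges traversed is at most F / x, where F is the mass that
-- has crossed edges, counted with multiplicity.  As F = O(K S) for K any of
-- Δin, Δout and √m, this is O(K / δ), although n π(t) is not known.  The
-- test is repeated after each edge because a single push can increase S
-- beyond any bound.

open import Defs
open import Algebra.Bundles using (CommutativeMonoid)
import Algebra.Definitions.RawMonoid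
open import Data.Bool using (Bool; true; false; if_then_else_; T)
open import Data.Fin using (Fin; zero; suc; toℕ; fromℕ<)
import Data.Fin.Properties as Fin
open import Data.Fin.Subset as Subset using (∣_∣)
open import Data.List as List using (List; []; _∷_)
open import Data.List.Membership.Propositional using (_∈_)
import Data.List.Membership.Propositional.Properties as List
open import Data.List.Relation.Unary.All as All using (All)
open import Data.List.Relation.Unary.Any using (here; there)
open import Data.Nat as ℕ using (ℕ; zero; suc; z≤n; s≤s; NonZero; _<ᵇ_)
import Data.Nat.DivMod as ℕ
import Data.Nat.ListAction as ListAction
import Data.Nat.Properties as ℕ
open import Data.Nat.Solver using (module +-*-Solver)
import Data.List.Extrema ℕ.≤-totalOrder as Extrema
open import Data.Product using (_×_; _,_; proj₁; proj₂; Σ; ∃; ∃-syntax)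
open import Data.Sum using (_⊎_; inj₁; inj₂)
open import Data.Unit using (⊤; tt)
open import Data.Vec as Vec using (Vec; []; _∷_)
open import Data.Vec.Functional using (updateAt)
open import Data.Vec.Functional.Properties using (updateAt-updates; updateAt-minimal)
import Data.Vec.Properties as Vec
import Data.Vec.Properties.WithK as Vec
open import Function using (_∘_; module Bijection)
open import Level using (Level; _⊔_; Lift)
open import Relation.Binary.Bundles using (TotalOrder)
open import Relation.Binary.PropositionalEquality as ≡ using (_≡_; _≢_)
open import Relation.Nullary using (¬_; yes; no; contradiction)
open import Relation.Nullary.Decidable using (⌊_⌋)

-- The series defining `π` serves only to derive the linear equation `π(u,t) = α [u = t] + (1 - α)
-- (average of π(w,t) over the children w of u)`. From there on, contributions are compared with
-- sub- and supersolutions of this equation, at a node where the difference is smallest.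
--
-- Names are arbitrary, so nodes with a large residue can only be found through a list of the nodes
-- met, and lowering `x` forces a rescan of that list. Summing the cost over all thresholds is
-- avoided by measuring steps in units of the current `x`. Put `Z = 2 S + F`, and let `k` be the
-- length of the list and `i` the number of entries scanned. Each entry after the first stems from
-- an edge crossed by at least `x`, whence `k x ≤ Z`; and `N` steps satisfy `N x ≤ (k + i) x + Z`.
-- At `i = k` the right side is at most `k x + 2 Z` up to the step itself, so halving `x` restores
-- the inequality with `i = 0`.
--
-- Hence `N x ≤ 3 Z = O(K S)`, and `S` cancels against `δ α S ≤ 2 x`. Running in lockstep yields the
-- smaller of the two costs although neither is known in advance.

-- Finite sums and ordered fields

module SumUpdate {c ℓ : Level} (M : CommutativeMonoid c ℓ) where

  open CommutativeMonoid M
  open import Algebra.Properties.CommutativeMonoid.Sum M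
  open import Algebra.Properties.CommutativeSemigroup commutativeSemigroup
    using (x∙yz≈y∙xz)

  -- One step of either exploration alters a sum over the nodes in a single term. Over the reals
  -- this updates mass and flow, over the naturals the remaining work of the search.
  sum-bump : ∀ {n d} {f g : Fin n → Carrier} i → f i ≈ d ∙ g i →
             (∀ j → j ≢ i → f j ≈ g j) → sum f ≈ d ∙ sum g
  sum-bump zero fi rest =
    trans (∙-cong fi (sum-cong-≋ λ j → rest (suc j) λ ())) (assoc _ _ _)
  sum-bump (suc i) fi rest =
    trans (∙-cong (rest zero λ ())
             (sum-bump i fi λ j j≢i → rest (suc j) (j≢i ∘ Fin.suc-injective)))
          (x∙yz≈y∙xz _ _ _)

module OrderedFieldProperties {c ℓ₁ ℓ₂ : Level} (F : OrderedField c ℓ₁ ℓ₂) where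

  open OrderedField F hiding (zero)
  open TotalOrder totalOrder public using (poset)
    renaming (refl to ≤-refl; reflexive to ≤-reflexive; trans to ≤-trans;
              antisym to ≤-antisym; total to ≤-total;
              ≤-respˡ-≈ to ≤-respˡ; ≤-respʳ-≈ to ≤-respʳ)
  open import Relation.Binary.Reasoning.PartialOrder poset public
  open import Algebra.Solver.Ring.NaturalCoefficients.Default
    commutativeSemiring public
    using (solve; _:=_; _:+_; _:*_; con; Polynomial)
  open import Algebra.Properties.Ring ring
    using (-‿distribˡ-*; -‿involutive)
  open import Algebra.Properties.Semiring.Sum semiring
    using (sum-cong-≋; sum-replicate-zero)
  open import Algebra.Properties.Monoid.Mult +-monoid
    using (×-homo-+)
  open import Algebra.Properties.Semiring.Mult semiring
    using (×1-homo-*)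
  open import Algebra.Construct.NaturalChoice.Min totalOrder using (⊓-sel)

  -- A sum of ones ending in zero, so that its evaluation is `fromℕ k` by definition and the solver
  -- applies to bounds written with literals.
  numeral : ∀ {n} → ℕ → Polynomial n
  numeral zero    = con 0
  numeral (suc k) = con 1 :+ numeral k

  ≰⇒≥ : ∀ {x y} → ¬ x ≤ y → y ≤ x
  ≰⇒≥ {x} {y} x≰y with ≤-total x y
  ... | inj₁ x≤y = contradiction x≤y x≰y
  ... | inj₂ y≤x = y≤x

  <⇒≱ : ∀ {x y} → x < y → ¬ y ≤ x
  <⇒≱ (x≤y , x≉y) y≤x = x≉y (≤-antisym x≤y y≤x)

  <⇒≉0 : ∀ {x} → 0# < x → ¬ x ≈ 0#
  <⇒≉0 (_ , 0≉x) x≈0 = 0≉x (sym x≈0)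

  +-mono-≤ : ∀ {a b x y} → a ≤ b → x ≤ y → a + x ≤ b + y
  +-mono-≤ {a} {b} {x} {y} a≤b x≤y = begin
    a + x  ≤⟨ +-monoˡ-≤ x a≤b ⟩
    b + x  ≈⟨ +-comm b x ⟩
    x + b  ≤⟨ +-monoˡ-≤ b x≤y ⟩
    y + b  ≈⟨ +-comm y b ⟩
    b + y  ∎

  +-monoʳ-≤ : ∀ z {x y} → x ≤ y → z + x ≤ z + y
  +-monoʳ-≤ z = +-mono-≤ ≤-refl

  +-cancelʳ-≤ : ∀ z {x y} → x + z ≤ y + z → x ≤ y
  +-cancelʳ-≤ z {x} {y} x+z≤y+z = begin
    x              ≈⟨ lemma x ⟨
    x + z + - z    ≤⟨ +-monoˡ-≤ (- z) x+z≤y+z ⟩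
    y + z + - z    ≈⟨ lemma y ⟩
    y              ∎
    where
    lemma : ∀ w → w + z + - z ≈ w
    lemma w = trans (+-assoc w z (- z))
                (trans (+-congˡ (-‿inverseʳ z)) (+-identityʳ w))

  +-cancelˡ-≤ : ∀ z {x y} → z + x ≤ z + y → x ≤ y
  +-cancelˡ-≤ z {x} {y} z+x≤z+y = +-cancelʳ-≤ z (begin
    x + z  ≈⟨ +-comm x z ⟩
    z + x  ≤⟨ z+x≤z+y ⟩
    z + y  ≈⟨ +-comm z y ⟩
    y + z  ∎)

  +-nonNeg : ∀ {x y} → 0# ≤ x → 0# ≤ y → 0# ≤ x + y
  +-nonNeg 0≤x 0≤y = ≤-respˡ (+-identityˡ 0#) (+-mono-≤ 0≤x 0≤y)

  x≤x+y : ∀ {x y} → 0# ≤ y → x ≤ x + y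
  x≤x+y {x} 0≤y = ≤-respˡ (+-identityʳ x) (+-monoʳ-≤ x 0≤y)

  x≤y+x : ∀ {x y} → 0# ≤ y → x ≤ y + x
  x≤y+x {x} 0≤y = ≤-respˡ (+-identityˡ x) (+-monoˡ-≤ x 0≤y)

  ≤⇒∃+ : ∀ {x y} → x ≤ y → ∃[ d ] 0# ≤ d × x + d ≈ y
  ≤⇒∃+ {x} {y} x≤y = - x + y ,
    ≤-respˡ (-‿inverseˡ x) (+-monoʳ-≤ (- x) x≤y) ,
    trans (sym (+-assoc x (- x) y))
      (trans (+-congʳ (-‿inverseʳ x)) (+-identityˡ y))

  *-monoˡ-≤ : ∀ {z} → 0# ≤ z → ∀ {x y} → x ≤ y → z * x ≤ z * y
  *-monoˡ-≤ {z} 0≤z {x} {y} x≤y with ≤⇒∃+ x≤y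
  ... | d , 0≤d , x+d≈y = begin
    z * x          ≤⟨ x≤x+y (*-nonNeg 0≤z 0≤d) ⟩
    z * x + z * d  ≈⟨ distribˡ z x d ⟨
    z * (x + d)    ≈⟨ *-congˡ x+d≈y ⟩
    z * y          ∎

  *-monoʳ-≤ : ∀ {z} → 0# ≤ z → ∀ {x y} → x ≤ y → x * z ≤ y * z
  *-monoʳ-≤ {z} 0≤z {x} {y} x≤y = begin
    x * z  ≈⟨ *-comm x z ⟩
    z * x  ≤⟨ *-monoˡ-≤ 0≤z x≤y ⟩
    z * y  ≈⟨ *-comm z y ⟩
    y * z  ∎

  *-cancelˡ-≤ : ∀ {z} → 0# < z → ∀ {x y} → z * x ≤ z * y → x ≤ y
  *-cancelˡ-≤ {z} 0<z {x} {y} zx≤zy with x ≤? y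
  ... | yes x≤y = x≤y
  ... | no  x≰y = ≤-reflexive (begin-equality
    x                ≈⟨ lemma x ⟨
    z ⁻¹ * (z * x)   ≈⟨ *-congˡ (≤-antisym zx≤zy (*-monoˡ-≤ (proj₁ 0<z) (≰⇒≥ x≰y))) ⟩
    z ⁻¹ * (z * y)   ≈⟨ lemma y ⟩
    y                ∎)
    where
    lemma : ∀ w → z ⁻¹ * (z * w) ≈ w
    lemma w = begin-equality
      z ⁻¹ * (z * w)  ≈⟨ solve 3 (λ i z w → i :* (z :* w) := (z :* i) :* w) refl (z ⁻¹) z w ⟩
      z * z ⁻¹ * w    ≈⟨ *-congʳ (⁻¹-inverseʳ z (<⇒≉0 0<z)) ⟩
      1# * w          ≈⟨ *-identityˡ w ⟩
      w               ∎

  0≤1 : 0# ≤ 1#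
  0≤1 with ≤-total 0# 1#
  ... | inj₁ 0≤1# = 0≤1#
  ... | inj₂ 1≤0 = begin
    0#             ≤⟨ *-nonNeg 0≤-1 0≤-1 ⟩
    - 1# * - 1#    ≈⟨ -‿distribˡ-* 1# (- 1#) ⟨
    - (1# * - 1#)  ≈⟨ -‿cong (*-identityˡ (- 1#)) ⟩
    - (- 1#)       ≈⟨ -‿involutive 1# ⟩
    1#             ∎
    where
    0≤-1 : 0# ≤ - 1#
    0≤-1 = begin
      0#         ≈⟨ -‿inverseʳ 1# ⟨
      1# + - 1#  ≤⟨ +-monoˡ-≤ (- 1#) 1≤0 ⟩
      0# + - 1#  ≈⟨ +-identityˡ (- 1#) ⟩
      - 1#       ∎

  0<1 : 0# < 1#
  0<1 = 0≤1 , 0≉1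

  *-positive : ∀ {x y} → 0# < x → 0# < y → 0# < x * y
  *-positive {x} {y} 0<x 0<y =
    *-nonNeg (proj₁ 0<x) (proj₁ 0<y) , λ 0≈xy →
    <⇒≱ 0<y (*-cancelˡ-≤ 0<x (≤-reflexive (trans (sym 0≈xy) (sym (zeroʳ x)))))

  <-≤-trans : ∀ {x y z} → x < y → y ≤ z → x < z
  <-≤-trans x<y y≤z =
    ≤-trans (proj₁ x<y) y≤z , λ x≈z → <⇒≱ x<y (≤-respʳ (sym x≈z) y≤z)

  ⁻¹-positive : ∀ {x} → 0# < x → 0# < x ⁻¹
  ⁻¹-positive {x} 0<x = *-cancelˡ-≤ 0<x (begin
      x * 0#    ≈⟨ zeroʳ x ⟩
      0#        ≤⟨ 0≤1 ⟩
      1#        ≈⟨ inverse ⟨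
      x * x ⁻¹  ∎) ,
    λ 0≈x⁻¹ → 0≉1 (begin-equality
      0#        ≈⟨ zeroʳ x ⟨
      x * 0#    ≈⟨ *-congˡ 0≈x⁻¹ ⟩
      x * x ⁻¹  ≈⟨ inverse ⟩
      1#        ∎)
    where
    inverse = ⁻¹-inverseʳ x (<⇒≉0 0<x)

  -- The slack is doubled because the limits on both sides of an equation are replaced by
  -- truncations. If `x` exceeded `y` by `d > 0`, the hypothesis would fail at `ε = d / 3`.
  ∀ε⇒≤ : ∀ {x y} → (∀ ε → 0# < ε → x ≤ y + (ε + ε)) → x ≤ y
  ∀ε⇒≤ {x} {y} h with x ≤? y
  ... | yes x≤y = x≤y
  ... | no  x≰y with ≤⇒∃+ (≰⇒≥ x≰y)
  ...   | d , 0≤d , y+d≈x = contradiction (≤-reflexive x≈y) x≰y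
    where
    3# = 1# + (1# + 1#)
    0<3 : 0# < 3#
    0<3 = <-≤-trans 0<1 (x≤x+y (+-nonNeg 0≤1 0≤1))
    ε = d * 3# ⁻¹
    d≈3ε : d ≈ ε + (ε + ε)
    d≈3ε = begin-equality
      d                ≈⟨ *-identityʳ d ⟨
      d * 1#           ≈⟨ *-congˡ (⁻¹-inverseʳ 3# (<⇒≉0 0<3)) ⟨
      d * (3# * 3# ⁻¹)
        ≈⟨ solve 2 (λ d i → d :* ((con 1 :+ (con 1 :+ con 1)) :* i)
                          := d :* i :+ (d :* i :+ d :* i)) refl d (3# ⁻¹) ⟩
      ε + (ε + ε)      ∎
    0≤ε : 0# ≤ ε
    0≤ε = *-nonNeg 0≤d (proj₁ (⁻¹-positive 0<3))
    x≈y : x ≈ y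
    x≈y with ε ≤? 0#
    ... | yes ε≤0 = let ε≈0 = ≤-antisym ε≤0 0≤ε in begin-equality
      x                 ≈⟨ y+d≈x ⟨
      y + d             ≈⟨ +-congˡ d≈3ε ⟩
      y + (ε + (ε + ε)) ≈⟨ +-congˡ (+-cong ε≈0 (+-cong ε≈0 ε≈0)) ⟩
      y + (0# + (0# + 0#)) ≈⟨ solve 1 (λ y → y :+ (con 0 :+ (con 0 :+ con 0)) := y) refl y ⟩
      y                 ∎
    ... | no ε≰0 = contradiction (+-cancelʳ-≤ (y + (ε + ε)) (begin
      ε + (y + (ε + ε))  ≈⟨ solve 2 (λ y ε → ε :+ (y :+ (ε :+ ε)) := y :+ (ε :+ (ε :+ ε))) refl y ε ⟩
      y + (ε + (ε + ε))  ≈⟨ +-congˡ d≈3ε ⟨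
      y + d              ≈⟨ y+d≈x ⟩
      x                  ≤⟨ h ε (0≤ε , λ 0≈ε → ε≰0 (≤-reflexive (sym 0≈ε))) ⟩
      y + (ε + ε)        ≈⟨ +-identityˡ _ ⟨
      0# + (y + (ε + ε)) ∎)) ε≰0

  fromℕ-nonNeg : ∀ k → 0# ≤ fromℕ k
  fromℕ-nonNeg zero    = ≤-refl
  fromℕ-nonNeg (suc k) = +-nonNeg 0≤1 (fromℕ-nonNeg k)

  fromℕ-+ : ∀ j k → fromℕ (j ℕ.+ k) ≈ fromℕ j + fromℕ k
  fromℕ-+ = ×-homo-+ 1#

  fromℕ-* : ∀ j k → fromℕ (j ℕ.* k) ≈ fromℕ j * fromℕ k
  fromℕ-* = ×1-homo-*

  fromℕ-mono-≤ : ∀ {j k} → j ℕ.≤ k → fromℕ j ≤ fromℕ k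
  fromℕ-mono-≤ {k = k} z≤n = fromℕ-nonNeg k
  fromℕ-mono-≤ (s≤s j≤k)   = +-monoʳ-≤ 1# (fromℕ-mono-≤ j≤k)

  1≤fromℕ : ∀ {k} → 1 ℕ.≤ k → 1# ≤ fromℕ k
  1≤fromℕ 1≤k = ≤-respˡ (+-identityʳ 1#) (fromℕ-mono-≤ 1≤k)

  fromℕ-positive : ∀ k → .{{_ : ℕ.NonZero k}} → 0# < fromℕ k
  fromℕ-positive (suc k) = <-≤-trans 0<1 (1≤fromℕ {suc k} (s≤s z≤n))

  sum-mono-≤ : ∀ {n} {f g : Fin n → ℝ} → (∀ i → f i ≤ g i) → sum f ≤ sum g
  sum-mono-≤ {zero}  f≤g = ≤-refl
  sum-mono-≤ {suc n} f≤g = +-mono-≤ (f≤g zero) (sum-mono-≤ (f≤g ∘ suc))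

  sum-nonNeg : ∀ {n} {f : Fin n → ℝ} → (∀ i → 0# ≤ f i) → 0# ≤ sum f
  sum-nonNeg {n} 0≤f = ≤-respˡ (sum-replicate-zero n) (sum-mono-≤ 0≤f)

  term≤sum : ∀ {n} {f : Fin n → ℝ} → (∀ i → 0# ≤ f i) → ∀ i → f i ≤ sum f
  term≤sum 0≤f zero    = x≤x+y (sum-nonNeg (0≤f ∘ suc))
  term≤sum 0≤f (suc i) = ≤-trans (term≤sum (0≤f ∘ suc) i) (x≤y+x (0≤f zero))

  fromℕ-sum : ∀ {n} (f : Fin n → ℕ) →
              fromℕ (Algebra.Definitions.RawMonoid.sum ℕ.+-0-rawMonoid f)
              ≈ sum (fromℕ ∘ f)
  fromℕ-sum {zero}  f = refl
  fromℕ-sum {suc n} f = trans (fromℕ-+ (f zero) _) (+-congˡ (fromℕ-sum (f ∘ suc)))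

  minimiser : ∀ {n} (f : Fin (suc n) → ℝ) → ∃[ i ] (∀ j → f i ≤ f j)
  minimiser {zero}  f = zero , λ { zero → ≤-refl }
  minimiser {suc n} f with minimiser (f ∘ suc)
  ... | i , min with ≤-total (f zero) (f (suc i))
  ...   | inj₁ f0≤fi = zero , λ { zero → ≤-refl ; (suc j) → ≤-trans f0≤fi (min j) }
  ...   | inj₂ fi≤f0 = suc i , λ { zero → fi≤f0 ; (suc j) → min j }

  ≤-*⊓ : ∀ {x} C y z → x ≤ C * y → x ≤ C * z → x ≤ C * (y ⊓ z)
  ≤-*⊓ C y z x≤Cy x≤Cz with ⊓-sel y z
  ... | inj₁ y⊓z≈y = ≤-respʳ (*-congˡ (sym y⊓z≈y)) x≤Cy
  ... | inj₂ y⊓z≈z = ≤-respʳ (*-congˡ (sym y⊓z≈z)) x≤Cz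

-- Contributions as the solution of a linear equation

module PageRankProperties
  {c ℓ₁ ℓ₂ : Level} (R : RealField c ℓ₁ ℓ₂)
  (α : RealField.ℝ R)
  (0<α : RealField._<_ R (RealField.0# R) α)
  (α<1 : RealField._<_ R α (RealField.1# R))
  (G : DiGraph) where

  open RealField R hiding (zero)
  open OrderedFieldProperties orderedField
  open import Algebra.Properties.Semiring.Sum semiring
    using (sum-cong-≋; *-distribˡ-sum; *-distribʳ-sum; ∑-distrib-+; ∑-comm)
  open DiGraph G
  open PageRank R α G

  β : ℝ
  β = 1# - α

  α+β≈1 : α + β ≈ 1#
  α+β≈1 = begin-equality
    α + (1# - α)  ≈⟨ +-congˡ (+-comm 1# (- α)) ⟩
    α + (- α + 1#) ≈⟨ +-assoc α (- α) 1# ⟨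
    α + - α + 1#  ≈⟨ +-congʳ (-‿inverseʳ α) ⟩
    0# + 1#       ≈⟨ +-identityˡ 1# ⟩
    1#            ∎

  0≤α : 0# ≤ α
  0≤α = proj₁ 0<α

  0≤β : 0# ≤ β
  0≤β = +-cancelˡ-≤ α (begin
    α + 0#  ≈⟨ +-identityʳ α ⟩
    α       ≤⟨ proj₁ α<1 ⟩
    1#      ≈⟨ α+β≈1 ⟨
    α + β   ∎)

  0<β : 0# < β
  0<β = 0≤β , λ 0≈β → proj₂ α<1 (begin-equality
    α       ≈⟨ +-identityʳ α ⟨
    α + 0#  ≈⟨ +-congˡ 0≈β ⟩
    α + β   ≈⟨ α+β≈1 ⟩
    1#      ∎)

  β≤1 : β ≤ 1#
  β≤1 = ≤-respʳ α+β≈1 (x≤y+x 0≤α)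

  indicator : Bool → ℝ
  indicator b = if b then 1# else 0#

  0≤indicator : ∀ b → 0# ≤ indicator b
  0≤indicator true  = 0≤1
  0≤indicator false = ≤-refl

  fromℕ-∣tabulate∣ : ∀ {k} (f : Fin k → Bool) →
                     fromℕ ∣ Vec.tabulate f ∣ ≈ sum (indicator ∘ f)
  fromℕ-∣tabulate∣ {zero}  f = refl
  fromℕ-∣tabulate∣ {suc k} f with f zero
  ... | true  = +-congˡ (fromℕ-∣tabulate∣ (f ∘ suc))
  ... | false = trans (fromℕ-∣tabulate∣ (f ∘ suc)) (sym (+-identityˡ _))

  outdegℝ indegℝ : V → ℝ
  outdegℝ u = fromℕ (outdeg u)
  indegℝ  v = fromℕ (indeg v)

  outdeg≈sum : ∀ u → outdegℝ u ≈ sum λ v → indicator (edge u v)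
  outdeg≈sum u = fromℕ-∣tabulate∣ (edge u)

  indeg≈sum : ∀ v → indegℝ v ≈ sum λ u → indicator (edge u v)
  indeg≈sum v = fromℕ-∣tabulate∣ λ u → edge u v

  m≈sum : fromℕ m ≈ sum outdegℝ
  m≈sum = lemma outdeg
    where
    lemma : ∀ {k} (f : Fin k → ℕ) →
            fromℕ (ListAction.sum (List.tabulate f)) ≈ sum (fromℕ ∘ f)
    lemma {zero}  f = refl
    lemma {suc k} f = trans (fromℕ-+ (f zero) _) (+-congˡ (lemma (f ∘ suc)))

  tabulate≤max : ∀ {k} (f : Fin k → ℕ) i → f i ℕ.≤ Extrema.max 0 (List.tabulate f)
  tabulate≤max f i =
    All.lookup (Extrema.xs≤max 0 (List.tabulate f)) (List.∈-tabulate⁺ i)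

  indeg≤Δin : ∀ v → indegℝ v ≤ fromℕ Δin
  indeg≤Δin v = fromℕ-mono-≤ (tabulate≤max indeg v)

  outdeg≤Δout : ∀ u → outdegℝ u ≤ fromℕ Δout
  outdeg≤Δout u = fromℕ-mono-≤ (tabulate≤max outdeg u)

  0<outdeg : ∀ u → 0# < outdegℝ u
  0<outdeg u = fromℕ-positive (outdeg u) {{outdeg-nonZero u}}

  outdeg-inverse : ∀ u → outdegℝ u * outdegℝ u ⁻¹ ≈ 1#
  outdeg-inverse u = ⁻¹-inverseʳ (outdegℝ u) (<⇒≉0 (0<outdeg u))

  0≤outdeg⁻¹ : ∀ u → 0# ≤ outdegℝ u ⁻¹
  0≤outdeg⁻¹ u = proj₁ (⁻¹-positive (0<outdeg u))

  average : (V → ℝ) → V → ℝ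
  average f u = sum λ w → stepProb u w * f w

  stepProb≈ : ∀ u w → stepProb u w ≈ outdegℝ u ⁻¹ * indicator (edge u w)
  stepProb≈ u w with edge u w
  ... | true  = *-comm 1# (outdegℝ u ⁻¹)
  ... | false = sym (zeroʳ _)

  0≤stepProb : ∀ u w → 0# ≤ stepProb u w
  0≤stepProb u w =
    ≤-respʳ (sym (stepProb≈ u w)) (*-nonNeg (0≤outdeg⁻¹ u) (0≤indicator _))

  average≈ : ∀ f u → average f u ≈ outdegℝ u ⁻¹ * sum λ w → indicator (edge u w) * f w
  average≈ f u = begin-equality
    average f u
      ≈⟨ sum-cong-≋ (λ w → trans (*-congʳ (stepProb≈ u w)) (*-assoc _ _ (f w))) ⟩
    (sum λ w → outdegℝ u ⁻¹ * (indicator (edge u w) * f w))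
      ≈⟨ *-distribˡ-sum (outdegℝ u ⁻¹) (λ w → indicator (edge u w) * f w) ⟨
    outdegℝ u ⁻¹ * (sum λ w → indicator (edge u w) * f w)
      ∎

  average-const : ∀ x u → average (λ _ → x) u ≈ x
  average-const x u = begin-equality
    average (λ _ → x) u
      ≈⟨ average≈ (λ _ → x) u ⟩
    outdegℝ u ⁻¹ * (sum λ w → indicator (edge u w) * x)
      ≈⟨ *-congˡ (*-distribʳ-sum x (λ w → indicator (edge u w))) ⟨
    outdegℝ u ⁻¹ * ((sum λ w → indicator (edge u w)) * x)
      ≈⟨ *-congˡ (*-congʳ (outdeg≈sum u)) ⟨
    outdegℝ u ⁻¹ * (outdegℝ u * x)
      ≈⟨ solve 3 (λ i d x → i :* (d :* x) := d :* i :* x) refl (outdegℝ u ⁻¹) (outdegℝ u) x ⟩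
    outdegℝ u * outdegℝ u ⁻¹ * x
      ≈⟨ *-congʳ (outdeg-inverse u) ⟩
    1# * x
      ≈⟨ *-identityˡ x ⟩
    x ∎

  average-cong : ∀ {f g} → (∀ w → f w ≈ g w) → ∀ u → average f u ≈ average g u
  average-cong f≈g u = sum-cong-≋ λ w → *-congˡ (f≈g w)

  average-mono : ∀ {f g} → (∀ w → f w ≤ g w) → ∀ u → average f u ≤ average g u
  average-mono f≤g u = sum-mono-≤ λ w → *-monoˡ-≤ (0≤stepProb u w) (f≤g w)

  average-+ : ∀ f g u → average (λ w → f w + g w) u ≈ average f u + average g u
  average-+ f g u = trans (sum-cong-≋ {n} λ w → distribˡ (stepProb u w) (f w) (g w))
    (∑-distrib-+ (λ w → stepProb u w * f w) (λ w → stepProb u w * g w))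

  average-* : ∀ x f u → average (λ w → x * f w) u ≈ x * average f u
  average-* x f u = trans
    (sum-cong-≋ λ w → solve 3 (λ p x f → p :* (x :* f) := x :* (p :* f)) refl (stepProb u w) x (f w))
    (sym (*-distribˡ-sum x λ w → stepProb u w * f w))

  -- At a node `a` where `h` is least, the average over the children is at least `h a`. Hence
  -- `β * h a ≤ h a`, that is `0 ≤ α * h a`, and `α` is positive.
  minimum-principle : ∀ h → (∀ u → β * average h u ≤ h u) → ∀ u → 0# ≤ h u
  minimum-principle h super u = ≤-trans 0≤min (proj₂ minimal u)
    where
    minimal : ∃[ i ] (∀ j → h i ≤ h j)
    minimal = lemma h u
      where
      -- The node `u` is passed along to show that the set of nodes is not empty.
      lemma : ∀ {k} (f : Fin k → ℝ) → Fin k → ∃[ i ] (∀ j → f i ≤ f j)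
      lemma {suc k} f _ = minimiser f
    a = proj₁ minimal
    0≤min : 0# ≤ h a
    0≤min = *-cancelˡ-≤ 0<α (+-cancelʳ-≤ (β * h a) (begin
      α * 0# + β * h a  ≈⟨ +-congʳ (zeroʳ α) ⟩
      0# + β * h a      ≈⟨ +-identityˡ _ ⟩
      β * h a           ≈⟨ *-congˡ (average-const (h a) a) ⟨
      β * average (λ _ → h a) a ≤⟨ *-monoˡ-≤ 0≤β (average-mono (proj₂ minimal) a) ⟩
      β * average h a   ≤⟨ super a ⟩
      h a               ≈⟨ *-identityˡ _ ⟨
      1# * h a          ≈⟨ *-congʳ α+β≈1 ⟨
      (α + β) * h a     ≈⟨ distribʳ _ _ _ ⟩
      α * h a + β * h a ∎))

  -- The hypothesis is `g - β average g ≤ f - β average f` with all terms moved to the side where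
  -- they are positive, so that uses of it need no subtraction. It makes `f - g` satisfy the minimum
  -- principle.
  comparison-principle : ∀ f g → (∀ u → g u + β * average f u ≤ f u + β * average g u) →
                         ∀ u → g u ≤ f u
  comparison-principle f g super u = +-cancelʳ-≤ (- g u)
    (≤-respˡ (sym (-‿inverseʳ (g u))) (minimum-principle h super′ u))
    where
    h : V → ℝ
    h w = f w - g w
    f≈g+h : ∀ w → f w ≈ g w + h w
    f≈g+h w = begin-equality
      f w                   ≈⟨ +-identityʳ _ ⟨
      f w + 0#              ≈⟨ +-congˡ (-‿inverseʳ (g w)) ⟨
      f w + (g w + - g w)   ≈⟨ solve 3 (λ f g n → f :+ (g :+ n) := g :+ (f :+ n)) refl (f w) (g w) (- g w) ⟩
      g w + (f w + - g w)   ∎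
    super′ : ∀ u → β * average h u ≤ h u
    super′ u = +-cancelˡ-≤ (g u + β * average g u) (begin
      g u + β * average g u + β * average h u
        ≈⟨ solve 4 (λ g b x y → g :+ b :* x :+ b :* y := g :+ b :* (x :+ y)) refl (g u) β (average g u) (average h u) ⟩
      g u + β * (average g u + average h u)
        ≈⟨ +-congˡ (*-congˡ (trans (average-cong f≈g+h u) (average-+ g h u))) ⟨
      g u + β * average f u
        ≤⟨ super u ⟩
      f u + β * average g u
        ≈⟨ +-congʳ (f≈g+h u) ⟩
      g u + h u + β * average g u
        ≈⟨ solve 3 (λ g h x → g :+ h :+ x := g :+ x :+ h) refl (g u) (h u) (β * average g u) ⟩
      g u + β * average g u + h u ∎)

  module Contributions
    (π : V → V → ℝ) (isContribution : IsContribution π) (t : V) where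

    unit : V → ℝ
    unit u = walkProb 0 u t

    0≤unit : ∀ u → 0# ≤ unit u
    0≤unit u = 0≤indicator ⌊ u Fin.≟ t ⌋

    unit-t : unit t ≈ 1#
    unit-t with t Fin.≟ t
    ... | yes _   = refl
    ... | no  t≢t = contradiction ≡.refl t≢t

    contribution : V → ℝ
    contribution u = π u t

    private
      truncated : ℕ → V → ℝ
      truncated k u = sum {k} λ i → (α * β ^ toℕ i) * walkProb (toℕ i) u t

      -- A walk of positive length is one step followed by a walk that is shorter by one, and the
      -- shift of the exponent contributes the factor `β`.
      truncated-suc : ∀ k u → truncated (suc k) u ≈ α * unit u + β * average (truncated k) u
      truncated-suc k u = +-cong (*-congʳ (*-identityʳ α)) (begin-equality
        (sum {k} λ i → (α * (β * β ^ toℕ i)) * average (λ w → walkProb (toℕ i) w t) u)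
          ≈⟨ sum-cong-≋ {k} (λ i → trans
               (solve 4 (λ a b p s → (a :* (b :* p)) :* s := b :* (a :* p :* s)) refl α β (β ^ toℕ i) _)
               (*-congˡ (sym (average-* (α * β ^ toℕ i) (λ w → walkProb (toℕ i) w t) u)))) ⟩
        (sum {k} λ i → β * average (λ w → (α * β ^ toℕ i) * walkProb (toℕ i) w t) u)
          ≈⟨ *-distribˡ-sum {k} β _ ⟨
        β * (sum {k} λ i → average (λ w → (α * β ^ toℕ i) * walkProb (toℕ i) w t) u)
          ≈⟨ *-congˡ (∑-comm {k} λ i w → stepProb u w * ((α * β ^ toℕ i) * walkProb (toℕ i) w t)) ⟩
        β * (sum λ w → sum {k} λ i → stepProb u w * ((α * β ^ toℕ i) * walkProb (toℕ i) w t))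
          ≈⟨ *-congˡ (sum-cong-≋ λ w → *-distribˡ-sum {k} (stepProb u w) λ i → (α * β ^ toℕ i) * walkProb (toℕ i) w t) ⟨
        β * average (truncated k) u ∎)

      -- The equation at `u` involves the limits at all children of `u` at once, so one `N` has to
      -- serve every node. There are finitely many.
      converges : ∀ ε → 0# < ε → ∃[ N ] (∀ k → N ℕ.≤ k → ∀ u →
                  truncated k u ≤ contribution u + ε × contribution u ≤ truncated k u + ε)
      converges ε 0<ε = uniform (λ k u → truncated k u ≤ contribution u + ε × contribution u ≤ truncated k u + ε)
                          λ u → isContribution u t ε 0<ε
        where
        uniform : ∀ {n p} (P : ℕ → Fin n → Set p) → (∀ u → ∃[ N ] (∀ k → N ℕ.≤ k → P k u)) →
                  ∃[ N ] (∀ k → N ℕ.≤ k → ∀ u → P k u)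
        uniform {zero}  P h = 0 , λ _ _ ()
        uniform {suc n} P h with h zero | uniform (λ k u → P k (suc u)) (h ∘ suc)
        ... | N₁ , h₁ | N₂ , h₂ = N₁ ℕ.⊔ N₂ , λ where
          k N≤k zero    → h₁ k (ℕ.≤-trans (ℕ.m≤m⊔n N₁ N₂) N≤k)
          k N≤k (suc u) → h₂ k (ℕ.≤-trans (ℕ.m≤n⊔m N₁ N₂) N≤k) u

      average-slack : ∀ {f g ε} → 0# ≤ ε → (∀ w → f w ≤ g w + ε) →
                      ∀ u → β * average f u ≤ β * average g u + ε
      average-slack {f} {g} {ε} 0≤ε f≤g+ε u = begin
        β * average f u                        ≤⟨ *-monoˡ-≤ 0≤β (average-mono f≤g+ε u) ⟩
        β * average (λ w → g w + ε) u          ≈⟨ *-congˡ (average-+ g (λ _ → ε) u) ⟩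
        β * (average g u + average (λ _ → ε) u) ≈⟨ *-congˡ (+-congˡ (average-const ε u)) ⟩
        β * (average g u + ε)                  ≈⟨ distribˡ _ _ _ ⟩
        β * average g u + β * ε                ≤⟨ +-monoʳ-≤ _ (≤-respʳ (*-identityˡ ε) (*-monoʳ-≤ 0≤ε β≤1)) ⟩
        β * average g u + ε                    ∎

    -- The limit of `truncated-suc`: one `ε` is spent on the left side and one on the average, which
    -- does not enlarge a uniform error.
    contribution-fixpoint : ∀ u → contribution u ≈ α * unit u + β * average contribution u
    contribution-fixpoint u = ≤-antisym (∀ε⇒≤ upper) (∀ε⇒≤ lower)
      where
      upper : ∀ ε → 0# < ε → contribution u ≤ (α * unit u + β * average contribution u) + (ε + ε)
      upper ε 0<ε with converges ε 0<ε
      ... | N , h = begin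
        contribution u          ≤⟨ proj₂ (h (suc N) (ℕ.n≤1+n N) u) ⟩
        truncated (suc N) u + ε ≈⟨ +-congʳ (truncated-suc N u) ⟩
        α * unit u + β * average (truncated N) u + ε
          ≤⟨ +-monoˡ-≤ ε (+-monoʳ-≤ _ (average-slack (proj₁ 0<ε) (λ w → proj₁ (h N ℕ.≤-refl w)) u)) ⟩
        α * unit u + (β * average contribution u + ε) + ε
          ≈⟨ solve 3 (λ a b e → a :+ (b :+ e) :+ e := (a :+ b) :+ (e :+ e)) refl (α * unit u) (β * average contribution u) ε ⟩
        (α * unit u + β * average contribution u) + (ε + ε) ∎
      lower : ∀ ε → 0# < ε → α * unit u + β * average contribution u ≤ contribution u + (ε + ε)
      lower ε 0<ε with converges ε 0<ε
      ... | N , h = begin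
        α * unit u + β * average contribution u
          ≤⟨ +-monoʳ-≤ _ (average-slack (proj₁ 0<ε) (λ w → proj₂ (h N ℕ.≤-refl w)) u) ⟩
        α * unit u + (β * average (truncated N) u + ε)
          ≈⟨ +-assoc _ _ ε ⟨
        α * unit u + β * average (truncated N) u + ε
          ≈⟨ +-congʳ (truncated-suc N u) ⟨
        truncated (suc N) u + ε ≤⟨ +-monoˡ-≤ ε (proj₁ (h (suc N) (ℕ.n≤1+n N) u)) ⟩
        contribution u + ε + ε  ≈⟨ +-assoc _ ε ε ⟩
        contribution u + (ε + ε) ∎

    0≤contribution : ∀ u → 0# ≤ contribution u
    0≤contribution = minimum-principle contribution λ u →
      ≤-respʳ (sym (contribution-fixpoint u)) (x≤y+x (*-nonNeg 0≤α (0≤unit u)))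

    -- n π(t)
    total : ℝ
    total = sum contribution

    contributing⇒≤ : ∀ {δ v} → Contributing π δ t v → δ * total ≤ contribution v
    contributing⇒≤ {δ} {v} = ≤-respˡ (begin-equality
      δ * fromℕ n * (1# * fromℕ n ⁻¹ * total)
        ≈⟨ solve 4 (λ d n i s → d :* n :* (con 1 :* i :* s) := d :* (n :* i :* s)) refl δ (fromℕ n) (fromℕ n ⁻¹) total ⟩
      δ * (fromℕ n * fromℕ n ⁻¹ * total)
        ≈⟨ *-congˡ (*-congʳ (⁻¹-inverseʳ (fromℕ n) (<⇒≉0 0<n))) ⟩
      δ * (1# * total) ≈⟨ *-congˡ (*-identityˡ total) ⟩
      δ * total ∎)
      where
      0<n : 0# < fromℕ n
      0<n = <-≤-trans 0<1 (1≤fromℕ (ℕ.≤-trans (s≤s z≤n) (Fin.toℕ<n v)))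

-- Mass and flow in a backward push

module FlowProperties
  {c ℓ₁ ℓ₂ : Level} (R : RealField c ℓ₁ ℓ₂)
  (α : RealField.ℝ R)
  (0<α : RealField._<_ R (RealField.0# R) α)
  (α<1 : RealField._<_ R α (RealField.1# R))
  (G : DiGraph)
  (π : DiGraph.V G → DiGraph.V G → RealField.ℝ R)
  (isContribution : PageRank.IsContribution R α G π)
  (t : DiGraph.V G) where

  open RealField R hiding (zero)
  open OrderedFieldProperties orderedField
  open import Algebra.Properties.Semiring.Sum semiring
    using (sum-cong-≋; *-distribˡ-sum; *-distribʳ-sum; ∑-distrib-+; ∑-comm)
  open DiGraph G
  open PageRank R α G
  open PageRankProperties R α 0<α α<1 G
  open Contributions π isContribution t

  -- A snapshot of the backward push: q is the mass pushed so far from each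
  -- node, r the residue, and φ u w the part of q w that has been passed on
  -- along the edge from u to w.  The inequality φ u w ≤ q w is strict only
  -- in the middle of a push.
  record Flow (q r : V → ℝ) (φ : V → V → ℝ) : Set (ℓ₁ ⊔ ℓ₂) where
    field
      0≤q     : ∀ u → 0# ≤ q u
      0≤r     : ∀ u → 0# ≤ r u
      0≤φ     : ∀ u w → 0# ≤ φ u w
      φ≤q     : ∀ u w → φ u w ≤ indicator (edge u w) * q w
      balance : ∀ u → q u + r u ≈ unit u + β * (outdegℝ u ⁻¹ * sum (φ u))

    received : V → ℝ
    received u = q u + r u

    mass flow : ℝ
    mass = sum received
    flow = sum λ u → sum (φ u)

    0≤received : ∀ u → 0# ≤ received u
    0≤received u = +-nonNeg (0≤q u) (0≤r u)

    0≤mass : 0# ≤ mass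
    0≤mass = sum-nonNeg 0≤received

    0≤flow : 0# ≤ flow
    0≤flow = sum-nonNeg λ u → sum-nonNeg (0≤φ u)

    -- Mass travels against the edges, and `u` receives only the fraction `β / outdeg u` of what
    -- crosses its outgoing edges. Solving `balance` for that amount gives the bound.
    φ-out≤ : ∀ u → β * sum (φ u) ≤ outdegℝ u * received u
    φ-out≤ u = begin
      β * sum (φ u)
        ≈⟨ *-identityˡ _ ⟨
      1# * (β * sum (φ u))
        ≈⟨ *-congʳ (outdeg-inverse u) ⟨
      outdegℝ u * outdegℝ u ⁻¹ * (β * sum (φ u))
        ≈⟨ solve 4 (λ d i b s → d :* i :* (b :* s) := d :* (b :* (i :* s))) refl (outdegℝ u) (outdegℝ u ⁻¹) β (sum (φ u)) ⟩
      outdegℝ u * (β * (outdegℝ u ⁻¹ * sum (φ u)))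
        ≤⟨ *-monoˡ-≤ (proj₁ (0<outdeg u)) (x≤y+x (0≤unit u)) ⟩
      outdegℝ u * (unit u + β * (outdegℝ u ⁻¹ * sum (φ u)))
        ≈⟨ *-congˡ (balance u) ⟨
      outdegℝ u * received u ∎

    unit≤received : ∀ u → unit u ≤ received u
    unit≤received u = ≤-respʳ (sym (balance u))
      (x≤x+y (*-nonNeg 0≤β (*-nonNeg (0≤outdeg⁻¹ u) (sum-nonNeg (0≤φ u)))))

    1≤mass : 1# ≤ mass
    1≤mass = ≤-respˡ unit-t (≤-trans (unit≤received t) (term≤sum 0≤received t))

    φ≤average : ∀ u → outdegℝ u ⁻¹ * sum (φ u) ≤ average q u
    φ≤average u = ≤-respʳ (sym (average≈ q u))
      (*-monoˡ-≤ (0≤outdeg⁻¹ u) (sum-mono-≤ (φ≤q u)))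

    -- `α * received` is a subsolution of the contribution equation: by `balance`, a node has
    -- received at most its unit plus `β` times the average of `q`, and `q ≤ received`. This also
    -- holds in the middle of a push.
    α*received≤contribution : ∀ u → α * received u ≤ contribution u
    α*received≤contribution =
      comparison-principle contribution (λ u → α * received u) λ u → begin
        α * received u + β * average contribution u
          ≈⟨ +-congʳ (*-congˡ (balance u)) ⟩
        α * (unit u + β * (outdegℝ u ⁻¹ * sum (φ u))) + β * average contribution u
          ≤⟨ +-monoˡ-≤ _ (*-monoˡ-≤ 0≤α (+-monoʳ-≤ _ (*-monoˡ-≤ 0≤β
               (≤-trans (φ≤average u) (average-mono (λ w → x≤x+y (0≤r w)) u))))) ⟩
        α * (unit u + β * average received u) + β * average contribution u
          ≈⟨ solve 5 (λ a b e s p → a :* (e :+ b :* s) :+ b :* p := a :* e :+ b :* p :+ b :* (a :* s)) refl α β (unit u) (average received u) (average contribution u) ⟩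
        α * unit u + β * average contribution u + β * (α * average received u)
          ≈⟨ +-cong (contribution-fixpoint u) (*-congˡ (average-* α received u)) ⟨
        contribution u + β * average (λ w → α * received w) u ∎

    α*mass≤total : α * mass ≤ total
    α*mass≤total = ≤-respˡ (sym (*-distribˡ-sum α received))
                     (sum-mono-≤ α*received≤contribution)

    -- Between pushes `φ` agrees with `q` on every edge, so `balance` turns `α (unit + β average q)`
    -- into `α (q + r)`. The error is `x` and not `x / α` because a constant reproduces itself:
    -- `α x + β x = x`.
    contribution≤ : ∀ {x} → (∀ u w → edge u w ≡ true → q w ≤ φ u w) →
                    (∀ u → r u ≤ x) → ∀ u → contribution u ≤ α * q u + x
    contribution≤ {x} settled r≤x =
      comparison-principle (λ u → α * q u + x) contribution λ u → begin
        contribution u + β * average (λ w → α * q w + x) u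
          ≈⟨ +-cong (contribution-fixpoint u) (*-congˡ (begin-equality
               average (λ w → α * q w + x) u
                 ≈⟨ average-+ (λ w → α * q w) (λ _ → x) u ⟩
               average (λ w → α * q w) u + average (λ _ → x) u
                 ≈⟨ +-cong (average-* α q u) (average-const x u) ⟩
               α * average q u + x ∎)) ⟩
        α * unit u + β * average contribution u + β * (α * average q u + x)
          ≈⟨ solve 6 (λ a b e p s x → a :* e :+ b :* p :+ b :* (a :* s :+ x)
                                    := a :* (e :+ b :* s) :+ b :* x :+ b :* p) refl α β (unit u) (average contribution u) (average q u) x ⟩
        α * (unit u + β * average q u) + β * x + β * average contribution u
          ≤⟨ +-monoˡ-≤ _ (+-monoˡ-≤ _ (*-monoˡ-≤ 0≤α (+-monoʳ-≤ _ (*-monoˡ-≤ 0≤β (average≤φ u))))) ⟩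
        α * (unit u + β * (outdegℝ u ⁻¹ * sum (φ u))) + β * x + β * average contribution u
          ≈⟨ +-congʳ (+-congʳ (*-congˡ (balance u))) ⟨
        α * (q u + r u) + β * x + β * average contribution u
          ≤⟨ +-monoˡ-≤ _ (+-monoˡ-≤ _ (*-monoˡ-≤ 0≤α (+-monoʳ-≤ _ (r≤x u)))) ⟩
        α * (q u + x) + β * x + β * average contribution u
          ≈⟨ solve 5 (λ a b q x p → a :* (q :+ x) :+ b :* x :+ b :* p
                                  := a :* q :+ (a :+ b) :* x :+ b :* p) refl α β (q u) x (average contribution u) ⟩
        α * q u + (α + β) * x + β * average contribution u
          ≈⟨ +-congʳ (+-congˡ (trans (*-congʳ α+β≈1) (*-identityˡ x))) ⟩
        α * q u + x + β * average contribution u ∎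
      where
      average≤φ : ∀ u → average q u ≤ outdegℝ u ⁻¹ * sum (φ u)
      average≤φ u = ≤-respˡ (sym (average≈ q u))
        (*-monoˡ-≤ (0≤outdeg⁻¹ u) (sum-mono-≤ λ w → lemma w (edge u w) ≡.refl))
        where
        lemma : ∀ w b → edge u w ≡ b → indicator b * q w ≤ φ u w
        lemma w true  e = ≤-respˡ (sym (*-identityˡ (q w))) (settled u w e)
        lemma w false e = ≤-respˡ (sym (zeroˡ (q w))) (0≤φ u w)

    pushed≤mass : sum q ≤ mass
    pushed≤mass = sum-mono-≤ λ u → x≤x+y (0≤r u)

    β*flow≤ : ∀ {x} → flow ≤ x → β * flow ≤ x
    β*flow≤ flow≤x = ≤-trans (≤-respʳ (*-identityˡ flow) (*-monoʳ-≤ 0≤flow β≤1)) flow≤x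

    -- The bounds by `Δin` and `Δout` are doubled to share the form of the bound by `√m`, where
    -- nodes of small and of large out-degree cost `s * mass` each.
    twice : ∀ {a b} → 0# ≤ b → a ≤ b * mass → a ≤ b * mass + b * mass
    twice 0≤b a≤bS = ≤-trans a≤bS (x≤x+y (*-nonNeg 0≤b 0≤mass))

    -- Edges are grouped by the node that pushes: each of its incoming edges has carried at most
    -- `q w`, and the sum of `q` is part of the mass.
    flow≤Δin : β * flow ≤ fromℕ Δin * mass + fromℕ Δin * mass
    flow≤Δin = twice (fromℕ-nonNeg Δin) (β*flow≤ (begin
      flow
        ≈⟨ ∑-comm φ ⟩
      (sum λ w → sum λ u → φ u w)
        ≤⟨ sum-mono-≤ (λ w → sum-mono-≤ λ u → φ≤q u w) ⟩
      (sum λ w → sum λ u → indicator (edge u w) * q w)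
        ≈⟨ sum-cong-≋ (λ w → *-distribʳ-sum (q w) λ u → indicator (edge u w)) ⟨
      (sum λ w → (sum λ u → indicator (edge u w)) * q w)
        ≈⟨ sum-cong-≋ (λ w → *-congʳ (indeg≈sum w)) ⟨
      (sum λ w → indegℝ w * q w)
        ≤⟨ sum-mono-≤ (λ w → *-monoʳ-≤ (0≤q w) (indeg≤Δin w)) ⟩
      (sum λ w → fromℕ Δin * q w)
        ≈⟨ *-distribˡ-sum (fromℕ Δin) q ⟨
      fromℕ Δin * sum q
        ≤⟨ *-monoˡ-≤ (fromℕ-nonNeg Δin) pushed≤mass ⟩
      fromℕ Δin * mass ∎))

    -- Edges are grouped by the node that receives, where `φ-out≤` applies.
    flow≤Δout : β * flow ≤ fromℕ Δout * mass + fromℕ Δout * mass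
    flow≤Δout = twice (fromℕ-nonNeg Δout) (begin
      β * flow
        ≈⟨ *-distribˡ-sum β (λ u → sum (φ u)) ⟩
      (sum λ u → β * sum (φ u))
        ≤⟨ sum-mono-≤ (λ u → ≤-trans (φ-out≤ u) (*-monoʳ-≤ (0≤received u) (outdeg≤Δout u))) ⟩
      (sum λ u → fromℕ Δout * received u)
        ≈⟨ *-distribˡ-sum (fromℕ Δout) received ⟨
      fromℕ Δout * mass ∎)

    -- A node with out-degree at most √m passes on at most √m / β times what
    -- it receives; any other node passes on at most Σ q, which is paid for
    -- by its out-degree because the out-degrees add up to m.
    flow≤√m : ∀ {s} → IsSqrt (fromℕ m) s → 0# < s → β * flow ≤ s * mass + s * mass
    flow≤√m {s} (0≤s , s*s≈m) 0<s = *-cancelˡ-≤ 0<s (begin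
      s * (β * flow)
        ≈⟨ *-congˡ (*-distribˡ-sum β (λ u → sum (φ u))) ⟩
      s * (sum λ u → β * sum (φ u))
        ≈⟨ *-distribˡ-sum s (λ u → β * sum (φ u)) ⟩
      (sum λ u → s * (β * sum (φ u)))
        ≤⟨ sum-mono-≤ pointwise ⟩
      (sum λ u → s * s * received u + outdegℝ u * mass)
        ≈⟨ ∑-distrib-+ (λ u → s * s * received u) (λ u → outdegℝ u * mass) ⟩
      (sum λ u → s * s * received u) + (sum λ u → outdegℝ u * mass)
        ≈⟨ +-cong (*-distribˡ-sum (s * s) received) (*-distribʳ-sum mass outdegℝ) ⟨
      s * s * mass + sum outdegℝ * mass
        ≈⟨ +-congˡ (*-congʳ (trans (sym m≈sum) (sym s*s≈m))) ⟩
      s * s * mass + s * s * mass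
        ≈⟨ solve 2 (λ s x → s :* s :* x :+ s :* s :* x := s :* (s :* x :+ s :* x)) refl s mass ⟩
      s * (s * mass + s * mass) ∎)
      where
      pointwise : ∀ u → s * (β * sum (φ u)) ≤ s * s * received u + outdegℝ u * mass
      pointwise u with ≤-total (outdegℝ u) s
      ... | inj₁ d≤s = begin
        s * (β * sum (φ u))      ≤⟨ *-monoˡ-≤ 0≤s (φ-out≤ u) ⟩
        s * (outdegℝ u * received u) ≤⟨ *-monoˡ-≤ 0≤s (*-monoʳ-≤ (0≤received u) d≤s) ⟩
        s * (s * received u)     ≈⟨ *-assoc s s _ ⟨
        s * s * received u       ≤⟨ x≤x+y (*-nonNeg (proj₁ (0<outdeg u)) 0≤mass) ⟩
        s * s * received u + outdegℝ u * mass ∎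
      ... | inj₂ s≤d = begin
        s * (β * sum (φ u))      ≤⟨ *-monoʳ-≤ (*-nonNeg 0≤β (sum-nonNeg (0≤φ u))) s≤d ⟩
        outdegℝ u * (β * sum (φ u))
          ≤⟨ *-monoˡ-≤ (proj₁ (0<outdeg u)) (≤-trans
               (≤-respʳ (*-identityˡ _) (*-monoʳ-≤ (sum-nonNeg (0≤φ u)) β≤1))
               (≤-trans (sum-mono-≤ φ≤q′) pushed≤mass)) ⟩
        outdegℝ u * mass         ≤⟨ x≤y+x (*-nonNeg (*-nonNeg 0≤s 0≤s) (0≤received u)) ⟩
        s * s * received u + outdegℝ u * mass ∎
        where
        indicator≤1 : ∀ b → indicator b ≤ 1#
        indicator≤1 true  = ≤-refl
        indicator≤1 false = 0≤1
        φ≤q′ : ∀ w → φ u w ≤ q w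
        φ≤q′ w = ≤-trans (φ≤q u w)
          (≤-respʳ (*-identityˡ (q w)) (*-monoʳ-≤ (0≤q w) (indicator≤1 (edge u w))))

-- Updated functions and the enumerations of parents and children

module _ {a} {A : Set a} where

  ↦-same : ∀ (f : ℕ → A) i {x} → (f [ i ↦ x ]) i ≡ x
  ↦-same f i with i ℕ.≟ i
  ... | yes _   = ≡.refl
  ... | no  i≢i = contradiction ≡.refl i≢i

  ↦-other : ∀ (f : ℕ → A) {i j x} → j ≢ i → (f [ i ↦ x ]) j ≡ f j
  ↦-other f {i} {j} j≢i with j ℕ.≟ i
  ... | yes j≡i = contradiction j≡i j≢i
  ... | no  _   = ≡.refl

module AccessProperties {G : DiGraph} (A : Access G) where

  open DiGraph G
  open Access A

  parent-edge : ∀ v p → edge (parent v p) v ≡ true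
  parent-edge v p = ≡.trans (≡.sym (Vec.lookup∘tabulate _ (parent v p)))
    (Vec.[]=⇒lookup (proj₂ (Bijection.to (parents-enum v) p)))

  child-edge : ∀ v p → edge v (child v p) ≡ true
  child-edge v p = ≡.trans (≡.sym (Vec.lookup∘tabulate _ (child v p)))
    (Vec.[]=⇒lookup (proj₂ (Bijection.to (children-enum v) p)))

  edge⇒parent : ∀ {u v} → edge u v ≡ true → ∃[ p ] parent v p ≡ u
  edge⇒parent {u} {v} e = p , ≡.cong proj₁ (proj₂ surj ≡.refl)
    where
    u∈ : u Subset.∈ parents v
    u∈ = Vec.lookup⇒[]= u (parents v) (≡.trans (Vec.lookup∘tabulate _ u) e)
    surj = Bijection.surjective (parents-enum v) (u , u∈)
    p = proj₁ surj

  -- Membership proofs in a `Subset` are unique, so equal nodes give equal pairs. A push that runs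
  -- through the indices therefore crosses each edge once.
  parent-injective : ∀ {v p p′} → parent v p ≡ parent v p′ → p ≡ p′
  parent-injective {v} {p} {p′} eq = Bijection.injective (parents-enum v)
    (lemma (Bijection.to (parents-enum v) p) (Bijection.to (parents-enum v) p′) eq)
    where
    lemma : ∀ (x y : ∃ λ u → u Subset.∈ parents v) → proj₁ x ≡ proj₁ y → x ≡ y
    lemma (u , u∈) (.u , u∈′) ≡.refl = ≡.cong (u ,_) (Vec.[]=-irrelevant u∈ u∈′)

-- The backward push and its amortised cost

module PushInvariant
  {c ℓ₁ ℓ₂ : Level} (R : RealField c ℓ₁ ℓ₂)
  (α : RealField.ℝ R)
  (0<α : RealField._<_ R (RealField.0# R) α)
  (α<1 : RealField._<_ R α (RealField.1# R))
  {G : DiGraph} (A : Access G)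
  (π : DiGraph.V G → DiGraph.V G → RealField.ℝ R)
  (isContribution : PageRank.IsContribution R α G π)
  (t : DiGraph.V G) where

  open RealField R hiding (zero)
  open OrderedFieldProperties orderedField
  open import Algebra.Properties.Semiring.Sum semiring
    using (sum-cong-≋; sum-replicate-zero)
  open SumUpdate +-commutativeMonoid
  open DiGraph G
  open Access A
  open AccessProperties A
  open PageRank R α G
  open PageRankProperties R α 0<α α<1 G
  open Contributions π isContribution t
  open FlowProperties R α 0<α α<1 G π isContribution t

  -- The push of ρ from v still has to serve the parents of v with an index
  -- below e.  The queue holds names; its first i entries have been scanned
  -- since the threshold x was last lowered.
  record Push : Set c where
    constructor mkPush
    field
      v          : V
      e i k      : ℕ
      queue      : ℕ → ℕ
      mass x ρ   : ℝ
      r          : ℕ → ℝ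

    Queued : ℕ → V → Set
    Queued lo w = ∃[ z ] lo ℕ.≤ z × z ℕ.< k × queue z ≡ name w

  -- N is the number of steps taken so far, and out the output.
  record PushInv (N : ℕ) (out : List V) (p : Push) : Set (c ⊔ ℓ₁ ⊔ ℓ₂) where
    open Push p
    field
      q         : V → ℝ
      φ         : V → V → ℝ
      flowing   : Flow q (r ∘ name) φ
      mass≈     : mass ≈ Flow.mass flowing
      0<x       : 0# < x
      x≤ρ       : 0 ℕ.< e → x ≤ ρ
      φ-other   : ∀ u w → w ≢ v → edge u w ≡ true → φ u w ≈ q w
      φ-done    : ∀ p → e ℕ.≤ toℕ p → φ (parent v p) v ≈ q v
      φ-pending : ∀ p → toℕ p ℕ.< e → φ (parent v p) v + ρ ≈ q v
      e≤indeg   : e ℕ.≤ indeg v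
      i≤k       : i ℕ.≤ k
      queue-ok  : ∀ z → z ℕ.< k → ∃[ w ] queue z ≡ name w × w ∈ out
      -- A node that receives mass is queued again, so the residue of a node missing from the
      -- unscanned part has not grown since that node was last found small or emptied.
      large     : ∀ w → Queued i w ⊎ r (name w) ≤ x
      touched   : ∀ w → Queued 0 w ⊎ (r (name w) ≤ 0# × q w ≤ 0#)
      -- `x + x` is the threshold before the last halving, when all residues were at most that
      -- large. The bound persists because `q` only grows.
      error     : ∀ w → contribution w ≤ α * q w + (x + x)
      -- Each entry after the first is paid for by an edge crossed with at least the current `x`.
      -- Twice the initial mass pays for the first entry and for the `suc`, which will cover the
      -- step that halves `x`.
      length    : fromℕ (suc k) * x ≤ mass + mass + Flow.flow flowing
      -- A step that crosses an edge raises `k` and a step that scans an entry raises `i`;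
      -- everything before the last halving is covered by the potential and one queue length.
      time      : fromℕ N * x ≤ fromℕ (k ℕ.+ i) * x + (mass + mass + Flow.flow flowing)

    0≤x : 0# ≤ x
    0≤x = proj₁ 0<x

  PushInv-∷ : ∀ {N out p u} → PushInv N out p → PushInv N (u ∷ out) p
  PushInv-∷ {out = out} {p} {u} inv = record
    { q = q ; φ = φ ; flowing = flowing ; mass≈ = mass≈ ; 0<x = 0<x ; x≤ρ = x≤ρ
    ; φ-other = φ-other ; φ-done = φ-done ; φ-pending = φ-pending
    ; e≤indeg = e≤indeg ; i≤k = i≤k
    ; queue-ok = λ z z<k → let w , eq , w∈out = queue-ok z z<k in w , eq , there w∈out
    ; large = large ; touched = touched ; error = error ; length = length ; time = time
    }
    where open PushInv inv

  -- Each field is by definition what the registers and arrays contain once the program has crossed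
  -- one edge.
  passOn : Push → ℕ → V → ℝ → Push
  passOn (mkPush v _ i k queue mass x ρ r) e u g =
    mkPush v e i (1 ℕ.+ k) (queue [ k ↦ name u ]) (mass + g) x ρ
           (r [ name u ↦ r (name u) + g ])

  -- The flow grows by `ρ ≥ x`, which pays for the new queue entry in `length`; the larger `k` pays
  -- for the step in `time`. The parent is queued whatever its residue, and possibly again.
  passOn-inv : ∀ {N out v e i k queue mass x ρ r} →
    PushInv N out (mkPush v (suc e) i k queue mass x ρ r) →
    (e< : e ℕ.< indeg v) → ∀ {g} →
    g ≈ β * ρ * outdegℝ (parent v (fromℕ< e<)) ⁻¹ →
    PushInv (suc N) (parent v (fromℕ< e<) ∷ out)
      (passOn (mkPush v (suc e) i k queue mass x ρ r) e (parent v (fromℕ< e<)) g)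
  passOn-inv {N} {out} {v} {e} {i} {k} {queue} {mass} {x} {ρ} {r} inv e< {g} g≈ = record
    { q         = q
    ; φ         = φ′
    ; flowing   = flowing′
    ; mass≈     = mass′≈
    ; 0<x       = 0<x
    ; x≤ρ       = λ _ → x≤ρ (s≤s z≤n)
    ; φ-other   = λ a b b≢v ab → trans (reflexive (φ-miss a b (inj₂ b≢v))) (φ-other a b b≢v ab)
    ; φ-done    = φ-done′
    ; φ-pending = λ p p<e → trans (+-congʳ (reflexive (φ-miss (parent v p) v (inj₁ (λ eq →
                    ℕ.<-irrefl (toℕ-parent eq) p<e)))))
                    (φ-pending p (ℕ.m≤n⇒m≤1+n p<e))
    ; e≤indeg   = ℕ.<⇒≤ e<
    ; i≤k       = ℕ.m≤n⇒m≤1+n i≤k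
    ; queue-ok  = queue-ok′
    ; large     = large′
    ; touched   = touched′
    ; error     = error
    ; length    = ≤-trans (≤-respˡ (sym (suc-* (suc k))) (+-mono-≤ x≤ρ′ length)) grows
    ; time      = begin
        fromℕ (suc N) * x
          ≈⟨ suc-* N ⟩
        x + fromℕ N * x
          ≤⟨ +-monoʳ-≤ x time ⟩
        x + (fromℕ (k ℕ.+ i) * x + (mass + mass + Flow.flow flowing))
          ≈⟨ +-assoc _ _ _ ⟨
        x + fromℕ (k ℕ.+ i) * x + (mass + mass + Flow.flow flowing)
          ≈⟨ +-congʳ (suc-* (k ℕ.+ i)) ⟨
        fromℕ (suc (k ℕ.+ i)) * x + (mass + mass + Flow.flow flowing)
          ≤⟨ +-monoʳ-≤ _ (≤-trans (x≤y+x 0≤ρ) grows) ⟩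
        fromℕ (suc (k ℕ.+ i)) * x + (mass + g + (mass + g) + Flow.flow flowing′) ∎
    }
    where
    open PushInv inv
    open Push (mkPush v (suc e) i k queue mass x ρ r) using (Queued)
    open Flow flowing using (0≤q; 0≤r; 0≤φ; φ≤q; balance)
    u = parent v (fromℕ< e<)
    r′ = r [ name u ↦ r (name u) + g ]
    φ′ : V → V → ℝ
    φ′ = updateAt φ u λ row → updateAt row v (_+ ρ)

    x≤ρ′ : x ≤ ρ
    x≤ρ′ = x≤ρ (s≤s z≤n)

    0≤ρ : 0# ≤ ρ
    0≤ρ = ≤-trans 0≤x x≤ρ′

    0≤g : 0# ≤ g
    0≤g = ≤-respʳ (sym g≈) (*-nonNeg (*-nonNeg 0≤β 0≤ρ) (0≤outdeg⁻¹ u))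

    suc-* : ∀ j → fromℕ (suc j) * x ≈ x + fromℕ j * x
    suc-* j = trans (distribʳ x 1# (fromℕ j)) (+-congʳ (*-identityˡ x))

    toℕ-parent : ∀ {p} → parent v p ≡ u → toℕ p ≡ e
    toℕ-parent eq = ≡.trans (≡.cong toℕ (parent-injective eq)) (Fin.toℕ-fromℕ< e<)

    φ-hit : φ′ u v ≡ φ u v + ρ
    φ-hit = ≡.trans (≡.cong (λ row → row v) (updateAt-updates u φ))
                    (updateAt-updates v (φ u))

    φ-row : ∀ b → b ≢ v → φ′ u b ≡ φ u b
    φ-row b b≢v = ≡.trans (≡.cong (λ row → row b) (updateAt-updates u φ))
                          (updateAt-minimal b v (φ u) b≢v)

    φ-rows : ∀ a → a ≢ u → φ′ a ≡ φ a
    φ-rows a a≢u = updateAt-minimal a u φ a≢u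

    φ-miss : ∀ a b → a ≢ u ⊎ b ≢ v → φ′ a b ≡ φ a b
    φ-miss a b (inj₁ a≢u) = ≡.cong (λ row → row b) (φ-rows a a≢u)
    φ-miss a b (inj₂ b≢v) with a Fin.≟ u
    ... | yes ≡.refl = φ-row b b≢v
    ... | no  a≢u    = ≡.cong (λ row → row b) (φ-rows a a≢u)

    φ-hit≈q : φ′ u v ≈ q v
    φ-hit≈q = trans (reflexive φ-hit)
      (φ-pending (fromℕ< e<) (s≤s (ℕ.≤-reflexive (Fin.toℕ-fromℕ< e<))))

    φ-done′ : ∀ p → e ℕ.≤ toℕ p → φ′ (parent v p) v ≈ q v
    φ-done′ p e≤p with parent v p Fin.≟ u
    ... | yes eq = trans (reflexive (≡.cong (λ a → φ′ a v) eq)) φ-hit≈q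
    ... | no  p≢u = trans (reflexive (φ-miss (parent v p) v (inj₁ p≢u)))
                     (φ-done p (ℕ.≤∧≢⇒< e≤p λ e≡p → p≢u (≡.cong (parent v)
                       (Fin.toℕ-injective (≡.trans (≡.sym e≡p) (≡.sym (Fin.toℕ-fromℕ< e<)))))))

    sum-row : sum (φ′ u) ≈ ρ + sum (φ u)
    sum-row = sum-bump v (trans (reflexive φ-hit) (+-comm _ ρ))
                λ b b≢v → reflexive (φ-row b b≢v)

    sum-rows : ∀ a → a ≢ u → sum (φ′ a) ≈ sum (φ a)
    sum-rows a a≢u = reflexive (≡.cong sum (φ-rows a a≢u))

    r-hit : r′ (name u) ≡ r (name u) + g
    r-hit = ↦-same r (name u)

    r-miss : ∀ a → a ≢ u → r′ (name a) ≡ r (name a)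
    r-miss a a≢u = ↦-other r (a≢u ∘ name-injective)

    flowing′ : Flow q (r′ ∘ name) φ′
    flowing′ = record
      { 0≤q     = 0≤q
      ; 0≤r     = 0≤r′
      ; 0≤φ     = 0≤φ′
      ; φ≤q     = φ≤q′
      ; balance = balance′
      }
      where
      0≤r′ : ∀ a → 0# ≤ r′ (name a)
      0≤r′ a with a Fin.≟ u
      ... | yes ≡.refl = ≤-respʳ (reflexive (≡.sym r-hit)) (+-nonNeg (0≤r u) 0≤g)
      ... | no  a≢u    = ≤-respʳ (reflexive (≡.sym (r-miss a a≢u))) (0≤r a)
      hit-or-miss : ∀ {ℓ} (P : ℝ → V → V → Set ℓ) →
        P (φ′ u v) u v → (∀ a b → P (φ a b) a b) → ∀ a b → P (φ′ a b) a b
      hit-or-miss P hit miss a b with a Fin.≟ u | b Fin.≟ v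
      ... | yes ≡.refl | yes ≡.refl = hit
      ... | yes ≡.refl | no b≢v = ≡.subst (λ y → P y u b) (≡.sym (φ-row b b≢v)) (miss u b)
      ... | no a≢u     | _ = ≡.subst (λ y → P y a b) (≡.sym (φ-miss a b (inj₁ a≢u))) (miss a b)
      0≤φ′ : ∀ a b → 0# ≤ φ′ a b
      0≤φ′ = hit-or-miss (λ y _ _ → 0# ≤ y) (≤-respʳ (sym φ-hit≈q) (0≤q v)) 0≤φ
      φ≤q′ : ∀ a b → φ′ a b ≤ indicator (edge a b) * q b
      φ≤q′ = hit-or-miss (λ y a b → y ≤ indicator (edge a b) * q b)
        (≤-reflexive (trans φ-hit≈q (trans (sym (*-identityˡ (q v)))
          (*-congʳ (reflexive (≡.cong indicator (≡.sym (parent-edge v (fromℕ< e<))))))))) φ≤q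
      balance′ : ∀ a → q a + r′ (name a) ≈ unit a + β * (outdegℝ a ⁻¹ * sum (φ′ a))
      balance′ a with a Fin.≟ u
      ... | yes ≡.refl = begin-equality
        q u + r′ (name u)         ≈⟨ +-congˡ (reflexive r-hit) ⟩
        q u + (r (name u) + g)    ≈⟨ +-assoc _ _ g ⟨
        q u + r (name u) + g      ≈⟨ +-cong (balance u) g≈ ⟩
        unit u + β * (outdegℝ u ⁻¹ * sum (φ u)) + β * ρ * outdegℝ u ⁻¹
          ≈⟨ solve 5 (λ e b d s p → e :+ b :* (d :* s) :+ b :* p :* d := e :+ b :* (d :* (p :+ s))) refl (unit u) β (outdegℝ u ⁻¹) (sum (φ u)) ρ ⟩
        unit u + β * (outdegℝ u ⁻¹ * (ρ + sum (φ u)))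
          ≈⟨ +-congˡ (*-congˡ (*-congˡ sum-row)) ⟨
        unit u + β * (outdegℝ u ⁻¹ * sum (φ′ u)) ∎
      ... | no a≢u = trans (+-congˡ (reflexive (r-miss a a≢u))) (trans (balance a)
        (+-congˡ (*-congˡ (*-congˡ (sym (sum-rows a a≢u))))))

    mass′≈ : mass + g ≈ Flow.mass flowing′
    mass′≈ = trans (+-comm mass g) (trans (+-congˡ mass≈) (sym (sum-bump u
      (trans (+-congˡ (reflexive r-hit))
        (solve 3 (λ q r g → q :+ (r :+ g) := g :+ (q :+ r)) refl (q u) (r (name u)) g))
      λ a a≢u → +-congˡ (reflexive (r-miss a a≢u)))))

    flow′≈ : Flow.flow flowing′ ≈ ρ + Flow.flow flowing
    flow′≈ = sum-bump u sum-row sum-rows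

    grows : ρ + (mass + mass + Flow.flow flowing) ≤ mass + g + (mass + g) + Flow.flow flowing′
    grows = begin
      ρ + (mass + mass + Flow.flow flowing)
        ≤⟨ x≤y+x (+-nonNeg 0≤g 0≤g) ⟩
      g + g + (ρ + (mass + mass + Flow.flow flowing))
        ≈⟨ solve 4 (λ g p m f → g :+ g :+ (p :+ (m :+ m :+ f)) := m :+ g :+ (m :+ g) :+ (p :+ f)) refl g ρ mass (Flow.flow flowing) ⟩
      mass + g + (mass + g) + (ρ + Flow.flow flowing)
        ≈⟨ +-congˡ flow′≈ ⟨
      mass + g + (mass + g) + Flow.flow flowing′ ∎

    Queued′ : ℕ → V → Set
    Queued′ = Push.Queued (passOn (mkPush v (suc e) i k queue mass x ρ r) e u g)

    keep : ∀ {lo w} → Queued lo w → Queued′ lo w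
    keep (z , lo≤z , z<k , eq) =
      z , lo≤z , ℕ.m≤n⇒m≤1+n z<k , ≡.trans (↦-other queue (ℕ.<⇒≢ z<k)) eq

    new : ∀ {lo} → lo ℕ.≤ k → Queued′ lo u
    new lo≤k = k , lo≤k , ℕ.≤-refl , ↦-same queue k

    queue-ok′ : ∀ z → z ℕ.< suc k → ∃[ w ] (queue [ k ↦ name u ]) z ≡ name w × w ∈ u ∷ out
    queue-ok′ z z<1+k with z ℕ.≟ k
    ... | yes ≡.refl = u , ≡.refl , here ≡.refl
    ... | no  z≢k with queue-ok z (ℕ.≤∧≢⇒< (ℕ.s≤s⁻¹ z<1+k) z≢k)
    ...   | w , eq , w∈out = w , eq , there w∈out

    large′ : ∀ w → Queued′ i w ⊎ r′ (name w) ≤ x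
    large′ w with w Fin.≟ u | large w
    ... | yes ≡.refl | _          = inj₁ (new i≤k)
    ... | no  _      | inj₁ qd    = inj₁ (keep qd)
    ... | no  w≢u    | inj₂ r≤x   = inj₂ (≤-respˡ (reflexive (≡.sym (r-miss w w≢u))) r≤x)

    touched′ : ∀ w → Queued′ 0 w ⊎ (r′ (name w) ≤ 0# × q w ≤ 0#)
    touched′ w with w Fin.≟ u | touched w
    ... | yes ≡.refl | _               = inj₁ (new z≤n)
    ... | no  _      | inj₁ qd         = inj₁ (keep qd)
    ... | no  w≢u    | inj₂ (r≤0 , q≤0) =
      inj₂ (≤-respˡ (reflexive (≡.sym (r-miss w w≢u))) r≤0 , q≤0)

  module _ {N out v i k queue mass x ρ r}
           (inv : PushInv N out (mkPush v 0 i k queue mass x ρ r)) where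

    open PushInv inv
    open Push (mkPush v 0 i k queue mass x ρ r) using (Queued)
    open Flow flowing using (0≤q; 0≤r; 0≤φ; φ≤q; balance)

    private
      potential = mass + mass + Flow.flow flowing

      -- With `e = 0` even the last node pushed has served all its parents, and every incoming edge
      -- has an index because the enumeration is onto.
      settled : ∀ u w → edge u w ≡ true → φ u w ≈ q w
      settled u w uw with w Fin.≟ v
      ... | no  w≢v    = φ-other u w w≢v uw
      ... | yes ≡.refl with edge⇒parent uw
      ...   | p , ≡.refl = φ-done p z≤n

      suc-* : ∀ j y → fromℕ (suc j) * y ≈ y + fromℕ j * y
      suc-* j y = trans (distribʳ y 1# (fromℕ j)) (+-congʳ (*-identityˡ y))

      scanned : fromℕ (suc N) * x ≤ fromℕ (k ℕ.+ suc i) * x + potential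
      scanned = begin
        fromℕ (suc N) * x                   ≈⟨ suc-* N x ⟩
        x + fromℕ N * x                     ≤⟨ +-monoʳ-≤ x time ⟩
        x + (fromℕ (k ℕ.+ i) * x + potential) ≈⟨ +-assoc _ _ _ ⟨
        x + fromℕ (k ℕ.+ i) * x + potential ≈⟨ +-congʳ (suc-* (k ℕ.+ i) x) ⟨
        fromℕ (suc (k ℕ.+ i)) * x + potential
          ≡⟨ ≡.cong (λ j → fromℕ j * x + potential) (ℕ.+-suc k i) ⟨
        fromℕ (k ℕ.+ suc i) * x + potential ∎

      requeue : ∀ {w a} → queue i ≡ name w → a ≢ w → Queued i a → Queued (suc i) a
      requeue qi a≢w (z , i≤z , z<k , qz) =
        z , ℕ.≤∧≢⇒< i≤z (λ { ≡.refl → a≢w (name-injective (≡.trans (≡.sym qz) qi)) }) , z<k , qz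

    -- The scan overwrites `v` and `ρ` although nothing is pushed. This is harmless because with
    -- `e = 0` the conditions on the current push hold for any node.
    skip-inv : ∀ {w} → i ℕ.< k → queue i ≡ name w → ¬ x ≤ r (name w) →
      PushInv (suc N) out (mkPush w 0 (suc i) k queue mass x (r (name w)) r)
    skip-inv {w} i<k qi x≰r = record
      { q         = q
      ; φ         = φ
      ; flowing   = flowing
      ; mass≈     = mass≈
      ; 0<x       = 0<x
      ; x≤ρ       = λ ()
      ; φ-other   = λ a b _ → settled a b
      ; φ-done    = λ p _ → settled _ w (parent-edge w p)
      ; φ-pending = λ _ ()
      ; e≤indeg   = z≤n
      ; i≤k       = i<k
      ; queue-ok  = queue-ok
      ; large     = large′
      ; touched   = touched
      ; error     = error
      ; length    = length
      ; time      = scanned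
      }
      where
      large′ : ∀ a → Push.Queued (mkPush w 0 (suc i) k queue mass x ρ r) (suc i) a ⊎ r (name a) ≤ x
      large′ a with a Fin.≟ w | large a
      ... | yes ≡.refl | _        = inj₂ (≰⇒≥ x≰r)
      ... | no  a≢w    | inj₁ qd  = inj₁ (requeue qi a≢w qd)
      ... | no  _      | inj₂ r≤x = inj₂ r≤x

    -- Moving the residue into `q` leaves `received` unchanged, and `φ` is not touched, so mass,
    -- flow and `balance` carry over. The edges into `w` all become pending.
    start-inv : ∀ {w} → i ℕ.< k → queue i ≡ name w → x ≤ r (name w) →
      PushInv (suc N) out
        (mkPush w (indeg w) (suc i) k queue mass x (r (name w)) (r [ name w ↦ 0# ]))
    start-inv {w} i<k qi x≤r = record
      { q         = q′
      ; φ         = φ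
      ; flowing   = flowing′
      ; mass≈     = trans mass≈ (sum-cong-≋ λ a → sym (received′ a))
      ; 0<x       = 0<x
      ; x≤ρ       = λ _ → x≤r
      ; φ-other   = λ a b b≢w ab → trans (settled a b ab) (reflexive (≡.sym (q-miss b b≢w)))
      ; φ-done    = λ p indeg≤p → contradiction (Fin.toℕ<n p) (ℕ.≤⇒≯ indeg≤p)
      ; φ-pending = λ p _ → trans (+-congʳ (settled _ w (parent-edge w p))) (sym (reflexive q-hit))
      ; e≤indeg   = ℕ.≤-refl
      ; i≤k       = i<k
      ; queue-ok  = queue-ok
      ; large     = large′
      ; touched   = touched′
      ; error     = λ a → ≤-trans (error a) (+-monoˡ-≤ _ (*-monoˡ-≤ 0≤α (q≤q′ a)))
      ; length    = length
      ; time      = scanned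
      }
      where
      q′ : V → ℝ
      q′ = updateAt q w (_+ r (name w))
      r′ = r [ name w ↦ 0# ]
      q-hit : q′ w ≡ q w + r (name w)
      q-hit = updateAt-updates w q
      q-miss : ∀ a → a ≢ w → q′ a ≡ q a
      q-miss a a≢w = updateAt-minimal a w q a≢w
      r-hit : r′ (name w) ≡ 0#
      r-hit = ↦-same r (name w)
      r-miss : ∀ a → a ≢ w → r′ (name a) ≡ r (name a)
      r-miss a a≢w = ↦-other r (a≢w ∘ name-injective)
      q≤q′ : ∀ a → q a ≤ q′ a
      q≤q′ a with a Fin.≟ w
      ... | yes ≡.refl = ≤-respʳ (reflexive (≡.sym q-hit)) (x≤x+y (0≤r w))
      ... | no  a≢w    = ≤-reflexive (reflexive (≡.sym (q-miss a a≢w)))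
      received′ : ∀ a → q′ a + r′ (name a) ≈ q a + r (name a)
      received′ a with a Fin.≟ w
      ... | yes ≡.refl = trans (+-cong (reflexive q-hit) (reflexive r-hit)) (+-identityʳ _)
      ... | no  a≢w    = +-cong (reflexive (q-miss a a≢w)) (reflexive (r-miss a a≢w))
      0≤r′ : ∀ a → 0# ≤ r′ (name a)
      0≤r′ a with a Fin.≟ w
      ... | yes ≡.refl = ≤-reflexive (reflexive (≡.sym r-hit))
      ... | no  a≢w    = ≤-respʳ (reflexive (≡.sym (r-miss a a≢w))) (0≤r a)
      flowing′ : Flow q′ (r′ ∘ name) φ
      flowing′ = record
        { 0≤q     = λ a → ≤-trans (0≤q a) (q≤q′ a)
        ; 0≤r     = 0≤r′
        ; 0≤φ     = 0≤φ
        ; φ≤q     = λ a b → ≤-trans (φ≤q a b) (*-monoˡ-≤ (0≤indicator (edge a b)) (q≤q′ b))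
        ; balance = λ a → trans (received′ a) (balance a)
        }
      Queued′ : ℕ → V → Set
      Queued′ = Push.Queued (mkPush w (indeg w) (suc i) k queue mass x (r (name w)) r′)
      large′ : ∀ a → Queued′ (suc i) a ⊎ r′ (name a) ≤ x
      large′ a with a Fin.≟ w | large a
      ... | yes ≡.refl | _        = inj₂ (≤-respˡ (reflexive (≡.sym r-hit)) 0≤x)
      ... | no  a≢w    | inj₁ qd  = inj₁ (requeue qi a≢w qd)
      ... | no  a≢w    | inj₂ r≤x = inj₂ (≤-respˡ (reflexive (≡.sym (r-miss a a≢w))) r≤x)
      touched′ : ∀ a → Queued′ 0 a ⊎ (r′ (name a) ≤ 0# × q′ a ≤ 0#)
      touched′ a with a Fin.≟ w | touched a
      ... | yes ≡.refl | _ = inj₁ (i , z≤n , i<k , qi)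
      ... | no  _      | inj₁ qd = inj₁ qd
      ... | no  a≢w    | inj₂ (r≤0 , q≤0) =
        inj₂ (≤-respˡ (reflexive (≡.sym (r-miss a a≢w))) r≤0 ,
              ≤-respˡ (reflexive (≡.sym (q-miss a a≢w))) q≤0)

    -- With `i = k`, the time including this step is at most `(k + 1) x + k x + Z` in units of `x`,
    -- where `Z` is the potential. By `length` the first summand is at most `Z`, and `k x + 2 Z` is
    -- twice `k x′ + Z`, the bound required at `i = 0`. As no residue exceeds the old threshold
    -- `2 x′`, `error` is renewed as well.
    rewind-inv : ∀ {x′} → i ≡ k → x′ + x′ ≈ x →
                 PushInv (suc N) out (mkPush v 0 0 k queue mass x′ ρ r)
    rewind-inv {x′} i≡k x′+x′≈x = record
      { q         = q
      ; φ         = φ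
      ; flowing   = flowing
      ; mass≈     = mass≈
      ; 0<x       = 0≤x′ , λ 0≈x′ → proj₂ 0<x (trans (sym (+-identityˡ 0#)) (trans (+-cong 0≈x′ 0≈x′) x′+x′≈x))
      ; x≤ρ       = λ ()
      ; φ-other   = φ-other
      ; φ-done    = φ-done
      ; φ-pending = φ-pending
      ; e≤indeg   = e≤indeg
      ; i≤k       = z≤n
      ; queue-ok  = queue-ok
      ; large     = large′
      ; touched   = touched
      ; error     = λ a → ≤-respʳ (+-congˡ (sym x′+x′≈x))
                    (Flow.contribution≤ flowing
                      (λ u w uw → ≤-reflexive (sym (settled u w uw))) r≤x a)
      ; length    = ≤-trans (*-monoˡ-≤ (fromℕ-nonNeg (suc k)) x′≤x) length
      ; time      = halve (begin
          fromℕ (suc N) * x′ + fromℕ (suc N) * x′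
            ≈⟨ trans (sym (distribˡ _ x′ x′)) (*-congˡ x′+x′≈x) ⟩
          fromℕ (suc N) * x
            ≤⟨ scanned ⟩
          fromℕ (k ℕ.+ suc i) * x + potential
            ≡⟨ ≡.cong (λ j → fromℕ j * x + potential) (≡.trans (≡.cong (λ j → k ℕ.+ suc j) i≡k) (ℕ.+-suc k k)) ⟩
          fromℕ (suc k ℕ.+ k) * x + potential
            ≈⟨ +-congʳ (trans (*-congʳ (fromℕ-+ (suc k) k)) (distribʳ x _ _)) ⟩
          fromℕ (suc k) * x + fromℕ k * x + potential
            ≤⟨ +-monoˡ-≤ potential (+-monoˡ-≤ _ length) ⟩
          potential + fromℕ k * x + potential
            ≈⟨ +-congʳ (+-congˡ (*-congˡ x′+x′≈x)) ⟨
          potential + fromℕ k * (x′ + x′) + potential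
            ≈⟨ solve 3 (λ p k y → p :+ k :* (y :+ y) :+ p := (k :* y :+ p) :+ (k :* y :+ p)) refl potential (fromℕ k) x′ ⟩
          (fromℕ k * x′ + potential) + (fromℕ k * x′ + potential)
            ≡⟨ ≡.cong (λ j → (fromℕ j * x′ + potential) + (fromℕ j * x′ + potential)) (ℕ.+-identityʳ k) ⟨
          (fromℕ (k ℕ.+ 0) * x′ + potential) + (fromℕ (k ℕ.+ 0) * x′ + potential) ∎)
      }
      where
      halve : ∀ {a b} → a + a ≤ b + b → a ≤ b
      halve {a} {b} 2a≤2b with a ≤? b
      ... | yes a≤b = a≤b
      ... | no  a≰b = +-cancelˡ-≤ b (≤-trans (+-monoˡ-≤ a (≰⇒≥ a≰b)) 2a≤2b)
      0≤x′ : 0# ≤ x′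
      0≤x′ = halve (≤-respˡ (sym (+-identityˡ 0#)) (≤-respʳ (sym x′+x′≈x) 0≤x))
      x′≤x : x′ ≤ x
      x′≤x = ≤-respʳ x′+x′≈x (x≤x+y 0≤x′)
      r≤x : ∀ a → r (name a) ≤ x
      r≤x a with large a
      ... | inj₂ r≤x = r≤x
      ... | inj₁ (z , i≤z , z<k , _) =
        contradiction (≡.subst (ℕ._≤ z) i≡k i≤z) (ℕ.<⇒≱ z<k)
      large′ : ∀ a → Push.Queued (mkPush v 0 0 k queue mass x′ ρ r) 0 a ⊎ r (name a) ≤ x′
      large′ a with touched a
      ... | inj₁ qd        = inj₁ qd
      ... | inj₂ (r≤0 , _) = inj₂ (≤-trans r≤0 0≤x′)

  -- The machine obtains its unit as `fromℕ 1`, which is equal to `1#` only up to `≈`; hence the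
  -- parameter.
  initialPush : ℝ → Push
  initialPush one = mkPush t 0 0 1 ((λ _ → 0) [ 0 ↦ name t ]) one one 0#
                           ((λ _ → 0#) [ name t ↦ one ])

  initialPush-inv : ∀ {one} → one ≈ 1# → PushInv 0 (t ∷ []) (initialPush one)
  initialPush-inv {one} one≈1 = record
    { q         = λ _ → 0#
    ; φ         = λ _ _ → 0#
    ; flowing   = flowing
    ; mass≈     = mass≈
    ; 0<x       = 0≤one , λ 0≈one → 0≉1 (trans 0≈one one≈1)
    ; x≤ρ       = λ ()
    ; φ-other   = λ _ _ _ _ → refl
    ; φ-done    = λ _ _ → refl
    ; φ-pending = λ _ ()
    ; e≤indeg   = z≤n
    ; i≤k       = z≤n
    ; queue-ok  = λ { zero _ → t , ≡.refl , here ≡.refl ; (suc _) (s≤s ()) }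
    ; large     = λ w → inj₂ (r≤one w)
    ; touched   = touched
    ; error     = λ w → ≤-trans
        (Flow.contribution≤ flowing (λ _ _ _ → ≤-refl) r≤one w)
        (+-monoʳ-≤ _ (x≤x+y 0≤one))
    ; length    = ≤-reflexive (begin-equality
        fromℕ 2 * one         ≈⟨ solve 1 (λ x → (con 1 :+ (con 1 :+ con 0)) :* x := x :+ x :+ con 0) refl one ⟩
        one + one + 0#        ≈⟨ +-congˡ no-flow ⟨
        one + one + Flow.flow flowing ∎)
    ; time      = ≤-respˡ (sym (zeroˡ one)) (+-nonNeg (*-nonNeg (fromℕ-nonNeg 1) 0≤one)
        (+-nonNeg (+-nonNeg 0≤one 0≤one) (Flow.0≤flow flowing)))
    }
    where
    r = (λ _ → 0#) [ name t ↦ one ]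
    0≤one : 0# ≤ one
    0≤one = ≤-respʳ (sym one≈1) 0≤1
    r-t : r (name t) ≡ one
    r-t = ↦-same (λ _ → 0#) (name t)
    r-other : ∀ w → w ≢ t → r (name w) ≡ 0#
    r-other w w≢t = ↦-other (λ _ → 0#) (w≢t ∘ name-injective)
    r≈unit : ∀ w → r (name w) ≈ unit w
    r≈unit w with w Fin.≟ t
    ... | yes ≡.refl = trans (reflexive r-t) one≈1
    ... | no  w≢t    = reflexive (r-other w w≢t)
    r≤one : ∀ w → r (name w) ≤ one
    r≤one w with w Fin.≟ t
    ... | yes ≡.refl = ≤-reflexive (reflexive r-t)
    ... | no  w≢t    = ≤-respˡ (sym (reflexive (r-other w w≢t))) 0≤one
    flowing : Flow (λ _ → 0#) (r ∘ name) (λ _ _ → 0#)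
    flowing = record
      { 0≤q     = λ _ → ≤-refl
      ; 0≤r     = λ w → ≤-respʳ (sym (r≈unit w)) (0≤unit w)
      ; 0≤φ     = λ _ _ → ≤-refl
      ; φ≤q     = λ u w → ≤-reflexive (sym (zeroʳ _))
      ; balance = λ u → trans (trans (+-identityˡ _) (r≈unit u)) (sym (trans (+-congˡ
          (trans (*-congˡ (trans (*-congˡ (sum-replicate-zero n)) (zeroʳ _))) (zeroʳ β)))
          (+-identityʳ _)))
      }
    mass≈ : one ≈ Flow.mass flowing
    mass≈ = sym (trans (SumUpdate.sum-bump +-commutativeMonoid {g = λ _ → 0#} t
        (trans (+-identityˡ _) (trans (reflexive r-t) (sym (+-identityʳ one))))
        (λ w w≢t → trans (+-identityˡ _) (reflexive (r-other w w≢t))))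
      (trans (+-congˡ (sum-replicate-zero n)) (+-identityʳ one)))
    no-flow : Flow.flow flowing ≈ 0#
    no-flow = trans (sum-cong-≋ {n} λ _ → sum-replicate-zero n) (sum-replicate-zero n)
    touched : ∀ w → Push.Queued (initialPush one) 0 w ⊎ (r (name w) ≤ 0# × 0# ≤ 0#)
    touched w with w Fin.≟ t
    ... | yes ≡.refl = inj₁ (0 , z≤n , s≤s z≤n , ≡.refl)
    ... | no  w≢t    = inj₂ (≤-reflexive (reflexive (r-other w w≢t)) , ≤-refl)

  module _ {N out p} (inv : PushInv N out p) {δ} (0<δ : 0# < δ) where

    open Push p
    open PushInv inv

    1≤mass : 1# ≤ mass
    1≤mass = ≤-respʳ (sym mass≈) (Flow.1≤mass flowing)

    -- A node that was never queued has `q = 0`, so `error` leaves it a contribution of at most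
    -- `2 x`, which is below `δ α S`. Queued nodes have been output, whether pushed or not.
    output-superset : ¬ (δ * α * mass ≤ x + x) → ∀ w → Contributing π δ t w → w ∈ out
    output-superset ≰x+x w contributing with touched w
    ... | inj₁ (z , _ , z<k , qz) with queue-ok z z<k
    ...   | w′ , qz′ , w′∈out =
      ≡.subst (_∈ out) (name-injective (≡.trans (≡.sym qz′) qz)) w′∈out
    output-superset ≰x+x w contributing | inj₂ (_ , q≤0) = contradiction (begin
      δ * α * mass             ≈⟨ *-assoc δ α mass ⟩
      δ * (α * mass)           ≈⟨ *-congˡ (*-congˡ mass≈) ⟩
      δ * (α * Flow.mass flowing) ≤⟨ *-monoˡ-≤ (proj₁ 0<δ) (Flow.α*mass≤total flowing) ⟩
      δ * total                ≤⟨ contributing⇒≤ contributing ⟩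
      contribution w           ≤⟨ error w ⟩
      α * q w + (x + x)        ≤⟨ +-monoˡ-≤ _ (*-monoˡ-≤ 0≤α q≤0) ⟩
      α * 0# + (x + x)         ≈⟨ solve 2 (λ a x → a :* con 0 :+ (x :+ x) := x :+ x) refl α x ⟩
      x + x                    ∎) ≰x+x

    -- Both `i x` and `k x` are at most `Z = 2 mass + F`, so `N x ≤ 3 Z`. From `β ≤ 1 ≤ B` and the
    -- bound on the flow, `β Z ≤ 4 B mass`, which makes `12 B mass`; replacing `δ α mass` by `2 x`
    -- gives 24, and `x` cancels.
    steps-bound : δ * α * mass ≤ x + x → ∀ {B} → 1# ≤ B →
                  β * Flow.flow flowing ≤ B * Flow.mass flowing + B * Flow.mass flowing →
                  α * β * δ * fromℕ N ≤ fromℕ 24 * B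
    steps-bound running {B} 1≤B flow≤ = *-cancelˡ-≤ 0<x (begin
      x * (α * β * δ * fromℕ N)
        ≈⟨ solve 5 (λ x a b d n → x :* (a :* b :* d :* n) := d :* a :* (b :* (n :* x))) refl x α β δ (fromℕ N) ⟩
      δ * α * (β * (fromℕ N * x))
        ≤⟨ *-monoˡ-≤ 0≤δα (*-monoˡ-≤ 0≤β steps≤) ⟩
      δ * α * (β * (Z + Z + Z))
        ≈⟨ *-congˡ (solve 3 (λ b m f → b :* ((m :+ m :+ f) :+ (m :+ m :+ f) :+ (m :+ m :+ f))
             := b :* (numeral 6 :* m) :+ (b :* f :+ b :* f :+ b :* f)) refl β mass F) ⟩
      δ * α * (β * (six * mass) + (β * F + β * F + β * F))
        ≤⟨ *-monoˡ-≤ 0≤δα (+-mono-≤ (*-monoʳ-≤ (*-nonNeg 0≤six 0≤mass) (≤-trans β≤1 1≤B))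
             (+-mono-≤ (+-mono-≤ flow≤′ flow≤′) flow≤′)) ⟩
      δ * α * (B * (six * mass) + ((B * mass + B * mass) + (B * mass + B * mass) + (B * mass + B * mass)))
        ≈⟨ solve 3 (λ d b m → d :* (b :* (numeral 6 :* m) :+ ((b :* m :+ b :* m) :+ (b :* m :+ b :* m) :+ (b :* m :+ b :* m)))
             := numeral 12 :* b :* (d :* m)) refl (δ * α) B mass ⟩
      twelve * B * (δ * α * mass)
        ≤⟨ *-monoˡ-≤ (*-nonNeg 0≤twelve (≤-trans 0≤1 1≤B)) running ⟩
      twelve * B * (x + x)
        ≈⟨ solve 2 (λ b x → numeral 12 :* b :* (x :+ x) := x :* (numeral 24 :* b)) refl B x ⟩
      x * (fromℕ 24 * B) ∎)
      where
      six = fromℕ 6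
      twelve = fromℕ 12
      F = Flow.flow flowing
      Z = mass + mass + F
      0≤six : 0# ≤ six
      0≤six = fromℕ-nonNeg 6
      0≤twelve : 0# ≤ twelve
      0≤twelve = fromℕ-nonNeg 12
      0≤δα : 0# ≤ δ * α
      0≤δα = *-nonNeg (proj₁ 0<δ) 0≤α
      0≤mass : 0# ≤ mass
      0≤mass = ≤-trans 0≤1 1≤mass
      flow≤′ : β * F ≤ B * mass + B * mass
      flow≤′ = ≤-respʳ (+-cong (*-congˡ (sym mass≈)) (*-congˡ (sym mass≈))) flow≤
      k≤ : fromℕ k * x ≤ Z
      k≤ = ≤-trans (*-monoʳ-≤ 0≤x (fromℕ-mono-≤ (ℕ.n≤1+n k))) length
      steps≤ : fromℕ N * x ≤ Z + Z + Z
      steps≤ = begin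
        fromℕ N * x                ≤⟨ time ⟩
        fromℕ (k ℕ.+ i) * x + Z    ≤⟨ +-monoˡ-≤ Z (*-monoʳ-≤ 0≤x (fromℕ-mono-≤ (ℕ.+-monoʳ-≤ k i≤k))) ⟩
        fromℕ (k ℕ.+ k) * x + Z    ≈⟨ +-congʳ (trans (*-congʳ (fromℕ-+ k k)) (distribʳ x _ _)) ⟩
        fromℕ k * x + fromℕ k * x + Z ≤⟨ +-monoˡ-≤ Z (+-mono-≤ k≤ k≤) ⟩
        Z + Z + Z                  ∎

-- The depth-first search and its remaining work

module _ where

  open import Data.Nat using (_+_)
  open +-*-Solver

  visit-identity : ∀ a d s e → suc (a + (suc d + s + e)) ≡ suc d + a + (s + suc e)
  visit-identity = solve 4 (λ a d s e →
    con 1 :+ (a :+ ((con 1 :+ d :+ s) :+ e)) := ((con 1 :+ d) :+ a) :+ (s :+ (con 1 :+ e))) ≡.refl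

  pop-identity : ∀ a d s → suc (a + (s + d)) ≡ a + (suc d + s + 0)
  pop-identity = solve 3 (λ a d s →
    con 1 :+ (a :+ (s :+ d)) := a :+ ((con 1 :+ d :+ s) :+ con 0)) ≡.refl

  initial-identity : ∀ a d → a + (suc d + 0 + 0) ≡ suc d + a
  initial-identity = solve 2 (λ a d →
    a :+ ((con 1 :+ d :+ con 0) :+ con 0) := (con 1 :+ d) :+ a) ≡.refl

module SearchInvariant
  {c ℓ₁ ℓ₂ : Level} (R : RealField c ℓ₁ ℓ₂)
  (α : RealField.ℝ R)
  (0<α : RealField._<_ R (RealField.0# R) α)
  (α<1 : RealField._<_ R α (RealField.1# R))
  {G : DiGraph} (A : Access G)
  (π : DiGraph.V G → DiGraph.V G → RealField.ℝ R)
  (isContribution : PageRank.IsContribution R α G π)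
  (t : DiGraph.V G) where

  open RealField R hiding (zero)
  open OrderedFieldProperties orderedField
  open import Algebra.Properties.Semiring.Sum semiring
    using (sum-cong-≋; ∑-comm; ∑-distrib-+)
  open Algebra.Definitions.RawMonoid ℕ.+-0-rawMonoid using () renaming (sum to sumℕ)
  open SumUpdate ℕ.+-0-commutativeMonoid
  open DiGraph G
  open Access A
  open AccessProperties A
  open PageRank R α G
  open PageRankProperties R α 0<α α<1 G
  open Contributions π isContribution t

  -- The parents of v with an index below e are still to be visited.
  record Search : Set where
    constructor mkSearch
    field
      v       : V
      e       : ℕ
      stack   : List V
      cells   : ℕ → ℕ
      visited : ℕ → ℕ

  -- The head of the list is the top of the stack, kept in the cell whose index is the number of
  -- nodes beneath it. Cells above the top are left free.
  StackAt : (ℕ → ℕ) → List V → Set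
  StackAt cells []       = ⊤
  StackAt cells (w ∷ st) = cells (List.length st) ≡ name w × StackAt cells st

  unseen : ℕ → ℕ → ℕ
  unseen zero    d = d
  unseen (suc _) d = 0

  -- A node costs one step when it is popped and one for each of its parents.
  unseenWork : (ℕ → ℕ) → ℕ
  unseenWork visited = sumℕ λ w → unseen (visited (name w)) (suc (indeg w))

  stackWork : List V → ℕ
  stackWork []       = 0
  stackWork (w ∷ st) = suc (indeg w) ℕ.+ stackWork st

  -- M is the number of steps left.
  record SearchInv (M : ℕ) (out : List V) (s : Search) : Set where
    open Search s
    field
      e≤indeg  : e ℕ.≤ indeg v
      stack-ok : StackAt cells stack
      root     : visited (name t) ≢ 0
      listed   : ∀ w → visited (name w) ≢ 0 → w ∈ out
      -- With an empty stack and `e = 0` only the middle alternative survives, so the visited nodes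
      -- are then closed under taking parents.
      closed   : ∀ w p → visited (name w) ≢ 0 →
                 w ∈ stack ⊎ visited (name (parent w p)) ≢ 0 ⊎ (w ≡ v × toℕ p ℕ.< e)
      work     : unseenWork visited ℕ.+ (stackWork stack ℕ.+ e) ≡ M

  SearchInv-∷ : ∀ {M out s u} → SearchInv M out s → SearchInv M (u ∷ out) s
  SearchInv-∷ inv = record
    { e≤indeg = e≤indeg ; stack-ok = stack-ok ; root = root
    ; listed = λ w vis → there (listed w vis)
    ; closed = closed ; work = work
    }
    where open SearchInv inv

  stackAt-↦ : ∀ {cells y} st {z} → List.length st ℕ.≤ z → StackAt cells st →
              StackAt (cells [ z ↦ y ]) st
  stackAt-↦         []       _   _         = tt
  stackAt-↦ {cells} (w ∷ st) l≤z (eq , ok) =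
    ≡.trans (↦-other cells (ℕ.<⇒≢ l≤z)) eq , stackAt-↦ st (ℕ.<⇒≤ l≤z) ok

  module _ {M out v e stack cells visited}
           (inv : SearchInv (suc M) out (mkSearch v (suc e) stack cells visited))
           (e< : e ℕ.< indeg v) where

    open SearchInv inv
    private
      u = parent v (fromℕ< e<)

      parent≡u : ∀ {p} → e ≡ toℕ p → parent v p ≡ u
      parent≡u e≡p = ≡.cong (parent v)
        (Fin.toℕ-injective (≡.trans (≡.sym e≡p) (≡.sym (Fin.toℕ-fromℕ< e<))))

    seen-inv : visited (name u) ≢ 0 → SearchInv M out (mkSearch v e stack cells visited)
    seen-inv seen = record
      { e≤indeg  = ℕ.<⇒≤ e<
      ; stack-ok = stack-ok
      ; root     = root
      ; listed   = listed
      ; closed   = closed′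
      ; work     = ℕ.suc-injective (≡.trans (≡.sym (≡.trans
                     (≡.cong (unseenWork visited ℕ.+_) (ℕ.+-suc (stackWork stack) e))
                     (ℕ.+-suc _ _))) work)
      }
      where
      closed′ : ∀ w p → visited (name w) ≢ 0 →
                w ∈ stack ⊎ visited (name (parent w p)) ≢ 0 ⊎ (w ≡ v × toℕ p ℕ.< e)
      closed′ w p vis with closed w p vis
      ... | inj₁ w∈         = inj₁ w∈
      ... | inj₂ (inj₁ vis′) = inj₂ (inj₁ vis′)
      ... | inj₂ (inj₂ (≡.refl , p<1+e)) with toℕ p ℕ.≟ e
      ...   | no  p≢e = inj₂ (inj₂ (≡.refl , ℕ.≤∧≢⇒< (ℕ.s≤s⁻¹ p<1+e) p≢e))
      ...   | yes p≡e = inj₂ (inj₁ (≡.subst (λ a → visited (name a) ≢ 0) (≡.sym (parent≡u (≡.sym p≡e))) seen))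

    -- The work of `u` moves from `unseenWork` to `stackWork`, so the total drops exactly by the
    -- edge just followed.
    visit-inv : visited (name u) ≡ 0 →
      SearchInv M (u ∷ out) (mkSearch v e (u ∷ stack)
        (cells [ List.length stack ↦ name u ]) (visited [ name u ↦ 1 ]))
    visit-inv new = record
      { e≤indeg  = ℕ.<⇒≤ e<
      ; stack-ok = ↦-same cells (List.length stack) , stackAt-↦ stack ℕ.≤-refl stack-ok
      ; root     = vis′ root
      ; listed   = listed′
      ; closed   = closed′
      ; work     = ℕ.suc-injective (≡.trans (visit-identity
          (unseenWork visited′) (indeg u) (stackWork stack) e)
          (≡.trans (≡.cong (ℕ._+ (stackWork stack ℕ.+ suc e)) (≡.sym less)) work))
      }
      where
      visited′ = visited [ name u ↦ 1 ]
      hit : visited′ (name u) ≡ 1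
      hit = ↦-same visited (name u)
      miss : ∀ w → w ≢ u → visited′ (name w) ≡ visited (name w)
      miss w w≢u = ↦-other visited (w≢u ∘ name-injective)
      hit≢0 : visited′ (name u) ≢ 0
      hit≢0 eq with ≡.trans (≡.sym hit) eq
      ... | ()
      vis′ : ∀ {w} → visited (name w) ≢ 0 → visited′ (name w) ≢ 0
      vis′ {w} vis with w Fin.≟ u
      ... | yes ≡.refl = hit≢0
      ... | no  w≢u    = vis ∘ ≡.trans (≡.sym (miss w w≢u))
      listed′ : ∀ w → visited′ (name w) ≢ 0 → w ∈ u ∷ out
      listed′ w vis with w Fin.≟ u
      ... | yes ≡.refl = here ≡.refl
      ... | no  w≢u    = there (listed w (vis ∘ ≡.trans (miss w w≢u)))
      closed′ : ∀ w p → visited′ (name w) ≢ 0 →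
                w ∈ u ∷ stack ⊎ visited′ (name (parent w p)) ≢ 0 ⊎ (w ≡ v × toℕ p ℕ.< e)
      closed′ w p vis with w Fin.≟ u
      ... | yes ≡.refl = inj₁ (here ≡.refl)
      ... | no  w≢u with closed w p (vis ∘ ≡.trans (miss w w≢u))
      ...   | inj₁ w∈          = inj₁ (there w∈)
      ...   | inj₂ (inj₁ vis′′) = inj₂ (inj₁ (vis′ vis′′))
      ...   | inj₂ (inj₂ (≡.refl , p<1+e)) with toℕ p ℕ.≟ e
      ...     | no  p≢e = inj₂ (inj₂ (≡.refl , ℕ.≤∧≢⇒< (ℕ.s≤s⁻¹ p<1+e) p≢e))
      ...     | yes p≡e = inj₂ (inj₁ (≡.subst (λ a → visited′ (name a) ≢ 0) (≡.sym (parent≡u (≡.sym p≡e))) hit≢0))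
      less : unseenWork visited ≡ suc (indeg u) ℕ.+ unseenWork visited′
      less = sum-bump u
        (≡.trans (≡.cong (λ b → unseen b (suc (indeg u))) new)
          (≡.sym (≡.trans (≡.cong (λ b → suc (indeg u) ℕ.+ unseen b (suc (indeg u))) hit) (ℕ.+-identityʳ _))))
        λ w w≢u → ≡.cong (λ b → unseen b (suc (indeg w))) (≡.sym (miss w w≢u))

  -- The `suc (indeg w)` reserved for `w` splits into this step and one step for each parent, all of
  -- which become pending.
  pop-inv : ∀ {M out v w st cells visited} →
    SearchInv (suc M) out (mkSearch v 0 (w ∷ st) cells visited) →
    SearchInv M out (mkSearch w (indeg w) st cells visited)
  pop-inv {M} {out} {v} {w} {st} {cells} {visited} inv = record
    { e≤indeg  = ℕ.≤-refl
    ; stack-ok = proj₂ stack-ok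
    ; root     = root
    ; listed   = listed
    ; closed   = closed′
    ; work     = ℕ.suc-injective (≡.trans (pop-identity (unseenWork visited) (indeg w) (stackWork st)) work)
    }
    where
    open SearchInv inv
    closed′ : ∀ a p → visited (name a) ≢ 0 →
              a ∈ st ⊎ visited (name (parent a p)) ≢ 0 ⊎ (a ≡ w × toℕ p ℕ.< indeg w)
    closed′ a p vis with closed a p vis
    ... | inj₁ (here ≡.refl)  = inj₂ (inj₂ (≡.refl , Fin.toℕ<n p))
    ... | inj₁ (there a∈)     = inj₁ a∈
    ... | inj₂ (inj₁ vis′)    = inj₂ (inj₁ vis′)
    ... | inj₂ (inj₂ (_ , ()))

  stack-work-positive : ∀ {M out v e w st cells visited} →
    SearchInv M out (mkSearch v e (w ∷ st) cells visited) → M ≢ 0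
  stack-work-positive {e = e} {w = w} {st} {visited = visited} inv ≡.refl
    with ≡.trans (≡.sym (ℕ.+-suc (unseenWork visited) (indeg w ℕ.+ stackWork st ℕ.+ e))) (SearchInv.work inv)
  ... | ()

  edge-work-positive : ∀ {M out v e st cells visited} →
    SearchInv M out (mkSearch v (suc e) st cells visited) → M ≢ 0
  edge-work-positive {e = e} {st} {visited = visited} inv ≡.refl
    with ≡.trans (≡.sym (≡.trans (≡.cong (unseenWork visited ℕ.+_) (ℕ.+-suc (stackWork st) e)) (ℕ.+-suc _ _)))
                 (SearchInv.work inv)
  ... | ()

  initialSearch : Search
  initialSearch = mkSearch t 0 (t ∷ []) ((λ _ → 0) [ 0 ↦ name t ]) ((λ _ → 0) [ name t ↦ 1 ])

  initialWork : ℕ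
  initialWork = sumℕ λ w → suc (indeg w)

  initialSearch-inv : SearchInv initialWork (t ∷ []) initialSearch
  initialSearch-inv = record
    { e≤indeg  = z≤n
    ; stack-ok = ≡.refl , tt
    ; root     = hit≢0
    ; listed   = λ w vis → here (only-t w vis)
    ; closed   = λ w p vis → inj₁ (here (only-t w vis))
    ; work     = ≡.trans (initial-identity (unseenWork visited) (indeg t))
        (≡.sym (sum-bump t (≡.sym (≡.trans (≡.cong (λ b → suc (indeg t) ℕ.+ unseen b (suc (indeg t))) hit) (ℕ.+-identityʳ _)))
          λ w w≢t → ≡.cong (λ b → unseen b (suc (indeg w))) (≡.sym (miss w w≢t))))
    }
    where
    visited = (λ _ → 0) [ name t ↦ 1 ]
    hit : visited (name t) ≡ 1
    hit = ↦-same (λ _ → 0) (name t)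
    miss : ∀ w → w ≢ t → visited (name w) ≡ 0
    miss w w≢t = ↦-other (λ _ → 0) (w≢t ∘ name-injective)
    hit≢0 : visited (name t) ≢ 0
    hit≢0 eq with ≡.trans (≡.sym hit) eq
    ... | ()
    only-t : ∀ w → visited (name w) ≢ 0 → w ≡ t
    only-t w vis with w Fin.≟ t
    ... | yes w≡t = w≡t
    ... | no  w≢t = contradiction (miss w w≢t) vis

  -- The step for popping a node is charged to one of its outgoing edges, which exists because
  -- out-degrees are nonzero.
  initialWork≤2m : fromℕ initialWork ≤ fromℕ m + fromℕ m
  initialWork≤2m = begin
    fromℕ initialWork
      ≈⟨ fromℕ-sum (λ w → suc (indeg w)) ⟩
    (sum λ w → 1# + indegℝ w)
      ≤⟨ sum-mono-≤ (λ w → +-monoˡ-≤ (indegℝ w) (1≤fromℕ {outdeg w} (ℕ.>-nonZero⁻¹ (outdeg w) {{outdeg-nonZero w}}))) ⟩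
    (sum λ w → outdegℝ w + indegℝ w)
      ≈⟨ ∑-distrib-+ outdegℝ indegℝ ⟩
    sum outdegℝ + sum indegℝ
      ≈⟨ +-cong (sym m≈sum) sum-indeg ⟩
    fromℕ m + fromℕ m ∎
    where
    sum-indeg : sum indegℝ ≈ fromℕ m
    sum-indeg = begin-equality
      sum indegℝ                                   ≈⟨ sum-cong-≋ indeg≈sum ⟩
      (sum λ v → sum λ u → indicator (edge u v))   ≈⟨ ∑-comm (λ v u → indicator (edge u v)) ⟩
      (sum λ u → sum λ v → indicator (edge u v))   ≈⟨ sum-cong-≋ outdeg≈sum ⟨
      sum outdegℝ                                  ≈⟨ m≈sum ⟨
      fromℕ m                                      ∎

  -- Restricted to the nodes that are not visited, the contributions are
  -- subharmonic, since all children of such a node are not visited either.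
  finished-superset : ∀ {M out v cells visited δ} → 0# < δ →
    SearchInv M out (mkSearch v 0 [] cells visited) → ∀ w → Contributing π δ t w → w ∈ out
  finished-superset {visited = visited} {δ} 0<δ inv w contributing with visited (name w) ℕ.≟ 0
  ... | no  vis = SearchInv.listed inv w vis
  ... | yes new = contradiction (begin
    δ * total       ≤⟨ contributing⇒≤ contributing ⟩
    contribution w  ≈⟨ restricted-new w new ⟨
    restricted w    ≤⟨ comparison-principle (λ _ → 0#) restricted subharmonic w ⟩
    0#              ∎) (<⇒≱ (*-positive 0<δ (<-≤-trans 0<α α≤total)))
    where
    open SearchInv inv
    restricted : V → ℝ
    restricted a = fromℕ (unseen (visited (name a)) 1) * contribution a
    restricted-new : ∀ a → visited (name a) ≡ 0 → restricted a ≈ contribution a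
    restricted-new a new rewrite new = solve 1 (λ x → (con 1 :+ con 0) :* x := x) refl (contribution a)
    restricted-old : ∀ a → visited (name a) ≢ 0 → restricted a ≈ 0#
    restricted-old a old with visited (name a)
    ... | zero  = contradiction ≡.refl old
    ... | suc _ = zeroˡ _
    0≤restricted : ∀ a → 0# ≤ restricted a
    0≤restricted a = *-nonNeg (fromℕ-nonNeg (unseen (visited (name a)) 1)) (0≤contribution a)
    unit-new : ∀ a → visited (name a) ≡ 0 → unit a ≈ 0#
    unit-new a new with a Fin.≟ t
    ... | yes ≡.refl = contradiction new root
    ... | no  _      = refl
    children-new : ∀ a b → visited (name a) ≡ 0 → edge a b ≡ true → visited (name b) ≡ 0
    children-new a b new ab with visited (name b) ℕ.≟ 0
    ... | yes new′ = new′
    ... | no  vis with edge⇒parent ab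
    ...   | p , ≡.refl with closed b p vis
    ...     | inj₁ ()
    ...     | inj₂ (inj₁ vis′)     = contradiction new vis′
    ...     | inj₂ (inj₂ (_ , ()))
    average-new : ∀ a → visited (name a) ≡ 0 → average contribution a ≈ average restricted a
    average-new a new = trans (average≈ contribution a) (trans (*-congˡ (sum-cong-≋ λ b → lemma b (edge a b) ≡.refl))
                          (sym (average≈ restricted a)))
      where
      lemma : ∀ b x → edge a b ≡ x → indicator x * contribution b ≈ indicator x * restricted b
      lemma b true  ab = *-congˡ (sym (restricted-new b (children-new a b new ab)))
      lemma b false _  = trans (zeroˡ _) (sym (zeroˡ _))
    subharmonic : ∀ a → restricted a + β * average (λ _ → 0#) a ≤ 0# + β * average restricted a
    subharmonic a with visited (name a) ℕ.≟ 0
    ... | yes new = ≤-reflexive (begin-equality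
      restricted a + β * average (λ _ → 0#) a
        ≈⟨ +-cong (restricted-new a new) (trans (*-congˡ (average-const 0# a)) (zeroʳ β)) ⟩
      contribution a + 0#
        ≈⟨ +-identityʳ _ ⟩
      contribution a
        ≈⟨ contribution-fixpoint a ⟩
      α * unit a + β * average contribution a
        ≈⟨ +-cong (trans (*-congˡ (unit-new a new)) (zeroʳ α)) (*-congˡ (average-new a new)) ⟩
      0# + β * average restricted a ∎)
    ... | no old = begin
      restricted a + β * average (λ _ → 0#) a
        ≤⟨ +-mono-≤ (≤-reflexive (restricted-old a old)) (*-monoˡ-≤ 0≤β (average-mono 0≤restricted a)) ⟩
      0# + β * average restricted a ∎
    -- The walk of length zero alone contributes `α` at `t`. This makes `δ * total` positive, so a
    -- node with contribution zero is not contributing.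
    α≤total : α ≤ total
    α≤total = begin
      α                ≈⟨ trans (*-congˡ unit-t) (*-identityʳ α) ⟨
      α * unit t       ≤⟨ x≤x+y (*-nonNeg 0≤β (≤-respˡ (average-const 0# t) (average-mono 0≤contribution t))) ⟩
      α * unit t + β * average contribution t ≈⟨ contribution-fixpoint t ⟨
      contribution t   ≤⟨ term≤sum 0≤contribution t ⟩
      total            ∎

-- Symbolic execution on a structured memory

module _ {a} {A : Set a} where

  -- With registers kept in a vector, reads and writes at literal indices reduce by computation, so
  -- straight-line code can be executed symbolically.
  get : ∀ {n} → A → Vec A n → ℕ → A
  get d []       _       = d
  get d (x ∷ xs) zero    = x
  get d (x ∷ xs) (suc i) = get d xs i

  put : ∀ {n} → Vec A n → ℕ → A → Vec A n
  put []       _       _ = []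
  put (x ∷ xs) zero    y = y ∷ xs
  put (x ∷ xs) (suc i) y = x ∷ put xs i y

  get-put-same : ∀ {n d y} (xs : Vec A n) {i} → i ℕ.< n → get d (put xs i y) i ≡ y
  get-put-same (x ∷ xs) {zero}  _         = ≡.refl
  get-put-same (x ∷ xs) {suc i} (s≤s i<n) = get-put-same xs i<n

  get-put-other : ∀ {n d y} (xs : Vec A n) {i j} → j ≢ i → get d (put xs i y) j ≡ get d xs j
  get-put-other []       _                      = ≡.refl
  get-put-other (x ∷ xs) {zero}  {zero}  0≢0 = contradiction ≡.refl 0≢0
  get-put-other (x ∷ xs) {zero}  {suc j} _   = ≡.refl
  get-put-other (x ∷ xs) {suc i} {zero}  _   = ≡.refl
  get-put-other (x ∷ xs) {suc i} {suc j} j≢i = get-put-other xs (j≢i ∘ ≡.cong suc)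

  ↦-get-put : ∀ {n d x y} {f : ℕ → A} (xs : Vec A n) i → x ≡ y →
              (∀ j → j ℕ.< n → f j ≡ get d xs j) →
              ∀ j → j ℕ.< n → (f [ i ↦ x ]) j ≡ get d (put xs i y) j
  ↦-get-put {f = f} xs i x≡y eq j j<n with j ℕ.≟ i
  ... | yes ≡.refl = ≡.trans x≡y (≡.sym (get-put-same xs j<n))
  ... | no  j≢i    = ≡.trans (eq j j<n) (≡.sym (get-put-other xs j≢i))

-- Written as the machine computes it: addition is its only way to multiply an index by three.
triple : ℕ → ℕ
triple z = z ℕ.+ z ℕ.+ z

-- The residue modulo 3 identifies the array and the quotient the index, so three unbounded arrays
-- share one memory without overlap.
slot-injective : ∀ {a b} y z → a ℕ.< 3 → b ℕ.< 3 → a ℕ.+ triple y ≡ b ℕ.+ triple z → a ≡ b × y ≡ z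
slot-injective {a} {b} y z a<3 b<3 eq = a≡b , y≡z
  where
  triple≡ : ∀ z → triple z ≡ z ℕ.* 3
  triple≡ z = ≡.trans (≡.trans (ℕ.+-assoc z z z) (≡.cong (λ w → z ℕ.+ (z ℕ.+ w)) (≡.sym (ℕ.+-identityʳ z)))) (ℕ.*-comm 3 z)
  remainder : ∀ {a} z → a ℕ.< 3 → (a ℕ.+ triple z) ℕ.% 3 ≡ a
  remainder {a} z a<3 = ≡.trans (≡.cong (λ w → (a ℕ.+ w) ℕ.% 3) (triple≡ z))
    (≡.trans (ℕ.[m+kn]%n≡m%n a z 3) (ℕ.m<n⇒m%n≡m a<3))
  a≡b : a ≡ b
  a≡b = ≡.trans (≡.sym (remainder y a<3)) (≡.trans (≡.cong (ℕ._% 3) eq) (remainder z b<3))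
  y≡z : y ≡ z
  y≡z = ℕ.*-cancelʳ-≡ y z 3 (≡.trans (≡.sym (triple≡ y)) (≡.trans
    (ℕ.+-cancelˡ-≡ a _ _ (≡.trans eq (≡.cong (ℕ._+ triple z) (≡.sym a≡b)))) (triple≡ z)))

straight : List Instr → Program
straight []       = skip
straight (I ∷ Is) = instr I ⨟ straight Is

module Execution
  {c ℓ₁ ℓ₂ : Level} (R : RealField c ℓ₁ ℓ₂) (α : RealField.ℝ R)
  {G : DiGraph} (A : Access G) where

  open RealField R hiding (zero)
  open DiGraph G
  open Access A
  open Machine R α A

  -- The cells X 0, …, X 15 and Y 0, …, Y 7 are registers.  The other X cells
  -- are dealt out to three arrays in turn; the other Y cells are one array.
  record Memory : Set c where
    constructor memory
    field
      xs     : Vec ℕ 16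
      ys     : Vec ℝ 8
      arrays : Vec (ℕ → ℕ) 3
      reals  : ℕ → ℝ
      out    : List V

  open Memory

  getX : Memory → ℕ → ℕ
  getX M = get 0 (xs M)

  getY : Memory → ℕ → ℝ
  getY M = get 0# (ys M)

  array : Memory → ℕ → ℕ → ℕ
  array M = get (λ _ → 0) (arrays M)

  infix 4 _∼_

  -- Equality of states would require function extensionality. Pointwise agreement is enough, as
  -- instructions read single cells.
  record _∼_ (s : State) (M : Memory) : Set c where
    field
      ∼X      : ∀ i → i ℕ.< 16 → X s i ≡ getX M i
      ∼Y      : ∀ i → i ℕ.< 8 → Y s i ≡ getY M i
      ∼arrays : ∀ a → a ℕ.< 3 → ∀ z → X s (16 ℕ.+ (a ℕ.+ triple z)) ≡ array M a z
      ∼reals  : ∀ z → Y s (8 ℕ.+ z) ≡ reals M z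
      ∼out    : output s ≡ out M

  open _∼_

  Runs : Program → Memory → ℕ → Memory → Set (c ⊔ ℓ₁ ⊔ ℓ₂)
  Runs P M τ M′ = ∀ {s} → s ∼ M → ∃[ s′ ] (P ⊢ s ⇓[ τ ] s′) × s′ ∼ M′

  -- A Boolean test, so that for a literal index the proof is inferred as an implicit argument.
  Register Registerℝ : ℕ → Set
  Register  i = T (i <ᵇ 16)
  Registerℝ i = T (i <ᵇ 8)

  module _ {M : Memory} where

    writeX : ∀ {s} i → s ∼ M → Register i → ∀ {x y} → x ≡ y →
             ⟪ X s [ i ↦ x ] , Y s , output s ⟫ ∼ record M { xs = put (xs M) i y }
    writeX {s} i s∼M i< x≡y = record
      { ∼X      = ↦-get-put (xs M) i x≡y (∼X s∼M)
      ; ∼Y      = ∼Y s∼M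
      ; ∼arrays = λ a a<3 z → ≡.trans (↦-other (X s) {i} λ eq →
          ℕ.<-irrefl (≡.sym eq) (ℕ.≤-trans (ℕ.<ᵇ⇒< i 16 i<) (ℕ.m≤m+n 16 _))) (∼arrays s∼M a a<3 z)
      ; ∼reals  = ∼reals s∼M
      ; ∼out    = ∼out s∼M
      }

    writeY : ∀ {s} i → s ∼ M → Registerℝ i → ∀ {x y} → x ≡ y →
             ⟪ X s , Y s [ i ↦ x ] , output s ⟫ ∼ record M { ys = put (ys M) i y }
    writeY {s} i s∼M i< x≡y = record
      { ∼X      = ∼X s∼M
      ; ∼Y      = ↦-get-put (ys M) i x≡y (∼Y s∼M)
      ; ∼arrays = ∼arrays s∼M
      ; ∼reals  = λ z → ≡.trans (↦-other (Y s) {i} λ eq →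
          ℕ.<-irrefl (≡.sym eq) (ℕ.≤-trans (ℕ.<ᵇ⇒< i 8 i<) (ℕ.m≤m+n 8 _))) (∼reals s∼M z)
      ; ∼out    = ∼out s∼M
      }

    writeArray : ∀ {s} a → s ∼ M → T (a <ᵇ 3) → ∀ {i z x y} → i ≡ 16 ℕ.+ (a ℕ.+ triple z) → x ≡ y →
                 ⟪ X s [ i ↦ x ] , Y s , output s ⟫ ∼
                 record M { arrays = put (arrays M) a (array M a [ z ↦ y ]) }
    writeArray {s} a s∼M a< {z = z} {x} ≡.refl ≡.refl = record
      { ∼X      = λ i i<16 → ≡.trans (↦-other (X s) {slot} {i} λ eq →
          ℕ.<-irrefl eq (ℕ.≤-trans i<16 (ℕ.m≤m+n 16 _))) (∼X s∼M i i<16)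
      ; ∼Y      = ∼Y s∼M
      ; ∼arrays = written
      ; ∼reals  = ∼reals s∼M
      ; ∼out    = ∼out s∼M
      }
      where
      a<3 = ℕ.<ᵇ⇒< a 3 a<
      slot = 16 ℕ.+ (a ℕ.+ triple z)
      written : ∀ b → b ℕ.< 3 → ∀ y → (X s [ slot ↦ x ]) (16 ℕ.+ (b ℕ.+ triple y)) ≡
                get (λ _ → 0) (put (arrays M) a (array M a [ z ↦ x ])) b y
      written b b<3 y with b ℕ.≟ a
      ... | no b≢a = ≡.trans
        (↦-other (X s) {slot} {16 ℕ.+ (b ℕ.+ triple y)} λ eq → b≢a (proj₁ (slot-injective y z b<3 a<3 (ℕ.+-cancelˡ-≡ 16 _ _ eq))))
        (≡.trans (∼arrays s∼M b b<3 y) (≡.cong (λ f → f y) (≡.sym (get-put-other (arrays M) b≢a))))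
      ... | yes ≡.refl with y ℕ.≟ z
      ...   | yes ≡.refl = ≡.trans (↦-same (X s) slot) (≡.sym (≡.trans
        (≡.cong (λ f → f z) (get-put-same (arrays M) a<3)) (↦-same (array M a) z)))
      ...   | no  y≢z = ≡.trans
        (↦-other (X s) {slot} {16 ℕ.+ (b ℕ.+ triple y)} λ eq → y≢z (proj₂ (slot-injective y z b<3 a<3 (ℕ.+-cancelˡ-≡ 16 _ _ eq))))
        (≡.trans (∼arrays s∼M a a<3 y) (≡.sym (≡.trans
          (≡.cong (λ f → f y) (get-put-same (arrays M) a<3)) (↦-other (array M a) y≢z))))

    writeReals : ∀ {s} → s ∼ M → ∀ {i z x y} → i ≡ 8 ℕ.+ z → x ≡ y →
                 ⟪ X s , Y s [ i ↦ x ] , output s ⟫ ∼ record M { reals = reals M [ z ↦ y ] }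
    writeReals {s} s∼M {z = z} {x} ≡.refl ≡.refl = record
      { ∼X      = ∼X s∼M
      ; ∼Y      = λ i i<8 → ≡.trans (↦-other (Y s) {8 ℕ.+ z} {i} λ eq →
          ℕ.<-irrefl eq (ℕ.≤-trans i<8 (ℕ.m≤m+n 8 _))) (∼Y s∼M i i<8)
      ; ∼arrays = ∼arrays s∼M
      ; ∼reals  = written
      ; ∼out    = ∼out s∼M
      }
      where
      written : ∀ y → (Y s [ 8 ℕ.+ z ↦ x ]) (8 ℕ.+ y) ≡ (reals M [ z ↦ x ]) y
      written y with y ℕ.≟ z
      ... | yes ≡.refl = ↦-same (Y s) (8 ℕ.+ z)
      ... | no  y≢z    = ≡.trans (↦-other (Y s) {8 ℕ.+ z} {8 ℕ.+ y} (y≢z ∘ ℕ.+-cancelˡ-≡ 8 _ _)) (∼reals s∼M y)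

    readX : ∀ {s} i → s ∼ M → Register i → X s i ≡ getX M i
    readX i s∼M i< = ∼X s∼M i (ℕ.<ᵇ⇒< i 16 i<)

    readY : ∀ {s} i → s ∼ M → Registerℝ i → Y s i ≡ getY M i
    readY i s∼M i< = ∼Y s∼M i (ℕ.<ᵇ⇒< i 8 i<)

  -- The explicit arguments a, z, v and p say which array element, node or
  -- index the address, name or number held by a register stands for.
  data Pre (M : Memory) : Instr → Set ℓ₁ where
    set    : ∀ {i k} {i< : Register i} → Pre M (set i k)
    add    : ∀ {i j k} {i< : Register i} {j< : Register j} {k< : Register k} → Pre M (add i j k)
    sub    : ∀ {i j k} {i< : Register i} {j< : Register j} {k< : Register k} → Pre M (sub i j k)
    -- The value `y` lets the result be recorded in the form needed later, such as `name w`, instead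
    -- of as an array lookup.
    load   : ∀ {i j} {i< : Register i} {j< : Register j} a {a< : T (a <ᵇ 3)} z {y} →
             getX M j ≡ 16 ℕ.+ (a ℕ.+ triple z) → array M a z ≡ y → Pre M (load i j)
    store  : ∀ {i j} {i< : Register i} {j< : Register j} a {a< : T (a <ᵇ 3)} z →
             getX M i ≡ 16 ℕ.+ (a ℕ.+ triple z) → Pre M (store i j)
    cast   : ∀ {i j} {i< : Registerℝ i} {j< : Register j} → Pre M (cast i j)
    decay  : ∀ {i} {i< : Registerℝ i} → Pre M (decay i)
    addR   : ∀ {i j k} {i< : Registerℝ i} {j< : Registerℝ j} {k< : Registerℝ k} → Pre M (addR i j k)
    subR   : ∀ {i j k} {i< : Registerℝ i} {j< : Registerℝ j} {k< : Registerℝ k} → Pre M (subR i j k)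
    mulR   : ∀ {i j k} {i< : Registerℝ i} {j< : Registerℝ j} {k< : Registerℝ k} → Pre M (mulR i j k)
    divR   : ∀ {i j k} {i< : Registerℝ i} {j< : Registerℝ j} {k< : Registerℝ k} →
             ¬ getY M k ≈ 0# → Pre M (divR i j k)
    loadR  : ∀ {i j} {i< : Registerℝ i} {j< : Register j} z → getX M j ≡ 8 ℕ.+ z → Pre M (loadR i j)
    storeR : ∀ {i j} {i< : Register i} {j< : Registerℝ j} z → getX M i ≡ 8 ℕ.+ z → Pre M (storeR i j)
    leqR   : ∀ {i j k} {i< : Register i} {j< : Registerℝ j} {k< : Registerℝ k} → Pre M (leqR i j k)
    INDEG  : ∀ {i j} {i< : Register i} {j< : Register j} v → getX M j ≡ name v → Pre M (INDEG i j)
    OUTDEG : ∀ {i j} {i< : Register i} {j< : Register j} v → getX M j ≡ name v → Pre M (OUTDEG i j)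
    PARENT : ∀ {i j k} {i< : Register i} {j< : Register j} {k< : Register k} v (p : Fin (indeg v)) →
             getX M j ≡ name v → getX M k ≡ toℕ p → Pre M (PARENT i j k)
    emit   : ∀ {i} {i< : Register i} v → getX M i ≡ name v → Pre M (emit i)

  post : ∀ {I M} → Pre M I → Memory
  post {set i k}      {M} set                 = record M { xs = put (xs M) i k }
  post {add i j k}    {M} add                 = record M { xs = put (xs M) i (getX M j ℕ.+ getX M k) }
  post {sub i j k}    {M} sub                 = record M { xs = put (xs M) i (getX M j ℕ.∸ getX M k) }
  post {load i j}     {M} (load a z {y} _ _)  = record M { xs = put (xs M) i y }
  post {store i j}    {M} (store a z _)       = record M { arrays = put (arrays M) a (array M a [ z ↦ getX M j ]) }
  post {cast i j}     {M} cast                = record M { ys = put (ys M) i (fromℕ (getX M j)) }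
  post {decay i}      {M} decay               = record M { ys = put (ys M) i α }
  post {addR i j k}   {M} addR                = record M { ys = put (ys M) i (getY M j + getY M k) }
  post {subR i j k}   {M} subR                = record M { ys = put (ys M) i (getY M j - getY M k) }
  post {mulR i j k}   {M} mulR                = record M { ys = put (ys M) i (getY M j * getY M k) }
  post {divR i j k}   {M} (divR _)            = record M { ys = put (ys M) i (getY M j / getY M k) }
  post {loadR i j}    {M} (loadR z _)         = record M { ys = put (ys M) i (reals M z) }
  post {storeR i j}   {M} (storeR z _)        = record M { reals = reals M [ z ↦ getY M j ] }
  post {leqR i j k}   {M} leqR                = record M { xs = put (xs M) i (if ⌊ getY M j ≤? getY M k ⌋ then 1 else 0) }
  post {INDEG i j}    {M} (INDEG v _)         = record M { xs = put (xs M) i (indeg v) }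
  post {OUTDEG i j}   {M} (OUTDEG v _)        = record M { xs = put (xs M) i (outdeg v) }
  post {PARENT i j k} {M} (PARENT v p _ _)    = record M { xs = put (xs M) i (name (parent v p)) }
  post {emit i}       {M} (emit v _)          = record M { out = v ∷ out M }

  instr-runs : ∀ {I M} (h : Pre M I) → Runs (instr I) M 1 (post h)
  instr-runs {set i k} (set {i< = i<}) s∼M = _ , instr set , writeX i s∼M i< ≡.refl
  instr-runs {add i j k} (add {i< = i<} {j<} {k<}) s∼M = _ , instr add ,
    writeX i s∼M i< (≡.cong₂ ℕ._+_ (readX j s∼M j<) (readX k s∼M k<))
  instr-runs {sub i j k} (sub {i< = i<} {j<} {k<}) s∼M = _ , instr sub ,
    writeX i s∼M i< (≡.cong₂ ℕ._∸_ (readX j s∼M j<) (readX k s∼M k<))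
  instr-runs {load i j} (load {i< = i<} {j<} a {a<} z eq eq′) {s} s∼M = _ , instr load ,
    writeX i s∼M i< (≡.trans (≡.cong (X s) (≡.trans (readX j s∼M j<) eq))
                             (≡.trans (∼arrays s∼M a (ℕ.<ᵇ⇒< a 3 a<) z) eq′))
  instr-runs {store i j} (store {i< = i<} {j<} a {a<} z eq) s∼M = _ , instr store ,
    writeArray a s∼M a< (≡.trans (readX i s∼M i<) eq) (readX j s∼M j<)
  instr-runs {cast i j} (cast {i< = i<} {j<}) s∼M = _ , instr cast ,
    writeY i s∼M i< (≡.cong fromℕ (readX j s∼M j<))
  instr-runs {decay i} (decay {i< = i<}) s∼M = _ , instr decay , writeY i s∼M i< ≡.refl
  instr-runs {addR i j k} (addR {i< = i<} {j<} {k<}) s∼M = _ , instr addR ,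
    writeY i s∼M i< (≡.cong₂ _+_ (readY j s∼M j<) (readY k s∼M k<))
  instr-runs {subR i j k} (subR {i< = i<} {j<} {k<}) s∼M = _ , instr subR ,
    writeY i s∼M i< (≡.cong₂ _-_ (readY j s∼M j<) (readY k s∼M k<))
  instr-runs {mulR i j k} (mulR {i< = i<} {j<} {k<}) s∼M = _ , instr mulR ,
    writeY i s∼M i< (≡.cong₂ _*_ (readY j s∼M j<) (readY k s∼M k<))
  instr-runs {divR i j k} (divR {i< = i<} {j<} {k<} k≉0) s∼M = _ ,
    instr (divR (≡.subst (λ y → ¬ y ≈ 0#) (≡.sym (readY k s∼M k<)) k≉0)) ,
    writeY i s∼M i< (≡.cong₂ _/_ (readY j s∼M j<) (readY k s∼M k<))
  instr-runs {loadR i j} (loadR {i< = i<} {j<} z eq) {s} s∼M = _ , instr loadR ,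
    writeY i s∼M i< (≡.trans (≡.cong (Y s) (≡.trans (readX j s∼M j<) eq)) (∼reals s∼M z))
  instr-runs {storeR i j} (storeR {i< = i<} {j<} z eq) s∼M = _ , instr storeR ,
    writeReals s∼M (≡.trans (readX i s∼M i<) eq) (readY j s∼M j<)
  instr-runs {leqR i j k} (leqR {i< = i<} {j<} {k<}) s∼M = _ , instr leqR ,
    writeX i s∼M i< (≡.cong₂ (λ x y → if ⌊ x ≤? y ⌋ then 1 else 0) (readY j s∼M j<) (readY k s∼M k<))
  instr-runs {INDEG i j} (INDEG {i< = i<} {j<} v eq) s∼M = _ ,
    instr (INDEG (≡.trans (readX j s∼M j<) eq)) , writeX i s∼M i< ≡.refl
  instr-runs {OUTDEG i j} (OUTDEG {i< = i<} {j<} v eq) s∼M = _ ,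
    instr (OUTDEG (≡.trans (readX j s∼M j<) eq)) , writeX i s∼M i< ≡.refl
  instr-runs {PARENT i j k} (PARENT {i< = i<} {j<} {k<} v p eq eq′) s∼M = _ ,
    instr (PARENT (≡.trans (readX j s∼M j<) eq) (≡.trans (readX k s∼M k<) eq′)) ,
    writeX i s∼M i< ≡.refl
  instr-runs {emit i} (emit {i< = i<} v eq) s∼M = _ ,
    instr (emit (≡.trans (readX i s∼M i<) eq)) , record
      { ∼X      = ∼X s∼M
      ; ∼Y      = ∼Y s∼M
      ; ∼arrays = ∼arrays s∼M
      ; ∼reals  = ∼reals s∼M
      ; ∼out    = ≡.cong (v ∷_) (∼out s∼M)
      }

  Pres : List Instr → Memory → Set ℓ₁
  Pres []       M = Lift ℓ₁ ⊤
  Pres (I ∷ Is) M = Σ (Pre M I) λ h → Pres Is (post h)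

  posts : ∀ Is {M} → Pres Is M → Memory
  posts []       {M} _        = M
  posts (I ∷ Is)     (h , hs) = posts Is hs

  skip-runs : ∀ {M} → Runs skip M 0 M
  skip-runs s∼M = _ , skip , s∼M

  infixr 5 _⨾_

  _⨾_ : ∀ {P Q M M′ M″ τ τ′} → Runs P M τ M′ → Runs Q M′ τ′ M″ → Runs (P ⨟ Q) M (τ ℕ.+ τ′) M″
  (p ⨾ q) s∼M with p s∼M
  ... | _ , p⇓ , s′∼M′ with q s′∼M′
  ...   | _ , q⇓ , s″∼M″ = _ , seq p⇓ q⇓ , s″∼M″

  straight-runs : ∀ Is {M} (hs : Pres Is M) → Runs (straight Is) M (List.length Is) (posts Is hs)
  straight-runs []       _        = skip-runs
  straight-runs (I ∷ Is) (h , hs) = instr-runs h ⨾ straight-runs Is hs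

  ifnz-then : ∀ {M M′ i P Q τ} {i< : Register i} → NonZero (getX M i) → Runs P M τ M′ →
              Runs (ifnz i P Q) M (suc τ) M′
  ifnz-then {i = i} {i< = i<} nz p s∼M with p s∼M
  ... | _ , p⇓ , s′∼M′ = _ , if-nz (≡.subst NonZero (≡.sym (readX i s∼M i<)) nz) p⇓ , s′∼M′

  ifnz-else : ∀ {M M′ i P Q τ} {i< : Register i} → getX M i ≡ 0 → Runs Q M τ M′ →
              Runs (ifnz i P Q) M (suc τ) M′
  ifnz-else {i = i} {i< = i<} z q s∼M with q s∼M
  ... | _ , q⇓ , s′∼M′ = _ , if-z (≡.trans (readX i s∼M i<) z) q⇓ , s′∼M′

-- The program

module Registers where

  -- Xv, Xe, Xi, Xk, Ymass, Yx and Yρ hold fields of Push, Xw and Xd fields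
  -- of Search, and Xh the height of the stack.  Xrun is zero when the loop
  -- is to end.
  Xv Xone Xqueue Xstack Xvisited Xe Xi Xk Xw Xd Xh Xrun Xa Xb Xf Xz : ℕ
  Xv       = 0
  Xone     = 1
  Xqueue   = 2
  Xstack   = 3
  Xvisited = 4
  Xe       = 5
  Xi       = 6
  Xk       = 7
  Xw       = 8
  Xd       = 9
  Xh       = 10
  Xrun     = 11
  Xa       = 12
  Xb       = 13
  Xf       = 14
  Xz       = 15

  Yδα Ymass Yx Yρ Yβ Yr Yg Yz : ℕ
  Yδα   = 0
  Ymass = 1
  Yx    = 2
  Yρ    = 3
  Yβ    = 4
  Yr    = 5
  Yg    = 6
  Yz    = 7

module PushSearch where

  open Registers

  setup check passOne scanOne rewind visitOne pop step main : Program

  setup = straight (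
    set Xone 1 ∷
    set Xqueue 16 ∷
    set Xstack 17 ∷
    set Xvisited 18 ∷
    set Xk 1 ∷
    set Xh 1 ∷
    -- A copy is an addition of zero; `Xz` has not been written yet.
    add Xw Xz Xv ∷
    cast Ymass Xone ∷
    cast Yx Xone ∷
    decay Yβ ∷
    mulR Yδα Yδα Yβ ∷
    -- `Ymass` still holds the unit, so this is `1 - α`.
    subR Yβ Ymass Yβ ∷
    -- Residues are stored by name, behind the eight real registers.
    set Xa 8 ∷
    add Xa Xa Xv ∷
    storeR Xa Ymass ∷
    store Xqueue Xv ∷
    store Xstack Xv ∷
    add Xa Xv Xv ∷
    add Xa Xa Xv ∷
    add Xa Xvisited Xa ∷
    store Xa Xone ∷
    emit Xv ∷ [])

  check =
    straight (mulR Yr Yδα Ymass ∷ addR Yg Yx Yx ∷ leqR Xrun Yr Yg ∷ []) ⨟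
    -- The sum acts as a disjunction: it vanishes only when the search has neither pending parents
    -- nor a stack.
    ifnz Xrun (straight (add Xrun Xd Xh ∷ [])) skip

  passOne = straight (
    sub Xe Xe Xone ∷
    PARENT Xb Xv Xe ∷
    OUTDEG Xa Xb ∷
    cast Yr Xa ∷
    mulR Yg Yβ Yρ ∷
    divR Yg Yg Yr ∷
    addR Ymass Ymass Yg ∷
    set Xa 8 ∷
    add Xa Xa Xb ∷
    loadR Yr Xa ∷
    addR Yr Yr Yg ∷
    storeR Xa Yr ∷
    add Xa Xk Xk ∷
    add Xa Xa Xk ∷
    add Xa Xqueue Xa ∷
    store Xa Xb ∷
    add Xk Xone Xk ∷
    emit Xb ∷ [])

  scanOne =
    straight (
      add Xa Xi Xi ∷
      add Xa Xa Xi ∷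
      add Xa Xqueue Xa ∷
      load Xv Xa ∷
      add Xi Xone Xi ∷
      set Xa 8 ∷
      add Xa Xa Xv ∷
      loadR Yρ Xa ∷
      leqR Xf Yx Yρ ∷ []) ⨟
    ifnz Xf
      (straight (INDEG Xe Xv ∷ set Xz 0 ∷ cast Yz Xz ∷ storeR Xa Yz ∷ []))
      skip

  rewind = straight (set Xi 0 ∷ set Xa 2 ∷ cast Yr Xa ∷ divR Yx Yx Yr ∷ [])

  visitOne =
    straight (
      sub Xd Xd Xone ∷
      PARENT Xb Xw Xd ∷
      add Xa Xb Xb ∷
      add Xa Xa Xb ∷
      add Xa Xvisited Xa ∷
      load Xf Xa ∷ []) ⨟
    ifnz Xf
      skip
      (straight (
        store Xa Xone ∷
        add Xa Xh Xh ∷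
        add Xa Xa Xh ∷
        add Xa Xstack Xa ∷
        store Xa Xb ∷
        add Xh Xone Xh ∷
        emit Xb ∷ []))

  pop = straight (
    sub Xh Xh Xone ∷
    add Xa Xh Xh ∷
    add Xa Xa Xh ∷
    add Xa Xstack Xa ∷
    load Xw Xa ∷
    INDEG Xd Xw ∷ [])

  pushStep searchStep : Program
  -- Every branch does constant work (one edge, one queue entry or one halving), so the steps
  -- counted by the invariants are iterations of the loop.
  pushStep   = ifnz Xe passOne (straight (sub Xa Xk Xi ∷ []) ⨟ ifnz Xa scanOne rewind)
  searchStep = ifnz Xd visitOne pop

  step = pushStep ⨟ searchStep ⨟ check

  main = setup ⨟ check ⨟ while Xrun step

-- From the number of iterations to the running time

module RunningTime {c ℓ₁ ℓ₂ : Level} (F : OrderedField c ℓ₁ ℓ₂) where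

  open OrderedField F
  open OrderedFieldProperties F

  fromℕ-affine : ∀ a b {j τ} → τ ℕ.≤ a ℕ.+ j ℕ.* b → fromℕ τ ≤ fromℕ a + fromℕ b * fromℕ j
  fromℕ-affine a b {j} {τ} τ≤ = begin
    fromℕ τ                     ≤⟨ fromℕ-mono-≤ τ≤ ⟩
    fromℕ (a ℕ.+ j ℕ.* b)       ≈⟨ fromℕ-+ a (j ℕ.* b) ⟩
    fromℕ a + fromℕ (j ℕ.* b)   ≈⟨ +-congˡ (trans (fromℕ-* j b) (*-comm _ _)) ⟩
    fromℕ a + fromℕ b * fromℕ j ∎

  -- Meant for `γ = α β`. After multiplication by `γ δ` the fixed cost `a` is absorbed because
  -- `γ δ ≤ 1 ≤ B`.
  ≤-local : ∀ {a b d γ δ B J T} → 0# ≤ a → 0# ≤ b → 0# < γ → γ ≤ 1# → 0# < δ → δ ≤ 1# →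
            1# ≤ B → γ * δ * J ≤ d * B → T ≤ a + b * J → T ≤ (a + b * d) * γ ⁻¹ * (B / δ)
  ≤-local {a} {b} {d} {γ} {δ} {B} {J} {T} 0≤a 0≤b 0<γ γ≤1 0<δ δ≤1 1≤B γδJ≤ T≤ =
    *-cancelˡ-≤ (*-positive 0<γ 0<δ) (begin
      γ * δ * T
        ≤⟨ *-monoˡ-≤ (proj₁ (*-positive 0<γ 0<δ)) T≤ ⟩
      γ * δ * (a + b * J)
        ≈⟨ solve 4 (λ z a b j → z :* (a :+ b :* j) := z :* a :+ b :* (z :* j)) refl (γ * δ) a b J ⟩
      γ * δ * a + b * (γ * δ * J)
        ≤⟨ +-mono-≤ (*-monoʳ-≤ 0≤a (≤-trans γδ≤1 1≤B)) (*-monoˡ-≤ 0≤b γδJ≤) ⟩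
      B * a + b * (d * B)
        ≈⟨ solve 4 (λ b x y z → b :* x :+ y :* (z :* b) := (x :+ y :* z) :* b :* (con 1 :* con 1)) refl B a b d ⟩
      (a + b * d) * B * (1# * 1#)
        ≈⟨ *-congˡ (*-cong (⁻¹-inverseʳ γ (<⇒≉0 0<γ)) (⁻¹-inverseʳ δ (<⇒≉0 0<δ))) ⟨
      (a + b * d) * B * (γ * γ ⁻¹ * (δ * δ ⁻¹))
        ≈⟨ solve 6 (λ k b z i d e → k :* b :* (z :* i :* (d :* e)) := z :* d :* (k :* i :* (b :* e))) refl (a + b * d) B γ (γ ⁻¹) δ (δ ⁻¹) ⟩
      γ * δ * ((a + b * d) * γ ⁻¹ * (B / δ)) ∎)
    where
    γδ≤1 : γ * δ ≤ 1#
    γδ≤1 = ≤-trans (*-monoʳ-≤ (proj₁ 0<δ) γ≤1) (≤-respˡ (sym (*-identityˡ δ)) δ≤1)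

  -- The constant is the one of `≤-local`, so that a single one serves all four terms of the
  -- minimum; `2 ≤ d` lets it cover the `2 M` steps of the search.
  ≤-global : ∀ {a b d γ M J T} → 0# ≤ a → 0# ≤ b → 1# + 1# ≤ d → 0# < γ → γ ≤ 1# →
             1# ≤ M → J ≤ M + M → T ≤ a + b * J → T ≤ (a + b * d) * γ ⁻¹ * M
  ≤-global {a} {b} {d} {γ} {M} {J} {T} 0≤a 0≤b 2≤d 0<γ γ≤1 1≤M J≤ T≤ =
    *-cancelˡ-≤ 0<γ (begin
      γ * T
        ≤⟨ *-monoˡ-≤ (proj₁ 0<γ) (begin
          T                           ≤⟨ T≤ ⟩
          a + b * J                   ≤⟨ +-mono-≤ a≤aM (*-monoˡ-≤ 0≤b (≤-trans J≤ 2M≤dM)) ⟩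
          a * M + b * (d * M)         ∎) ⟩
      γ * (a * M + b * (d * M))
        ≤⟨ *-monoʳ-≤ (+-nonNeg (*-nonNeg 0≤a 0≤M) (*-nonNeg 0≤b (*-nonNeg 0≤d 0≤M))) γ≤1 ⟩
      1# * (a * M + b * (d * M))
        ≈⟨ *-congʳ (⁻¹-inverseʳ γ (<⇒≉0 0<γ)) ⟨
      γ * γ ⁻¹ * (a * M + b * (d * M))
        ≈⟨ solve 6 (λ z i a b d m → z :* i :* (a :* m :+ b :* (d :* m)) := z :* ((a :+ b :* d) :* i :* m)) refl γ (γ ⁻¹) a b d M ⟩
      γ * ((a + b * d) * γ ⁻¹ * M) ∎)
    where
    0≤M : 0# ≤ M
    0≤M = ≤-trans 0≤1 1≤M
    0≤d : 0# ≤ d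
    0≤d = ≤-trans (+-nonNeg 0≤1 0≤1) 2≤d
    a≤aM : a ≤ a * M
    a≤aM = ≤-respˡ (*-identityʳ a) (*-monoˡ-≤ 0≤a 1≤M)
    2M≤dM : M + M ≤ d * M
    2M≤dM = ≤-respˡ (solve 1 (λ m → (con 1 :+ con 1) :* m := m :+ m) refl M) (*-monoʳ-≤ 0≤M 2≤d)

-- Correctness and complexity of the program

module Correctness
  {c ℓ₁ ℓ₂ : Level} (R : RealField c ℓ₁ ℓ₂)
  (α : RealField.ℝ R)
  (0<α : RealField._<_ R (RealField.0# R) α)
  (α<1 : RealField._<_ R α (RealField.1# R))
  {G : DiGraph} (A : Access G)
  (π : DiGraph.V G → DiGraph.V G → RealField.ℝ R)
  (isContribution : PageRank.IsContribution R α G π)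
  (t : DiGraph.V G) where

  open RealField R hiding (zero)
  open OrderedFieldProperties orderedField
  open RunningTime orderedField
  open DiGraph G
  open Access A
  open AccessProperties A
  open PageRank R α G
  open Machine R α A
  open PageRankProperties R α 0<α α<1 G
  open Contributions π isContribution t
  open FlowProperties R α 0<α α<1 G π isContribution t
  open PushInvariant R α 0<α α<1 A π isContribution t
  open SearchInvariant R α 0<α α<1 A π isContribution t
  open Execution R α A
  open PushSearch

  one : ℝ
  one = fromℕ 1

  one≈1 : one ≈ 1#
  one≈1 = +-identityʳ 1#

  -- Registers that carry nothing from one step of an exploration to the next; the run lemmas
  -- quantify their final contents existentially.
  record Scratch : Set c where
    constructor scratch
    field
      a b f z     : ℕ
      yr yg yz    : ℝ

  module _ (δ : ℝ) where

    layout : Push → Search → ℕ → List V → Scratch → Memory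
    layout (mkPush v e i k queue mass x ρ r) (mkSearch w d stack cells visited) run out
           (scratch a b f z yr yg yz) = memory
      (name v ∷ 1 ∷ 16 ∷ 17 ∷ 18 ∷ e ∷ i ∷ k ∷ name w ∷ d ∷ List.length stack ∷
       run ∷ a ∷ b ∷ f ∷ z ∷ [])
      (δ * α ∷ mass ∷ x ∷ ρ ∷ one - α ∷ yr ∷ yg ∷ yz ∷ [])
      (queue ∷ cells ∷ visited ∷ [])
      r
      out

    -- The memory after symbolic execution reduces to the required layout, so what remains to be
    -- proved is the validity of operands: addresses, names, the index of the parent and a nonzero
    -- divisor.
    passOne-runs : ∀ {v e i k queue mass x ρ r s run out sc} (e< : e ℕ.< indeg v) →
      let p = mkPush v (suc e) i k queue mass x ρ r
          u = parent v (fromℕ< e<) in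
      ∃[ sc′ ] Runs passOne (layout p s run out sc) 18
        (layout (passOn p e u ((one - α) * ρ / outdegℝ u)) s run (u ∷ out) sc′)
    passOne-runs {v} {k = k} e< = _ , straight-runs _
      (sub , PARENT v (fromℕ< e<) ≡.refl (≡.sym (Fin.toℕ-fromℕ< e<)) , OUTDEG u ≡.refl ,
       cast , mulR , divR (<⇒≉0 (0<outdeg u)) , addR ,
       set , add , loadR (name u) ≡.refl , addR , storeR (name u) ≡.refl ,
       add , add , add , store 0 k ≡.refl , add , emit u ≡.refl , _)
      where u = parent v (fromℕ< e<)

    flag-true : ∀ {x y} → x ≤ y → (if ⌊ x ≤? y ⌋ then 1 else 0) ≡ 1
    flag-true {x} {y} x≤y with x ≤? y
    ... | yes _   = ≡.refl
    ... | no  x≰y = contradiction x≤y x≰y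

    flag-false : ∀ {x y} → ¬ x ≤ y → (if ⌊ x ≤? y ⌋ then 1 else 0) ≡ 0
    flag-false {x} {y} x≰y with x ≤? y
    ... | yes x≤y = contradiction x≤y x≰y
    ... | no  _   = ≡.refl

    start-runs : ∀ {v i k queue mass x ρ r s run out sc w} → queue i ≡ name w → x ≤ r (name w) →
      ∃[ sc′ ] Runs scanOne (layout (mkPush v 0 i k queue mass x ρ r) s run out sc) 14
        (layout (mkPush w (indeg w) (suc i) k queue mass x (r (name w)) (r [ name w ↦ 0# ])) s run out sc′)
    start-runs {i = i} {w = w} qi x≤r = _ ,
      (straight-runs _ (add , add , add , load 0 i ≡.refl qi , add , set , add ,
                        loadR (name w) ≡.refl , leqR , _) ⨾
       ifnz-then (≡.subst NonZero (≡.sym (flag-true x≤r)) _)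
         (straight-runs _ (INDEG w ≡.refl , set , cast , storeR (name w) ≡.refl , _)))

    ignore-runs : ∀ {v i k queue mass x ρ r s run out sc w} → queue i ≡ name w → ¬ x ≤ r (name w) →
      ∃[ sc′ ] Runs scanOne (layout (mkPush v 0 i k queue mass x ρ r) s run out sc) 10
        (layout (mkPush w 0 (suc i) k queue mass x (r (name w)) r) s run out sc′)
    ignore-runs {i = i} {w = w} qi x≰r = _ ,
      (straight-runs _ (add , add , add , load 0 i ≡.refl qi , add , set , add ,
                        loadR (name w) ≡.refl , leqR , _) ⨾
       ifnz-else (flag-false x≰r) skip-runs)

    0<2 : 0# < fromℕ 2
    0<2 = fromℕ-positive 2

    rewind-runs : ∀ {v i k queue mass x ρ r s run out sc} →
      ∃[ sc′ ] Runs rewind (layout (mkPush v 0 i k queue mass x ρ r) s run out sc) 4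
        (layout (mkPush v 0 0 k queue mass (x / fromℕ 2) ρ r) s run out sc′)
    rewind-runs = _ , straight-runs _ (set , set , cast , divR (<⇒≉0 0<2) , _)

    halves : ∀ x → x / fromℕ 2 + x / fromℕ 2 ≈ x
    halves x = begin-equality
      x * fromℕ 2 ⁻¹ + x * fromℕ 2 ⁻¹
        ≈⟨ solve 2 (λ x i → x :* i :+ x :* i := numeral 2 :* i :* x) refl x (fromℕ 2 ⁻¹) ⟩
      fromℕ 2 * fromℕ 2 ⁻¹ * x
        ≈⟨ *-congʳ (⁻¹-inverseʳ (fromℕ 2) (<⇒≉0 0<2)) ⟩
      1# * x
        ≈⟨ *-identityˡ x ⟩
      x ∎

    -- The explorations share nothing but the output, so the search invariant only has to survive a
    -- longer output. The slowest branch crosses an edge: 18 instructions and one test.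
    pushStep-runs : ∀ {N out p} s run sc → PushInv N out p →
      ∃[ p′ ] ∃[ out′ ] ∃[ sc′ ] ∃[ τ ] τ ℕ.≤ 19 ×
        Runs pushStep (layout p s run out sc) τ (layout p′ s run out′ sc′) ×
        PushInv (suc N) out′ p′ × (∀ {M} → SearchInv M out s → SearchInv M out′ s)
    pushStep-runs {p = mkPush v (suc e) i k queue mass x ρ r} s run sc inv =
      _ , _ , _ , 19 , ℕ.≤-refl ,
      ifnz-then _ (proj₂ (passOne-runs {s = s} e<)) ,
      passOn-inv inv e< (*-congʳ (*-congʳ (+-congʳ one≈1))) ,
      SearchInv-∷
      where
      e< : e ℕ.< indeg v
      e< = PushInv.e≤indeg inv
    pushStep-runs {p = mkPush v zero i k queue mass x ρ r} s run sc inv with i ℕ.<? k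
    ... | no i≮k =
      _ , _ , _ , 7 , ℕ.m≤m+n 7 12 ,
      ifnz-else ≡.refl (straight-runs _ (sub , _) ⨾
        ifnz-else (ℕ.m≤n⇒m∸n≡0 (ℕ.≮⇒≥ i≮k)) (proj₂ (rewind-runs {s = s}))) ,
      rewind-inv inv (ℕ.≤-antisym (PushInv.i≤k inv) (ℕ.≮⇒≥ i≮k)) (halves x) ,
      λ inv′ → inv′
    ... | yes i<k with PushInv.queue-ok inv i i<k
    ...   | w , qi , _ with x ≤? r (name w)
    ...     | yes x≤r =
      _ , _ , _ , 17 , ℕ.m≤m+n 17 2 ,
      ifnz-else ≡.refl (straight-runs _ (sub , _) ⨾
        ifnz-then (ℕ.>-nonZero (ℕ.m<n⇒0<n∸m i<k)) (proj₂ (start-runs {s = s} {w = w} qi x≤r))) ,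
      start-inv inv i<k qi x≤r , λ inv′ → inv′
    ...     | no x≰r =
      _ , _ , _ , 13 , ℕ.m≤m+n 13 6 ,
      ifnz-else ≡.refl (straight-runs _ (sub , _) ⨾
        ifnz-then (ℕ.>-nonZero (ℕ.m<n⇒0<n∸m i<k)) (proj₂ (ignore-runs {s = s} {w = w} qi x≰r))) ,
      skip-inv inv i<k qi x≰r , λ inv′ → inv′

    seen-runs : ∀ {v d stack cells visited p run out sc} (d< : d ℕ.< indeg v) →
      visited (name (parent v (fromℕ< d<))) ≢ 0 →
      ∃[ sc′ ] Runs visitOne (layout p (mkSearch v (suc d) stack cells visited) run out sc) 7
        (layout p (mkSearch v d stack cells visited) run out sc′)
    seen-runs {v} d< seen = _ ,
      (straight-runs _ (sub , PARENT v (fromℕ< d<) ≡.refl (≡.sym (Fin.toℕ-fromℕ< d<)) ,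
                        add , add , add , load 2 (name u) ≡.refl ≡.refl , _) ⨾
       ifnz-then (ℕ.≢-nonZero seen) skip-runs)
      where u = parent v (fromℕ< d<)

    visit-runs : ∀ {v d stack cells visited p run out sc} (d< : d ℕ.< indeg v) →
      let u = parent v (fromℕ< d<) in visited (name u) ≡ 0 →
      ∃[ sc′ ] Runs visitOne (layout p (mkSearch v (suc d) stack cells visited) run out sc) 14
        (layout p (mkSearch v d (u ∷ stack) (cells [ List.length stack ↦ name u ])
                                            (visited [ name u ↦ 1 ])) run (u ∷ out) sc′)
    visit-runs {v} {stack = stack} d< new = _ ,
      (straight-runs _ (sub , PARENT v (fromℕ< d<) ≡.refl (≡.sym (Fin.toℕ-fromℕ< d<)) ,
                        add , add , add , load 2 (name u) ≡.refl new , _) ⨾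
       ifnz-else ≡.refl (straight-runs _
         (store 2 (name u) ≡.refl , add , add , add , store 1 (List.length stack) ≡.refl ,
          add , emit u ≡.refl , _)))
      where u = parent v (fromℕ< d<)

    pop-runs : ∀ {v w st cells visited p run out sc} → cells (List.length st) ≡ name w →
      ∃[ sc′ ] Runs pop (layout p (mkSearch v 0 (w ∷ st) cells visited) run out sc) 6
        (layout p (mkSearch w (indeg w) st cells visited) run out sc′)
    pop-runs {w = w} {st} top = _ ,
      straight-runs _ (sub , add , add , add , load 1 (List.length st) ≡.refl top , INDEG w ≡.refl , _)

    pending : Search → ℕ
    pending s = Search.e s ℕ.+ List.length (Search.stack s)

    searchStep-runs : ∀ {M out s} p run sc → SearchInv (suc M) out s → pending s ≢ 0 →
      ∃[ s′ ] ∃[ out′ ] ∃[ sc′ ] ∃[ τ ] τ ℕ.≤ 15 ×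
        Runs searchStep (layout p s run out sc) τ (layout p s′ run out′ sc′) ×
        SearchInv M out′ s′ × (∀ {N} → PushInv N out p → PushInv N out′ p)
    searchStep-runs {s = mkSearch v zero [] cells visited} p run sc inv ≢0 = contradiction ≡.refl ≢0
    searchStep-runs {s = mkSearch v zero (w ∷ st) cells visited} p run sc inv _ =
      _ , _ , _ , 7 , ℕ.m≤m+n 7 8 ,
      ifnz-else ≡.refl (proj₂ (pop-runs {st = st} {p = p} (proj₁ (SearchInv.stack-ok inv)))) ,
      pop-inv inv , λ inv′ → inv′
    searchStep-runs {s = mkSearch v (suc d) st cells visited} p run sc inv _
      with visited (name (parent v (fromℕ< (SearchInv.e≤indeg inv)))) ℕ.≟ 0
    ... | yes new =
      _ , _ , _ , 15 , ℕ.≤-refl ,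
      ifnz-then _ (proj₂ (visit-runs {stack = st} {p = p} (SearchInv.e≤indeg inv) new)) ,
      visit-inv inv (SearchInv.e≤indeg inv) new , PushInv-∷
    ... | no seen =
      _ , _ , _ , 8 , ℕ.m≤m+n 8 7 ,
      ifnz-then _ (proj₂ (seen-runs {stack = st} {p = p} (SearchInv.e≤indeg inv) seen)) ,
      seen-inv inv (SearchInv.e≤indeg inv) seen , λ inv′ → inv′

    Below : Push → Set ℓ₂
    Below p = δ * α * Push.mass p ≤ Push.x p + Push.x p

    -- `Xrun` can vanish for two reasons, a sufficiently precise push or a finished search, and the
    -- superset property is proved differently for each.
    Status : Push → Search → ℕ → Set ℓ₂
    Status p s run = (run ≡ 0 × ¬ Below p) ⊎ (run ≡ pending s × Below p)

    check-runs : ∀ {run} p s out sc →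
      ∃[ run′ ] ∃[ sc′ ] ∃[ τ ] τ ℕ.≤ 5 ×
        Runs check (layout p s run out sc) τ (layout p s run′ out sc′) × Status p s run′
    check-runs p s out sc with δ * α * Push.mass p ≤? Push.x p + Push.x p
    ... | yes below =
      _ , _ , 5 , ℕ.≤-refl ,
      (straight-runs _ (mulR , addR , leqR , _) ⨾
       ifnz-then (≡.subst NonZero (≡.sym (flag-true below)) _) (straight-runs _ (add , _))) ,
      inj₂ (≡.refl , below)
    ... | no above =
      _ , _ , 4 , ℕ.m≤m+n 4 1 ,
      (straight-runs _ (mulR , addR , leqR , _) ⨾ ifnz-else (flag-false above) skip-runs) ,
      inj₁ (flag-false above , above)

    -- To be supplied for the start of the last iteration: the test passed then, but it may fail
    -- afterwards, so the step bound applies to all iterations but one.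
    Running : ℕ → Set (c ⊔ ℓ₁ ⊔ ℓ₂)
    Running N = ∃[ out ] ∃[ p ] PushInv N out p × Below p

    module _ (0<δ : 0# < δ) where

      -- j is the number of iterations, none of which takes more than 40 steps.
      loop : ∀ M {N out p s run sc st} → PushInv N out p → SearchInv M out s →
        Status p s run → st ∼ layout p s run out sc →
        ∃[ j ] ∃[ τ ] ∃[ st′ ] (while Registers.Xrun step ⊢ st ⇓[ τ ] st′) ×
          τ ℕ.≤ suc (j ℕ.* 40) × j ℕ.≤ M × (∀ j′ → j ≡ suc j′ → Running (N ℕ.+ j′)) ×
          (∀ w → Contributing π δ t w → w ∈ output st′)
      loop M {st = st} inv inv′ (inj₁ (≡.refl , above)) st∼ =
        0 , 1 , st , while-z (readX 11 st∼ _) , ℕ.≤-refl , z≤n , (λ _ ()) ,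
        λ w contributing → ≡.subst (w ∈_) (≡.sym (_∼_.∼out st∼))
          (output-superset inv 0<δ above w contributing)
      loop M {s = s} {st = st} inv inv′ (inj₂ (≡.refl , below)) st∼ with pending s ℕ.≟ 0
      ... | yes idle =
        0 , 1 , st , while-z (≡.trans (readX 11 st∼ _) idle) , ℕ.≤-refl , z≤n , (λ _ ()) ,
        λ w contributing → ≡.subst (w ∈_) (≡.sym (_∼_.∼out st∼))
          (idle⇒superset s idle inv′ w contributing)
        where
        idle⇒superset : ∀ {M out} s → pending s ≡ 0 → SearchInv M out s →
                        ∀ w → Contributing π δ t w → w ∈ out
        idle⇒superset (mkSearch v zero [] cells visited) _ = finished-superset 0<δ
      loop zero {s = s} inv inv′ (inj₂ (≡.refl , below)) st∼ | no busy =
        contradiction ≡.refl (busy⇒work s busy inv′)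
        where
        busy⇒work : ∀ {M out} s → pending s ≢ 0 → SearchInv M out s → M ≢ 0
        busy⇒work (mkSearch v zero    []       _ _) ≢0 _ = contradiction ≡.refl ≢0
        busy⇒work (mkSearch v zero    (w ∷ st) _ _) _ = stack-work-positive
        busy⇒work (mkSearch v (suc e) st       _ _) _ = edge-work-positive
      loop (suc M) {N} {out} {p} {s} {sc = sc} inv inv′ (inj₂ (≡.refl , below)) st∼ | no busy
        with pushStep-runs s (pending s) sc inv
      ... | p₁ , out₁ , sc₁ , τ₁ , τ₁≤ , runs₁ , inv₁ , grow₁
        with searchStep-runs p₁ (pending s) sc₁ (grow₁ inv′) busy
      ... | s₂ , out₂ , sc₂ , τ₂ , τ₂≤ , runs₂ , inv₂ , grow₂
        with check-runs {pending s} p₁ s₂ out₂ sc₂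
      ... | run₃ , sc₃ , τ₃ , τ₃≤ , runs₃ , status
        with (runs₁ ⨾ runs₂ ⨾ runs₃) st∼
      ... | st₃ , body , st₃∼
        with loop M (grow₂ inv₁) inv₂ status st₃∼
      ... | j , τ , st′ , rest , τ≤ , j≤M , running , superset =
        suc j , _ , st′ ,
        while-nz (ℕ.≢-nonZero λ eq → busy (≡.trans (≡.sym (readX 11 st∼ _)) eq)) body rest ,
        -- The body takes at most 19 + 15 + 5 steps, and the test of the loop makes 40.
        s≤s (ℕ.≤-trans (ℕ.+-mono-≤ (ℕ.+-mono-≤ τ₁≤ (ℕ.+-mono-≤ τ₂≤ τ₃≤)) τ≤)
                       (ℕ.≤-reflexive (ℕ.+-suc 39 (j ℕ.* 40)))) ,
        s≤s j≤M , running′ , superset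
        where
        running′ : ∀ j′ → suc j ≡ suc j′ → Running (N ℕ.+ j′)
        running′ zero     _  = out , p , ≡.subst (λ N → PushInv N out p) (≡.sym (ℕ.+-identityʳ N)) inv , below
        running′ (suc j′) eq = ≡.subst Running (≡.sym (ℕ.+-suc N j′)) (running j′ (ℕ.suc-injective eq))

      initialMemory : Memory
      initialMemory = memory (name t ∷ Vec.replicate 15 0) (δ ∷ Vec.replicate 7 0#)
                             (Vec.replicate 3 (λ _ → 0)) (λ _ → 0#) []

      initial∼ : initial t δ ∼ initialMemory
      initial∼ = record
        { ∼X      = λ { zero _ → ≡.refl ; (suc i) _ → ≡.sym (get-replicate 15 i) }
        ; ∼Y      = λ { zero _ → ≡.refl ; (suc i) _ → ≡.sym (get-replicate 7 i) }
        ; ∼arrays = λ a _ z → ≡.cong (λ (f : ℕ → ℕ) → f z) (≡.sym (get-replicate {d = λ _ → 0} 3 a))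
        ; ∼reals  = λ _ → ≡.refl
        ; ∼out    = ≡.refl
        }
        where
        get-replicate : ∀ {a} {A : Set a} {d : A} n i → get d (Vec.replicate n d) i ≡ d
        get-replicate zero    i       = ≡.refl
        get-replicate (suc n) zero    = ≡.refl
        get-replicate (suc n) (suc i) = get-replicate n i

      setup-runs : ∃[ sc ] Runs setup initialMemory 22
                     (layout (initialPush one) initialSearch 0 (t ∷ []) sc)
      setup-runs = _ , straight-runs _
        (set , set , set , set , set , set , add , cast , cast , decay , mulR , subR ,
         set , add , storeR (name t) ≡.refl , store 0 0 ≡.refl , store 1 0 ≡.refl ,
         add , add , add , store 2 (name t) ≡.refl , emit t ≡.refl , _)

      -- Outside the iterations there are 22 + 5 + 1 = 28 steps.
      main-runs : ∃[ j ] ∃[ τ ] ∃[ st ] (main ⊢ initial t δ ⇓[ τ ] st) ×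
        τ ℕ.≤ 28 ℕ.+ j ℕ.* 40 × j ℕ.≤ initialWork × (∀ j′ → j ≡ suc j′ → Running j′) ×
        (∀ w → Contributing π δ t w → w ∈ output st)
      main-runs = after-setup (proj₂ setup-runs initial∼)
        where
        Result : Set (c ⊔ ℓ₁ ⊔ ℓ₂)
        Result = ∃[ j ] ∃[ τ ] ∃[ st ] (main ⊢ initial t δ ⇓[ τ ] st) ×
          τ ℕ.≤ 28 ℕ.+ j ℕ.* 40 × j ℕ.≤ initialWork × (∀ j′ → j ≡ suc j′ → Running j′) ×
          (∀ w → Contributing π δ t w → w ∈ output st)
        p = initialPush one
        after-check : ∀ {st st₁ run sc τ₁} → setup ⊢ initial t δ ⇓[ 22 ] st → τ₁ ℕ.≤ 5 →
          Status p initialSearch run → check ⊢ st ⇓[ τ₁ ] st₁ →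
          st₁ ∼ layout p initialSearch run (t ∷ []) sc → Result
        after-check setup⇓ τ₁≤ status check⇓ st₁∼
          with loop initialWork (initialPush-inv one≈1) initialSearch-inv status st₁∼
        ... | j , τ , st′ , rest , τ≤ , j≤ , running , superset =
          j , _ , st′ , seq setup⇓ (seq check⇓ rest) ,
          ℕ.+-monoʳ-≤ 22 (ℕ.≤-trans (ℕ.+-mono-≤ τ₁≤ τ≤) (ℕ.≤-reflexive (ℕ.+-suc 5 (j ℕ.* 40)))) ,
          j≤ , running , superset
        after-setup : ∀ {sc} → ∃[ st ] (setup ⊢ initial t δ ⇓[ 22 ] st) ×
          st ∼ layout p initialSearch 0 (t ∷ []) sc → Result
        after-setup {sc} (st , setup⇓ , st∼) with check-runs {0} p initialSearch (t ∷ []) sc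
        ... | run , sc₁ , τ₁ , τ₁≤ , runs₁ , status =
          let st₁ , check⇓ , st₁∼ = runs₁ st∼ in
          after-check setup⇓ τ₁≤ status check⇓ st₁∼

      steps≤ : ∀ {B} → 1# ≤ B →
        (∀ {q r φ} (f : Flow q r φ) → β * Flow.flow f ≤ B * Flow.mass f + B * Flow.mass f) →
        ∀ j → (∀ j′ → j ≡ suc j′ → Running j′) → α * β * δ * fromℕ (ℕ.pred j) ≤ fromℕ 24 * B
      steps≤ {B} 1≤B flow≤ zero    running =
        ≤-respˡ (sym (zeroʳ _)) (*-nonNeg (fromℕ-nonNeg 24) (≤-trans 0≤1 1≤B))
      steps≤ {B} 1≤B flow≤ (suc j) running with running j ≡.refl
      ... | out , p , inv , below =
        steps-bound inv 0<δ below 1≤B (flow≤ (PushInv.flowing inv))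

      -- 68 is the fixed cost 28 plus the 40 steps of the last iteration, to which the step bound
      -- does not apply; 40 is the cost of an iteration and 24 stems from `steps-bound`.
      C : ℝ
      C = (fromℕ 68 + fromℕ 40 * fromℕ 24) * (α * β) ⁻¹

      0<αβ : 0# < α * β
      0<αβ = *-positive 0<α 0<β

      αβ≤1 : α * β ≤ 1#
      αβ≤1 = ≤-trans (*-monoʳ-≤ 0≤β (proj₁ α<1)) (≤-respˡ (sym (*-identityˡ β)) β≤1)

      1≤outdeg : 1# ≤ outdegℝ t
      1≤outdeg = 1≤fromℕ {outdeg t} (ℕ.>-nonZero⁻¹ (outdeg t) {{outdeg-nonZero t}})

      1≤m : 1# ≤ fromℕ m
      1≤m = ≤-trans 1≤outdeg (≤-respʳ (sym m≈sum) (term≤sum (λ u → fromℕ-nonNeg (outdeg u)) t))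

      1≤Δout : 1# ≤ fromℕ Δout
      1≤Δout = ≤-trans 1≤outdeg (outdeg≤Δout t)

      -- The target itself may have no parents, but it has a child, and that child has `t` as a
      -- parent.
      1≤Δin : 1# ≤ fromℕ Δin
      1≤Δin with edge⇒parent (child-edge t (fromℕ< (ℕ.>-nonZero⁻¹ (outdeg t) {{outdeg-nonZero t}})))
      ... | p , _ = ≤-trans (1≤fromℕ (ℕ.≤-trans (s≤s z≤n) (Fin.toℕ<n p))) (indeg≤Δin _)

      1≤√m : ∀ {s} → IsSqrt (fromℕ m) s → 1# ≤ s
      1≤√m {s} (0≤s , s*s≈m) with 1# ≤? s
      ... | yes 1≤s = 1≤s
      ... | no  1≰s = begin
        1#       ≤⟨ 1≤m ⟩
        fromℕ m  ≈⟨ s*s≈m ⟨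
        s * s    ≤⟨ *-monoˡ-≤ 0≤s (≰⇒≥ 1≰s) ⟩
        s * 1#   ≈⟨ *-identityʳ s ⟩
        s        ∎

      2≤24 : 1# + 1# ≤ fromℕ 24
      2≤24 = +-monoʳ-≤ 1# (x≤x+y (fromℕ-nonNeg 22))

      pred-bound : ∀ j → 28 ℕ.+ j ℕ.* 40 ℕ.≤ 68 ℕ.+ ℕ.pred j ℕ.* 40
      pred-bound zero    = ℕ.m≤m+n 28 40
      pred-bound (suc j) = ℕ.≤-reflexive (≡.sym (ℕ.+-assoc 28 40 (j ℕ.* 40)))

      module _ (δ<1 : δ < 1#) {j τ : ℕ} (τ≤ : τ ℕ.≤ 28 ℕ.+ j ℕ.* 40) where

        time≤local : ∀ {B} → 1# ≤ B → α * β * δ * fromℕ (ℕ.pred j) ≤ fromℕ 24 * B →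
                     fromℕ τ ≤ C * (B / δ)
        time≤local 1≤B steps =
          ≤-local (fromℕ-nonNeg 68) (fromℕ-nonNeg 40) 0<αβ αβ≤1 0<δ (proj₁ δ<1) 1≤B steps
            (fromℕ-affine 68 40 {ℕ.pred j} {τ} (ℕ.≤-trans τ≤ (pred-bound j)))

        time≤global : j ℕ.≤ initialWork → fromℕ τ ≤ C * fromℕ m
        time≤global j≤ =
          ≤-global (fromℕ-nonNeg 68) (fromℕ-nonNeg 40) 2≤24 0<αβ αβ≤1 1≤m
            (≤-trans (fromℕ-mono-≤ {j} {initialWork} j≤) initialWork≤2m)
            (fromℕ-affine 68 40 {j} {τ} (ℕ.≤-trans τ≤ (ℕ.+-monoˡ-≤ (j ℕ.* 40) (ℕ.m≤m+n 28 40))))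

      time≤ : δ < 1# → ∀ √m → IsSqrt (fromℕ m) √m → ∀ {j τ} → τ ℕ.≤ 28 ℕ.+ j ℕ.* 40 →
        j ℕ.≤ initialWork → (∀ j′ → j ≡ suc j′ → Running j′) →
        fromℕ τ ≤ C * ((fromℕ Δin / δ) ⊓ (fromℕ Δout / δ) ⊓ (√m / δ) ⊓ fromℕ m)
      time≤ δ<1 √m isSqrt {j} {τ} τ≤ j≤ running =
        ≤-*⊓ C _ _ (≤-*⊓ C _ _ (≤-*⊓ C _ _
          (local 1≤Δin Flow.flow≤Δin)
          (local 1≤Δout Flow.flow≤Δout))
          (local (1≤√m isSqrt) λ f → Flow.flow≤√m f isSqrt (<-≤-trans 0<1 (1≤√m isSqrt))))
          (time≤global δ<1 {j} {τ} τ≤ j≤)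
        where
        local : ∀ {B} → 1# ≤ B →
          (∀ {q r φ} (f : Flow q r φ) → β * Flow.flow f ≤ B * Flow.mass f + B * Flow.mass f) →
          fromℕ τ ≤ C * (B / δ)
        local 1≤B flow≤ = time≤local δ<1 {j} {τ} τ≤ 1≤B (steps≤ 1≤B flow≤ j running)
      main-correct : δ < 1# → ∀ √m → IsSqrt (fromℕ m) √m →
        ComputesSupersetWithin R α main A π t δ
          (C * ((fromℕ Δin / δ) ⊓ (fromℕ Δout / δ) ⊓ (√m / δ) ⊓ fromℕ m))
      main-correct δ<1 √m isSqrt =
        let j , τ , st , run , τ≤ , j≤ , running , superset = main-runs in
        τ , st , run , time≤ δ<1 √m isSqrt {j} {τ} τ≤ j≤ running , superset

theorem1p2 : {c ℓ₁ ℓ₂ : Level} (R : RealField c ℓ₁ ℓ₂) →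
    let open RealField R in
    (α : ℝ) → 0# < α → α < 1# →
    ∃[ P ] ∃[ C ]
    ((G : DiGraph) (A : Access G) →
    let open DiGraph G in
    (π : V → V → ℝ) → PageRank.IsContribution R α G π →
    (√m : ℝ) → IsSqrt (fromℕ m) √m →
    (t : V) (δ : ℝ) → 0# < δ → δ < 1# →
    ComputesSupersetWithin R α P A π t δ
    (C * ((fromℕ Δin / δ) ⊓ (fromℕ Δout / δ) ⊓ (√m / δ) ⊓ fromℕ m)))
theorem1p2 R α 0<α α<1 =
  PushSearch.main , (fromℕ 68 + fromℕ 40 * fromℕ 24) * (α * (1# - α)) ⁻¹ ,
  λ G A π isContribution √m isSqrt t δ 0<δ δ<1 →
    Correctness.main-correct R α 0<α α<1 A π isContribution t δ 0<δ δ<1 √m isSqrt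
  where open RealField R
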